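{- Let $n\geq 2$ and let $\mathcal{G}=\{G_1, G_2, \ldots , G_{2n-2}\}$ be a family of (not necessarily distinct) nearly balanced bipartite graphs on the common vertex set $[2n-1]$ with the common bipartition $(X, Y)$. If $$\rho (G_i) \geq \rho(K_{n-1,n-1}\cup K_1)$$ for every $i\in [2n-2]$, then $\mathcal{G}$ admits a rainbow Hamilton path unless $G_1=G_2=\cdots =G_{2n-2}\cong K_{n-1,n-1}\cup K_1$.
   Context: All graphs are simple and undirected. $[k]=\{1,2,\ldots,k\}$. A bipartite graph with bipartition $(X,Y)$ is nearly balanced if $|X|-|Y|=1$ (up to interchanging the names of $X$ and $Y$). $\rho(G)$ is the spectral radius of $G$, i.e. the maximum modulus of the eigenvalues of its adjacency matrix. $G\cup H$ denotes disjoint union, and $K_{s,t}$ the complete bipartite graph. $G_i=G_j$ means equality as graphs on the labelled vertex set (same edge set), while $\cong$ denotes isomorphism. For a family $\mathcal{G}=\{G_1,\ldots,G_k\}$ of not necessarily distinct graphs on the same vertex set $V$ and a graph $H$ with $k$ edges and $V(H)\subseteq V$, $H$ is a rainbow copy in $\mathcal{G}$ if there is a bijection $\phi:E(H)\to[k]$ with $e\in E(G_{\phi(e)})$ for all $e\in E(H)$. A rainbow Hamilton path in $\mathcal{G}$ is such an $H$ that is a path visiting every vertex of $V$ exactly once. -}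

module Defs where

open import Algebra.Bundles.Raw using (RawMonoid)
import Algebra.Definitions.RawMonoid as RawMonoidOps
open import Data.Bool.Base using (Bool; true; false; T; not; _∨_; if_then_else_)
import Data.Bool.Properties as Bool
open import Data.Fin.Base using (Fin; toℕ; splitAt)
import Data.Fin.Base as Fin
import Data.Fin.Properties as Fin
open import Data.Fin.Subset using (Subset; _∈_; ∣_∣)
open import Data.Nat.Base using (ℕ; suc; _≡ᵇ_; _⊔_)
import Data.Nat.Base as ℕ
import Data.Nat.Properties as ℕ
open import Data.Product.Base using (Σ; Σ-syntax; ∃; ∃-syntax; _×_; _,_; proj₁; proj₂)
open import Data.Rational.Base using (ℚ; 0ℚ; 1ℚ; ½)
import Data.Rational.Base as ℚ
import Data.Rational.Properties as ℚ
open import Data.Rational.Solver using (module +-*-Solver)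
open import Data.Sum.Base using (_⊎_; inj₁; inj₂)
open import Function.Bundles using (_↔_; Inverse)
open import Level using (0ℓ)
open import Relation.Binary.PropositionalEquality
open import Relation.Nullary using (¬_; does)

------------------------------------------------------------------------
-- Real numbers: Cauchy sequences of rationals

Eventually : (ℕ → Set) → Set
Eventually P = ∃[ N ] ∀ n → N ℕ.≤ n → P n

IsCauchy : (ℕ → ℚ) → Set
IsCauchy x = ∀ ε → 0ℚ ℚ.< ε →
  ∃[ N ] ∀ m n → N ℕ.≤ m → N ℕ.≤ n → ℚ.∣ x m ℚ.- x n ∣ ℚ.≤ ε

record ℝ : Set where
  constructor mkℝ
  field
    seq    : ℕ → ℚ
    cauchy : IsCauchy seq

open ℝ public

infix 4 _≈ℝ_ _≤ℝ_

-- These relations are records, rather than functions, so that x and y can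
-- be inferred.
record _≈ℝ_ (x y : ℝ) : Set where
  constructor mk≈
  field
    close : ∀ ε → 0ℚ ℚ.< ε → Eventually λ n → ℚ.∣ seq x n ℚ.- seq y n ∣ ℚ.≤ ε

record _≤ℝ_ (x y : ℝ) : Set where
  constructor mk≤
  field
    below : ∀ ε → 0ℚ ℚ.< ε → Eventually λ n → seq x n ℚ.≤ seq y n ℚ.+ ε

open _≈ℝ_ public
open _≤ℝ_ public

-- Closure of Cauchy sequences under the operations; abstract so that these
-- proofs are never unfolded.
private
  abstract
    ½ε+½ε : ∀ ε → ½ ℚ.* ε ℚ.+ ½ ℚ.* ε ≡ ε
    ½ε+½ε ε = trans (sym (ℚ.*-distribʳ-+ ε ½ ½)) (ℚ.*-identityˡ ε)

    0<½ε : ∀ {ε} → 0ℚ ℚ.< ε → 0ℚ ℚ.< ½ ℚ.* ε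
    0<½ε {ε} 0<ε = subst (ℚ._< ½ ℚ.* ε) (ℚ.*-zeroʳ ½) (ℚ.*-monoʳ-<-pos ½ 0<ε)

    const-cauchy : ∀ q → IsCauchy (λ _ → q)
    const-cauchy q ε 0<ε = 0 , λ _ _ _ _ →
      subst (ℚ._≤ ε) (sym (cong ℚ.∣_∣ (ℚ.+-inverseʳ q))) (ℚ.<⇒≤ 0<ε)

    +-cauchy : ∀ {x y} → IsCauchy x → IsCauchy y → IsCauchy (λ n → x n ℚ.+ y n)
    +-cauchy {x} {y} cx cy ε 0<ε
      with cx (½ ℚ.* ε) (0<½ε 0<ε) | cy (½ ℚ.* ε) (0<½ε 0<ε)
    ... | M , px | N , py = M ⊔ N , λ m n p q → begin
        ℚ.∣ (x m ℚ.+ y m) ℚ.- (x n ℚ.+ y n) ∣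
          ≡⟨ cong ℚ.∣_∣ (regroup (x m) (y m) (x n) (y n)) ⟩
        ℚ.∣ (x m ℚ.- x n) ℚ.+ (y m ℚ.- y n) ∣
          ≤⟨ ℚ.∣p+q∣≤∣p∣+∣q∣ (x m ℚ.- x n) (y m ℚ.- y n) ⟩
        ℚ.∣ x m ℚ.- x n ∣ ℚ.+ ℚ.∣ y m ℚ.- y n ∣
          ≤⟨ ℚ.+-mono-≤ (px m n (ℕ.m⊔n≤o⇒m≤o M N p) (ℕ.m⊔n≤o⇒m≤o M N q))
                        (py m n (ℕ.m⊔n≤o⇒n≤o M N p) (ℕ.m⊔n≤o⇒n≤o M N q)) ⟩
        ½ ℚ.* ε ℚ.+ ½ ℚ.* ε
          ≡⟨ ½ε+½ε ε ⟩
        ε ∎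
      where
      open ℚ.≤-Reasoning
      regroup : ∀ a b c d → (a ℚ.+ b) ℚ.- (c ℚ.+ d) ≡ (a ℚ.- c) ℚ.+ (b ℚ.- d)
      regroup = solve 4 (λ a b c d →
        (a :+ b) :+ (:- (c :+ d)) := (a :+ (:- c)) :+ (b :+ (:- d))) refl
        where open +-*-Solver

    neg-cauchy : ∀ {x} → IsCauchy x → IsCauchy (λ n → ℚ.- x n)
    neg-cauchy {x} cx ε 0<ε with cx ε 0<ε
    ... | N , px = N , λ m n p q → subst (ℚ._≤ ε)
        (trans (sym (ℚ.∣-p∣≡∣p∣ (x m ℚ.- x n)))
               (cong ℚ.∣_∣ (ℚ.neg-distrib-+ (x m) (ℚ.- x n))))
        (px m n p q)

    bounded : ∀ {x} → IsCauchy x →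
      ∃[ B ] ℚ.Positive B × Eventually λ n → ℚ.∣ x n ∣ ℚ.≤ B
    bounded {x} cx with cx 1ℚ (ℚ.positive⁻¹ 1ℚ)
    ... | N , px = 1ℚ ℚ.+ ℚ.∣ x N ∣ , ℚ.positive 0<B , N , λ n N≤n → begin
        ℚ.∣ x n ∣                        ≡⟨ cong ℚ.∣_∣ (shift (x n) (x N)) ⟩
        ℚ.∣ (x n ℚ.- x N) ℚ.+ x N ∣      ≤⟨ ℚ.∣p+q∣≤∣p∣+∣q∣ (x n ℚ.- x N) (x N) ⟩
        ℚ.∣ x n ℚ.- x N ∣ ℚ.+ ℚ.∣ x N ∣  ≤⟨ ℚ.+-monoˡ-≤ ℚ.∣ x N ∣ (px n N N≤n ℕ.≤-refl) ⟩
        1ℚ ℚ.+ ℚ.∣ x N ∣                 ∎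
      where
      open ℚ.≤-Reasoning
      0<B : 0ℚ ℚ.< 1ℚ ℚ.+ ℚ.∣ x N ∣
      0<B = ℚ.+-mono-<-≤ (ℚ.positive⁻¹ 1ℚ) (ℚ.0≤∣p∣ (x N))
      shift : ∀ a b → a ≡ (a ℚ.- b) ℚ.+ b
      shift = solve 2 (λ a b → a := (a :+ (:- b)) :+ b) refl
        where open +-*-Solver

    small : ∀ B .{{_ : ℚ.Positive B}} {ε} → 0ℚ ℚ.< ε → ∃[ δ ] 0ℚ ℚ.< δ × B ℚ.* δ ≡ ε
    small B {ε} 0<ε = B⁻¹ ℚ.* ε
        , subst (ℚ._< B⁻¹ ℚ.* ε) (ℚ.*-zeroʳ B⁻¹) (ℚ.*-monoʳ-<-pos B⁻¹ {{ℚ.1/pos⇒pos B}} 0<ε)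
        , trans (sym (ℚ.*-assoc B B⁻¹ ε))
                (trans (cong (ℚ._* ε) (ℚ.*-inverseʳ B {{ℚ.pos⇒nonZero B}})) (ℚ.*-identityˡ ε))
      where
      B⁻¹ : ℚ
      B⁻¹ = (ℚ.1/ B) {{ℚ.pos⇒nonZero B}}

    ∣*∣-≤ : ∀ {a b B δ} .{{_ : ℚ.Positive B}} →
      ℚ.∣ a ∣ ℚ.≤ B → ℚ.∣ b ∣ ℚ.≤ δ → ℚ.∣ a ℚ.* b ∣ ℚ.≤ B ℚ.* δ
    ∣*∣-≤ {a} {b} {B} {δ} a≤B b≤δ = begin
        ℚ.∣ a ℚ.* b ∣        ≡⟨ ℚ.∣p*q∣≡∣p∣*∣q∣ a b ⟩
        ℚ.∣ a ∣ ℚ.* ℚ.∣ b ∣  ≤⟨ ℚ.*-monoʳ-≤-nonNeg ℚ.∣ b ∣ {{ℚ.∣-∣-nonNeg b}} a≤B ⟩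
        B ℚ.* ℚ.∣ b ∣        ≤⟨ ℚ.*-monoˡ-≤-nonNeg B {{ℚ.pos⇒nonNeg B}} b≤δ ⟩
        B ℚ.* δ              ∎
      where open ℚ.≤-Reasoning

    *-diff : ∀ a b c d → a ℚ.* b ℚ.- c ℚ.* d ≡ a ℚ.* (b ℚ.- d) ℚ.+ d ℚ.* (a ℚ.- c)
    *-diff = solve 4 (λ a b c d → (a :* b) :+ (:- (c :* d))
      := (a :* (b :+ (:- d))) :+ (d :* (a :+ (:- c)))) refl
      where open +-*-Solver

    *-close : ∀ a b c d {B C δ η} → ℚ.Positive B → ℚ.Positive C →
      ℚ.∣ a ∣ ℚ.≤ B → ℚ.∣ b ℚ.- d ∣ ℚ.≤ δ → ℚ.∣ d ∣ ℚ.≤ C → ℚ.∣ a ℚ.- c ∣ ℚ.≤ η →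
      ℚ.∣ a ℚ.* b ℚ.- c ℚ.* d ∣ ℚ.≤ B ℚ.* δ ℚ.+ C ℚ.* η
    *-close a b c d {B} {C} {δ} {η} 0<B 0<C a≤B b-d≤δ d≤C a-c≤η = begin
        ℚ.∣ a ℚ.* b ℚ.- c ℚ.* d ∣
          ≡⟨ cong ℚ.∣_∣ (*-diff a b c d) ⟩
        ℚ.∣ a ℚ.* (b ℚ.- d) ℚ.+ d ℚ.* (a ℚ.- c) ∣
          ≤⟨ ℚ.∣p+q∣≤∣p∣+∣q∣ (a ℚ.* (b ℚ.- d)) (d ℚ.* (a ℚ.- c)) ⟩
        ℚ.∣ a ℚ.* (b ℚ.- d) ∣ ℚ.+ ℚ.∣ d ℚ.* (a ℚ.- c) ∣
          ≤⟨ ℚ.+-mono-≤ (∣*∣-≤ {a} {b ℚ.- d} {B} {δ} {{0<B}} a≤B b-d≤δ)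
                        (∣*∣-≤ {d} {a ℚ.- c} {C} {η} {{0<C}} d≤C a-c≤η) ⟩
        B ℚ.* δ ℚ.+ C ℚ.* η ∎
      where open ℚ.≤-Reasoning

    *-cauchy : ∀ {x y} → IsCauchy x → IsCauchy y → IsCauchy (λ n → x n ℚ.* y n)
    *-cauchy {x} {y} cx cy ε 0<ε =
      let B , 0<B , K , ∣x∣≤B = bounded {x} cx
          C , 0<C , L , ∣y∣≤C = bounded {y} cy
          δ , 0<δ , Bδ≡½ε = small B {{0<B}} (0<½ε 0<ε)
          η , 0<η , Cη≡½ε = small C {{0<C}} (0<½ε 0<ε)
          M , py = cy δ 0<δ
          N , px = cx η 0<η
      in (K ⊔ L) ⊔ (M ⊔ N) , λ m n p q →
        let p₁ = ℕ.m⊔n≤o⇒m≤o (K ⊔ L) (M ⊔ N) p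
            p₂ = ℕ.m⊔n≤o⇒n≤o (K ⊔ L) (M ⊔ N) p
            q₁ = ℕ.m⊔n≤o⇒m≤o (K ⊔ L) (M ⊔ N) q
            q₂ = ℕ.m⊔n≤o⇒n≤o (K ⊔ L) (M ⊔ N) q
        in subst (ℚ.∣ x m ℚ.* y m ℚ.- x n ℚ.* y n ∣ ℚ.≤_)
             (trans (cong₂ ℚ._+_ Bδ≡½ε Cη≡½ε) (½ε+½ε ε))
             (*-close (x m) (y m) (x n) (y n) {B} {C} {δ} {η} 0<B 0<C
               (∣x∣≤B m (ℕ.m⊔n≤o⇒m≤o K L p₁))
               (py m n (ℕ.m⊔n≤o⇒m≤o M N p₂) (ℕ.m⊔n≤o⇒m≤o M N q₂))
               (∣y∣≤C n (ℕ.m⊔n≤o⇒n≤o K L q₁))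
               (px m n (ℕ.m⊔n≤o⇒n≤o M N p₂) (ℕ.m⊔n≤o⇒n≤o M N q₂)))

infixl 6 _+ℝ_ _-ℝ_
infixl 7 _*ℝ_
infix  8 -ℝ_

0ℝ 1ℝ : ℝ
0ℝ = mkℝ (λ _ → 0ℚ) (const-cauchy 0ℚ)
1ℝ = mkℝ (λ _ → 1ℚ) (const-cauchy 1ℚ)

_+ℝ_ _*ℝ_ : ℝ → ℝ → ℝ
x +ℝ y = mkℝ (λ n → seq x n ℚ.+ seq y n) (+-cauchy {seq x} {seq y} (cauchy x) (cauchy y))
x *ℝ y = mkℝ (λ n → seq x n ℚ.* seq y n) (*-cauchy {seq x} {seq y} (cauchy x) (cauchy y))

-ℝ_ : ℝ → ℝ
-ℝ x = mkℝ (λ n → ℚ.- seq x n) (neg-cauchy {seq x} (cauchy x))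

_-ℝ_ : ℝ → ℝ → ℝ
x -ℝ y = x +ℝ (-ℝ y)

------------------------------------------------------------------------
-- Complex numbers

record ℂ : Set where
  constructor _+i_
  field
    re im : ℝ

open ℂ public

infix  4 _≈ℂ_
infixl 6 _+ℂ_
infixl 7 _*ℂ_

record _≈ℂ_ (z w : ℂ) : Set where
  constructor mk≈ℂ
  field
    re-≈ : re z ≈ℝ re w
    im-≈ : im z ≈ℝ im w

open _≈ℂ_ public

0ℂ 1ℂ : ℂ
0ℂ = 0ℝ +i 0ℝ
1ℂ = 1ℝ +i 0ℝ

_+ℂ_ _*ℂ_ : ℂ → ℂ → ℂ
z +ℂ w = (re z +ℝ re w) +i (im z +ℝ im w)
z *ℂ w = (re z *ℝ re w -ℝ im z *ℝ im w) +i (re z *ℝ im w +ℝ im z *ℝ re w)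

-- The relation ∣ z ∣ = r, with ∣ z ∣ the nonnegative square root of
-- re z ² + im z ².
IsModulus : ℂ → ℝ → Set
IsModulus z r = 0ℝ ≤ℝ r × r *ℝ r ≈ℝ re z *ℝ re z +ℝ im z *ℝ im z

+ℂ-rawMonoid : RawMonoid 0ℓ 0ℓ
+ℂ-rawMonoid = record { Carrier = ℂ ; _≈_ = _≈ℂ_ ; _∙_ = _+ℂ_ ; ε = 0ℂ }

open RawMonoidOps +ℂ-rawMonoid public using () renaming (sum to sumℂ)

------------------------------------------------------------------------
-- Eigenvalues and spectral radius

Matrix : ℕ → Set
Matrix m = Fin m → Fin m → ℂ

IsEigenvalue : ∀ {m} → Matrix m → ℂ → Set
IsEigenvalue {m} A z = Σ[ v ∈ (Fin m → ℂ) ]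
  ¬ (∀ i → v i ≈ℂ 0ℂ) ×
  (∀ i → sumℂ (λ j → A i j *ℂ v j) ≈ℂ z *ℂ v i)

record MaxModulusOfEigenvalues {m} (A : Matrix m) (r : ℝ) : Set where
  field
    attained : ∃[ z ] IsEigenvalue A z × IsModulus z r
    maximal  : ∀ z s → IsEigenvalue A z → IsModulus z s → s ≤ℝ r

------------------------------------------------------------------------
-- Simple graphs

record Graph (m : ℕ) : Set where
  field
    adj        : Fin m → Fin m → Bool
    adj-sym    : ∀ u v → adj u v ≡ adj v u
    adj-irrefl : ∀ v → adj v v ≡ false

  Adj : Fin m → Fin m → Set
  Adj u v = T (adj u v)

  -- Each edge is listed once, with its smaller endpoint first; both
  -- components of the proof are propositions, so _≡_ on Edge is equality
  -- of edges.
  Edge : Set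
  Edge = Σ[ u ∈ Fin m ] Σ[ v ∈ Fin m ] (u Fin.< v × Adj u v)

open Graph public using (adj; Adj; Edge)

private variable m k : ℕ

infix 4 _≐_ _≅_

-- Equality as labelled graphs.
_≐_ : Graph m → Graph m → Set
G ≐ H = ∀ u v → adj G u v ≡ adj H u v

_≅_ : Graph m → Graph k → Set
_≅_ {m} {k} G H = Σ[ f ∈ Fin m ↔ Fin k ]
  ∀ u v → adj G u v ≡ adj H (Inverse.to f u) (Inverse.to f v)

adjacencyMatrix : Graph m → Matrix m
adjacencyMatrix G i j = if adj G i j then 1ℂ else 0ℂ

IsSpectralRadius : Graph m → ℝ → Set
IsSpectralRadius G = MaxModulusOfEigenvalues (adjacencyMatrix G)

-- ρ(G) ≥ ρ(H).  The spectral radius is characterised uniquely up to _≈ℝ_.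
infix 4 _ρ≥ρ_
_ρ≥ρ_ : Graph m → Graph k → Set
G ρ≥ρ H = ∃[ r ] ∃[ s ] IsSpectralRadius G r × IsSpectralRadius H s × s ≤ℝ r

------------------------------------------------------------------------
-- Particular graphs

K : ∀ m → Graph m
K m = record
  { adj        = λ u v → not (does (u Fin.≟ v))
  ; adj-sym    = λ u v → cong not (does-sym u v)
  ; adj-irrefl = λ v → cong not (does-refl v)
  }
  where
  open import Relation.Nullary.Decidable using (dec-true; does-⇔)
  open import Function.Bundles using (mk⇔)
  does-sym : ∀ (u v : Fin m) → does (u Fin.≟ v) ≡ does (v Fin.≟ u)
  does-sym u v = does-⇔ (mk⇔ sym sym) (u Fin.≟ v) (v Fin.≟ u)
  does-refl : ∀ (v : Fin m) → does (v Fin.≟ v) ≡ true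
  does-refl v = dec-true (v Fin.≟ v) refl

K[_,_] : ∀ s t → Graph (s ℕ.+ t)
K[ s , t ] = record
  { adj        = λ u v → joined (splitAt s u) (splitAt s v)
  ; adj-sym    = λ u v → joined-sym (splitAt s u) (splitAt s v)
  ; adj-irrefl = λ v → joined-irrefl (splitAt s v)
  }
  where
  joined : Fin s ⊎ Fin t → Fin s ⊎ Fin t → Bool
  joined (inj₁ _) (inj₁ _) = false
  joined (inj₁ _) (inj₂ _) = true
  joined (inj₂ _) (inj₁ _) = true
  joined (inj₂ _) (inj₂ _) = false
  joined-sym : ∀ a b → joined a b ≡ joined b a
  joined-sym (inj₁ _) (inj₁ _) = refl
  joined-sym (inj₁ _) (inj₂ _) = refl
  joined-sym (inj₂ _) (inj₁ _) = refl
  joined-sym (inj₂ _) (inj₂ _) = refl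
  joined-irrefl : ∀ a → joined a a ≡ false
  joined-irrefl (inj₁ _) = refl
  joined-irrefl (inj₂ _) = refl

infixr 6 _⊍_

_⊍_ : Graph m → Graph k → Graph (m ℕ.+ k)
_⊍_ {m} {k} G H = record
  { adj        = λ u v → joined (splitAt m u) (splitAt m v)
  ; adj-sym    = λ u v → joined-sym (splitAt m u) (splitAt m v)
  ; adj-irrefl = λ v → joined-irrefl (splitAt m v)
  }
  where
  joined : Fin m ⊎ Fin k → Fin m ⊎ Fin k → Bool
  joined (inj₁ a) (inj₁ b) = adj G a b
  joined (inj₁ _) (inj₂ _) = false
  joined (inj₂ _) (inj₁ _) = false
  joined (inj₂ a) (inj₂ b) = adj H a b
  joined-sym : ∀ a b → joined a b ≡ joined b a
  joined-sym (inj₁ a) (inj₁ b) = Graph.adj-sym G a b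
  joined-sym (inj₁ _) (inj₂ _) = refl
  joined-sym (inj₂ _) (inj₁ _) = refl
  joined-sym (inj₂ a) (inj₂ b) = Graph.adj-sym H a b
  joined-irrefl : ∀ a → joined a a ≡ false
  joined-irrefl (inj₁ a) = Graph.adj-irrefl G a
  joined-irrefl (inj₂ a) = Graph.adj-irrefl H a

-- The path 0 — 1 — ⋯ — (m - 1).
Path : ∀ m → Graph m
Path m = record
  { adj        = λ i j → (suc (toℕ i) ≡ᵇ toℕ j) ∨ (suc (toℕ j) ≡ᵇ toℕ i)
  ; adj-sym    = λ i j → Bool.∨-comm (suc (toℕ i) ≡ᵇ toℕ j) _
  ; adj-irrefl = λ i → cong₂ _∨_ (n+1≢n (toℕ i)) (n+1≢n (toℕ i))
  }
  where
  n+1≢n : ∀ n → (suc n ≡ᵇ n) ≡ false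
  n+1≢n ℕ.zero  = refl
  n+1≢n (suc n) = n+1≢n n

------------------------------------------------------------------------
-- Bipartitions

record IsBipartition (X Y : Subset m) : Set where
  field
    cover    : ∀ v → v ∈ X ⊎ v ∈ Y
    disjoint : ∀ v → ¬ (v ∈ X × v ∈ Y)

NearlyBalanced : Subset m → Subset m → Set
NearlyBalanced X Y = ∣ X ∣ ≡ suc ∣ Y ∣ ⊎ ∣ Y ∣ ≡ suc ∣ X ∣

IsBipartite : Graph m → Subset m → Subset m → Set
IsBipartite G X Y = ∀ u v → Adj G u v → (u ∈ X × v ∈ Y) ⊎ (u ∈ Y × v ∈ X)

------------------------------------------------------------------------
-- Rainbow Hamilton paths

Family : ℕ → ℕ → Set
Family k m = Fin k → Graph m

-- H is given on the whole vertex set; a subgraph on fewer vertices is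
-- represented by adding isolated vertices, which does not affect E(H).
IsRainbowCopy : Family k m → Graph m → Set
IsRainbowCopy {k} 𝒢 H = Σ[ φ ∈ Edge H ↔ Fin k ]
  ∀ (e : Edge H) → Adj (𝒢 (Inverse.to φ e)) (proj₁ e) (proj₁ (proj₂ e))

-- A path through every vertex exactly once: the isomorphism with Path m
-- is an enumeration of the vertices along H.
IsHamiltonPath : Graph m → Set
IsHamiltonPath {m} H = Path m ≅ H

HasRainbowHamiltonPath : Family k m → Set
HasRainbowHamiltonPath {m = m} 𝒢 = Σ[ H ∈ Graph m ] IsHamiltonPath H × IsRainbowCopy 𝒢 H

{-# OPTIONS --safe #-}

-- For a bipartite graph with e edges ρ² ≤ e, by the Cauchy–Schwarz inequality, and
-- equality makes the graph complete bipartite up to isolated vertices.  With m = n - 1,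
-- each G_i therefore misses fewer than m of the m(m + 1) pairs in X × Y, or else exactly
-- the m pairs at one vertex of the larger part (it is then a "star" below).
--
-- Kelmans' operation, which moves to u the neighbours of v that u lacks, applied to all
-- graphs of the family at once, creates no rainbow Hamilton path: such a path can be
-- pulled back by exchanging u and v and by reversing the stretch between them.  When some
-- graph is not a star, one may hence assume that all graphs are closed downwards in one
-- part and upwards in the other.  A missing pair then forces the rectangle it spans to be
-- missing, which is too large if the pair lies on the path x₀ y₀ x₁ y₁ ⋯ y_{m-1} x_m.
-- Only stars at x_m lack an edge of this path, namely the last one, which is given to a
-- graph that is not a star.  If all graphs are stars but not at the same vertex, one
-- operation replaces one of them by a complete graph.

module Submission where

open import Defs
open import Data.Nat using (ℕ; _≤_; _*_; _∸_)
open import Data.Fin.Subset using (Subset)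
open import Data.Product using (_×_)
open import Relation.Nullary using (¬_)

open import Algebra.Bundles using (CommutativeRing)
open import Data.Bool.Base using (Bool; true; false; T; not; _∨_; _∧_; if_then_else_)
import Data.Bool.Properties as Bool
open import Data.Empty using (⊥; ⊥-elim)
open import Data.Fin.Base using (Fin; zero; suc; toℕ)
import Data.Fin.Base as Fin
import Data.Fin.Permutation as Perm
open import Data.Fin.Permutation.Components using (transpose)
import Data.Fin.Properties as Fin
open import Data.Fin.Subset using (_∈_; _∉_; ∣_∣; ∁; inside; outside)
import Data.Fin.Subset.Properties as Subset
import Data.Integer.Base as ℤ
open import Data.Nat.Base using (zero; suc; _+_; _<_; z≤n; s≤s)
import Data.Nat.Base as ℕ
open import Data.Nat.Induction using (<-wellFounded)
import Data.Nat.Properties as ℕ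
open import Data.Product.Base using (Σ-syntax; ∃-syntax; _,_; proj₁; proj₂)
open import Data.Rational.Base using (ℚ; 0ℚ; 1ℚ; ½)
import Data.Rational.Base as ℚ
import Data.Rational.Properties as ℚ
open import Data.Rational.Solver using (module +-*-Solver)
open import Data.Sum.Base using (_⊎_; inj₁; inj₂; map; map₁; swap)
open import Data.Vec.Base using (_∷_; here; there)
open import Data.Vec.Functional using (removeAt)
open import Function.Base using (_∘_; id; case_of_; flip)
open import Function.Bundles using (_↔_; mk↔ₛ′)
open import Induction.WellFounded using (Acc; acc)
open import Relation.Binary.Definitions using (tri<; tri≈; tri>)
open import Relation.Binary.PropositionalEquality
open import Relation.Nullary using (yes; no; does)
open import Relation.Nullary.Decidable using (Dec; dec-true; dec-false; _×-dec_)
open import Relation.Nullary.Negation using (contradiction)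

import Algebra.Properties.Semiring.Sum ℕ.+-*-semiring as ∑
import Algebra.Properties.Semiring.Sum (CommutativeRing.semiring ℚ.+-*-commutativeRing) as ∑ℚ
import Algebra.Properties.Semiring.Mult (CommutativeRing.semiring ℚ.+-*-commutativeRing) as Mult
open +-*-Solver using (solve; _:=_; _:+_; _:*_; _:-_; :-_; con)

-- A path pulled back through Kelmans' operation may have two edges at `u`, only one of which owes
-- its place to the operation. The stretch between `u` and `v` separates them: at most one edge at
-- `u` lies inside it and at most one outside. Each side therefore decides by its own edge at `u`
-- whether to exchange `u` and `v`. Edges at `v` survive either decision, because `v` keeps only the
-- common neighbours. The four pairs of decisions are realised by relabelling, by reversing the
-- stretch, by both or by neither.
--
-- The threshold of m² edges comes from the eigenvalue m of K_{m,m} ∪ K_1, whose eigenvector is the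
-- indicator of the non-isolated vertices.
--
-- Equality of reals is undecidable. Cauchy-Schwarz is therefore kept as a rational identity with an
-- explicit nonnegative deficit at every index of the sequences, and its equality case says that the
-- deficits tend to 0. Case distinctions are made on adjacency only; that the eigenvector is nonzero
-- is used to refute that all its entries vanish. Eigenvalues are complex by definition, so real and
-- imaginary parts are carried along together.

private variable
  a b k l : ℕ
  V C : Set

-- Arrangements of vertices and colours along a path

abstract
  reflect : ℕ → ℕ → ℕ → ℕ
  reflect i j t with i ℕ.≤? t | t ℕ.≤? j
  ... | yes _ | yes _ = i + j ∸ t
  ... | _     | _     = t

  reflect-within : ∀ {i j t} → i ≤ t → t ≤ j → reflect i j t ≡ i + j ∸ t
  reflect-within {i} {j} {t} i≤t t≤j with i ℕ.≤? t | t ℕ.≤? j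
  ... | yes _ | yes _ = refl
  ... | yes _ | no t≰j = contradiction t≤j t≰j
  ... | no i≰t | _ = contradiction i≤t i≰t

  reflect-before : ∀ {i j t} → t < i → reflect i j t ≡ t
  reflect-before {i} {j} {t} t<i with i ℕ.≤? t | t ℕ.≤? j
  ... | yes i≤t | _ = contradiction i≤t (ℕ.<⇒≱ t<i)
  ... | no _ | _ = refl

  reflect-after : ∀ {i j t} → j < t → reflect i j t ≡ t
  reflect-after {i} {j} {t} j<t with i ℕ.≤? t | t ℕ.≤? j
  ... | _ | yes t≤j = contradiction t≤j (ℕ.<⇒≱ j<t)
  ... | yes _ | no _ = refl
  ... | no _ | no _ = refl

data Location (i j t : ℕ) : Set where
  before : t < i → Location i j t
  within : i ≤ t → t ≤ j → Location i j t
  after  : j < t → Location i j t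

locate : ∀ i j t → Location i j t
locate i j t with i ℕ.≤? t | t ℕ.≤? j
... | no i≰t  | _ = before (ℕ.≰⇒> i≰t)
... | yes i≤t | yes t≤j = within i≤t t≤j
... | yes _   | no t≰j = after (ℕ.≰⇒> t≰j)

i≤i+j∸t : ∀ i {j t} → t ≤ j → i ≤ i + j ∸ t
i≤i+j∸t i {j} {t} t≤j = subst (i ≤_) (sym (ℕ.+-∸-assoc i t≤j)) (ℕ.m≤m+n i _)

i+j∸t≤j : ∀ {i t} j → i ≤ t → i + j ∸ t ≤ j
i+j∸t≤j {i} {t} j i≤t = ℕ.m≤n+o⇒m∸n≤o (i + j) t (ℕ.+-monoˡ-≤ j i≤t)

reflect-involutive : ∀ i j t → reflect i j (reflect i j t) ≡ t
reflect-involutive i j t with locate i j t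
... | before t<i = trans (cong (reflect i j) (reflect-before t<i)) (reflect-before t<i)
... | after j<t = trans (cong (reflect i j) (reflect-after j<t)) (reflect-after j<t)
... | within i≤t t≤j = begin
  reflect i j (reflect i j t)  ≡⟨ cong (reflect i j) (reflect-within i≤t t≤j) ⟩
  reflect i j (i + j ∸ t)      ≡⟨ reflect-within (i≤i+j∸t i t≤j) (i+j∸t≤j j i≤t) ⟩
  i + j ∸ (i + j ∸ t)          ≡⟨ ℕ.m∸[m∸n]≡n (ℕ.≤-trans t≤j (ℕ.m≤n+m j i)) ⟩
  t                            ∎
  where open ≡-Reasoning

reflect-≤ : ∀ {i j t k} → j ≤ k → t ≤ k → reflect i j t ≤ k
reflect-≤ {i} {j} {t} {k} j≤k t≤k with locate i j t
... | before t<i = subst (_≤ k) (sym (reflect-before t<i)) t≤k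
... | after j<t = subst (_≤ k) (sym (reflect-after j<t)) t≤k
... | within i≤t t≤j = subst (_≤ k) (sym (reflect-within i≤t t≤j))
                         (ℕ.≤-trans (i+j∸t≤j j i≤t) j≤k)

-- Vertices and colours are indexed by all of ℕ to keep arithmetic out of `Fin`; values past the end
-- are unconstrained. The inverses `position` and `step` express that every vertex and every colour
-- occurs exactly once.
record Arrangement (k : ℕ) (V C : Set) : Set where
  field
    vertex          : ℕ → V
    position        : V → ℕ
    position≤       : ∀ v → position v ≤ k
    vertex-position : ∀ v → vertex (position v) ≡ v
    position-vertex : ∀ {t} → t ≤ k → position (vertex t) ≡ t
    colour          : ℕ → C
    step            : C → ℕ
    step<           : ∀ c → step c < k
    colour-step     : ∀ c → colour (step c) ≡ c
    step-colour     : ∀ {t} → t < k → step (colour t) ≡ t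

  Follows : (C → V → V → Set) → Set
  Follows E = ∀ {t} → t < k → E (colour t) (vertex t) (vertex (suc t))

open Arrangement

RainbowPath : ∀ (k : ℕ) {V C : Set} → (C → V → V → Set) → Set
RainbowPath k {V} {C} E = Σ[ A ∈ Arrangement k V C ] Follows A E

relabel : ∀ {W} (f : V → W) (f⁻¹ : W → V) → (∀ v → f⁻¹ (f v) ≡ v) → (∀ w → f (f⁻¹ w) ≡ w) →
  Arrangement k V C → Arrangement k W C
relabel f f⁻¹ f⁻¹f ff⁻¹ A = record
  { vertex          = f ∘ vertex A
  ; position        = position A ∘ f⁻¹
  ; position≤       = position≤ A ∘ f⁻¹
  ; vertex-position = λ w → trans (cong f (vertex-position A (f⁻¹ w))) (ff⁻¹ w)
  ; position-vertex = λ t≤k → trans (cong (position A) (f⁻¹f _)) (position-vertex A t≤k)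
  ; colour          = colour A
  ; step            = step A
  ; step<           = step< A
  ; colour-step     = colour-step A
  ; step-colour     = step-colour A
  }

recolour : (f : C → C) → (∀ c → f (f c) ≡ c) → Arrangement k V C → Arrangement k V C
recolour f ff A = record
  { vertex          = vertex A
  ; position        = position A
  ; position≤       = position≤ A
  ; vertex-position = vertex-position A
  ; position-vertex = position-vertex A
  ; colour          = f ∘ colour A
  ; step            = step A ∘ f
  ; step<           = step< A ∘ f
  ; colour-step     = λ c → trans (cong f (colour-step A (f c))) (ff c)
  ; step-colour     = λ t<k → trans (cong (step A) (ff _)) (step-colour A t<k)
  }

-- The stretch runs from position i to position j + 1.
reverseStretch : ∀ (i j : ℕ) → suc j ≤ k → Arrangement k V C → Arrangement k V C
reverseStretch {k = suc k} i j (s≤s j≤k) A = record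
  { vertex          = vertex A ∘ reflect i (suc j)
  ; position        = reflect i (suc j) ∘ position A
  ; position≤       = λ v → reflect-≤ (s≤s j≤k) (position≤ A v)
  ; vertex-position = λ v → trans (cong (vertex A) (reflect-involutive i (suc j) _)) (vertex-position A v)
  ; position-vertex = λ {t} t≤k → trans
      (cong (reflect i (suc j)) (position-vertex A (reflect-≤ (s≤s j≤k) t≤k)))
      (reflect-involutive i (suc j) t)
  -- The stretch has one edge fewer than vertices: step t becomes the backward step from
  -- `suc (i + j ∸ t)` to `i + j ∸ t`.
  ; colour          = colour A ∘ reflect i j
  ; step            = reflect i j ∘ step A
  ; step<           = λ c → s≤s (reflect-≤ j≤k (ℕ.s≤s⁻¹ (step< A c)))
  ; colour-step     = λ c → trans (cong (colour A) (reflect-involutive i j _)) (colour-step A c)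
  ; step-colour     = λ {t} t<k → trans
      (cong (reflect i j) (step-colour A (s≤s (reflect-≤ j≤k (ℕ.s≤s⁻¹ t<k)))))
      (reflect-involutive i j t)
  }

-- Reversing the stretch between two vertices has the same effect as exchanging
-- the two vertices on the edges outside the stretch only.
reverseStretch-follows : ∀ (E : C → V → V → Set) → (∀ {c x y} → E c x y → E c y x) →
  (A : Arrangement k V C) → ∀ {i j} → i ≤ j → (j<k : j < k) → (τ : V → V) →
  τ (vertex A i) ≡ vertex A (suc j) → τ (vertex A (suc j)) ≡ vertex A i →
  (∀ {t} → t ≤ k → t ≢ i → t ≢ suc j → τ (vertex A t) ≡ vertex A t) →
  (∀ {t} → t < k → t < i ⊎ j < t → E (colour A t) (τ (vertex A t)) (τ (vertex A (suc t)))) →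
  (∀ {t} → t < k → i ≤ t → t ≤ j → E (colour A t) (vertex A t) (vertex A (suc t))) →
  Follows (reverseStretch i j j<k A) E
reverseStretch-follows {k = suc k} E E-sym A {i} {j} i≤j (s≤s j≤k) τ τi τj τ-fix outer inner {t} t<k
  with locate i j t
... | before t<i = subst₂ (E _) (sym (before-τ (ℕ.<⇒≤ t<k) (ℕ.<⇒≤ t<i))) (sym (before-τ t<k t<i))
      (subst (λ s → E (colour A s) (τ (vertex A t)) (τ (vertex A (suc t)))) (sym (reflect-before t<i)) (outer t<k (inj₁ t<i)))
  where
  -- The bound includes t = i, where the edge entering the stretch now meets its other end, just as
  -- `τ` prescribes.
  before-τ : ∀ {t} → t ≤ suc k → t ≤ i → vertex A (reflect i (suc j) t) ≡ τ (vertex A t)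
  before-τ {t} t≤k t≤i with ℕ.m≤n⇒m<n∨m≡n t≤i
  ... | inj₁ t<i = trans (cong (vertex A) (reflect-before t<i))
        (sym (τ-fix t≤k (ℕ.<⇒≢ t<i) (ℕ.<⇒≢ (ℕ.<-≤-trans t<i (ℕ.m≤n⇒m≤1+n i≤j)))))
  ... | inj₂ refl = trans (cong (vertex A) (trans (reflect-within ℕ.≤-refl (ℕ.m≤n⇒m≤1+n i≤j))
          (ℕ.m+n∸m≡n i (suc j)))) (sym τi)
... | after j<t = subst₂ (E _) (sym (after-τ (ℕ.<⇒≤ t<k) j<t)) (sym (after-τ t<k (ℕ.m≤n⇒m≤1+n j<t)))
      (subst (λ s → E (colour A s) (τ (vertex A t)) (τ (vertex A (suc t)))) (sym (reflect-after j<t)) (outer t<k (inj₂ j<t)))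
  where
  after-τ : ∀ {t} → t ≤ suc k → j < t → vertex A (reflect i (suc j) t) ≡ τ (vertex A t)
  after-τ {t} t≤k j<t with ℕ.m≤n⇒m<n∨m≡n j<t
  ... | inj₁ 1+j<t = trans (cong (vertex A) (reflect-after 1+j<t))
        (sym (τ-fix t≤k (ℕ.>⇒≢ (ℕ.≤-<-trans i≤j j<t)) (ℕ.>⇒≢ 1+j<t)))
  ... | inj₂ refl = trans (cong (vertex A) (trans (reflect-within (ℕ.m≤n⇒m≤1+n i≤j) ℕ.≤-refl)
          (ℕ.m+n∸n≡m i (suc j)))) (sym τj)
... | within i≤t t≤j = subst₂ (E _) (sym (cong (vertex A) left)) (sym (cong (vertex A) right))
      (subst (λ s → E (colour A s) (vertex A (suc (i + j ∸ t))) (vertex A (i + j ∸ t))) (sym (reflect-within i≤t t≤j))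
        (E-sym (inner (s≤s (ℕ.≤-trans (i+j∸t≤j j i≤t) j≤k)) (i≤i+j∸t i t≤j) (i+j∸t≤j j i≤t))))
  where
  left : reflect i (suc j) t ≡ suc (i + j ∸ t)
  left = trans (reflect-within i≤t (ℕ.m≤n⇒m≤1+n t≤j))
    (trans (cong (_∸ t) (ℕ.+-suc i j)) (ℕ.+-∸-assoc 1 (ℕ.≤-trans t≤j (ℕ.m≤n+m j i))))
  right : reflect i (suc j) (suc t) ≡ i + j ∸ t
  right = trans (reflect-within (ℕ.m≤n⇒m≤1+n i≤t) (s≤s t≤j)) (cong (_∸ suc t) (ℕ.+-suc i j))

power : (V → V) → Bool → V → V
power τ false = id
power τ true  = τ

-- Every edge of A lies on one of two sides, and each side contains at most one
-- edge at u and at most one at v; on each side separately the exchange τ of u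
-- and v can be carried out on the edges.
record Toggle (A : Arrangement k V C) (τ : V → V) (u v : V) : Set₁ where
  field
    side   : ℕ → Bool
    uTime  : Bool → ℕ
    vTime  : Bool → ℕ
    uTouch : ∀ {t} → t < k → vertex A t ≡ u ⊎ vertex A (suc t) ≡ u → t ≡ uTime (side t)
    vTouch : ∀ {t} → t < k → vertex A t ≡ v ⊎ vertex A (suc t) ≡ v → t ≡ vTime (side t)
    toggle : ∀ (E : C → V → V → Set) → (∀ {c x y} → E c x y → E c y x) →
      (f : Bool → Bool) →
      (∀ {t} → t < k → E (colour A t) (power τ (f (side t)) (vertex A t))
                                      (power τ (f (side t)) (vertex A (suc t)))) →
      RainbowPath k E

module _ (A : Arrangement k V C) (τ : V → V) (ττ : ∀ v → τ (τ v) ≡ v) {u v : V}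
  (τu : τ u ≡ v) (τv : τ v ≡ u) (τ-fix : ∀ {x} → x ≢ u → x ≢ v → τ x ≡ x) where

  private
    at : ∀ {t x} → t ≤ k → vertex A t ≡ x → t ≡ position A x
    at t≤k refl = sym (position-vertex A t≤k)

  toggle-ordered : position A u < position A v → Toggle A τ u v
  toggle-ordered pu<pv = record
    { side   = sideOf
    -- If `u` is the first vertex of the path, or `v` the last, no outer step touches it, and the
    -- value on the outer side is a mere default.
    ; uTime  = λ s → if s then i else ℕ.pred i
    ; vTime  = λ s → if s then j else suc j
    ; uTouch = uTouch
    ; vTouch = vTouch
    ; toggle = toggle
    }
    where
    i = position A u
    j = ℕ.pred (position A v)
    1+j≡pv : suc j ≡ position A v
    1+j≡pv = ℕ.suc-pred (position A v) {{ℕ.>-nonZero (ℕ.≤-<-trans z≤n pu<pv)}}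
    i≤j : i ≤ j
    i≤j = ℕ.s≤s⁻¹ (subst (i <_) (sym 1+j≡pv) pu<pv)
    j<k : j < k
    j<k = subst (_≤ k) (sym 1+j≡pv) (position≤ A v)
    sideOf : ℕ → Bool
    sideOf t with locate i j t
    ... | within _ _ = true
    ... | _ = false
    uTouch : ∀ {t} → t < k → vertex A t ≡ u ⊎ vertex A (suc t) ≡ u →
      t ≡ (if sideOf t then i else ℕ.pred i)
    uTouch {t} t<k eq with locate i j t
    uTouch {t} t<k (inj₁ eq) | within _ _ = at (ℕ.<⇒≤ t<k) eq
    uTouch {t} t<k (inj₂ eq) | within i≤t _ = contradiction (subst (_≤ t) (sym (at t<k eq)) i≤t) ℕ.1+n≰n
    uTouch {t} t<k (inj₁ eq) | before t<i = contradiction (at (ℕ.<⇒≤ t<k) eq) (ℕ.<⇒≢ t<i)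
    uTouch {t} t<k (inj₂ eq) | before t<i = cong ℕ.pred (at t<k eq)
    uTouch {t} t<k (inj₁ eq) | after j<t = contradiction (subst (_≤ j) (sym (at (ℕ.<⇒≤ t<k) eq)) i≤j) (ℕ.<⇒≱ j<t)
    uTouch {t} t<k (inj₂ eq) | after j<t = contradiction (subst (_≤ j) (sym (at t<k eq)) i≤j) (ℕ.<⇒≱ (ℕ.m≤n⇒m≤1+n j<t))
    vTouch : ∀ {t} → t < k → vertex A t ≡ v ⊎ vertex A (suc t) ≡ v →
      t ≡ (if sideOf t then j else suc j)
    vTouch {t} t<k eq with locate i j t
    vTouch {t} t<k (inj₁ eq) | within _ t≤j =
      contradiction (subst (_≤ j) (trans (at (ℕ.<⇒≤ t<k) eq) (sym 1+j≡pv)) t≤j) ℕ.1+n≰n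
    vTouch {t} t<k (inj₂ eq) | within _ _ = ℕ.suc-injective (trans (at t<k eq) (sym 1+j≡pv))
    vTouch {t} t<k (inj₁ eq) | before t<i =
      contradiction (ℕ.<-trans (subst (_< i) (at (ℕ.<⇒≤ t<k) eq) t<i) pu<pv) (ℕ.<-irrefl refl)
    vTouch {t} t<k (inj₂ eq) | before t<i =
      contradiction (ℕ.≤-<-trans (subst (_≤ i) (at t<k eq) t<i) pu<pv) (ℕ.<-irrefl refl)
    vTouch {t} t<k (inj₁ eq) | after j<t = trans (at (ℕ.<⇒≤ t<k) eq) (sym 1+j≡pv)
    vTouch {t} t<k (inj₂ eq) | after j<t =
      contradiction (subst (j <_) (ℕ.suc-injective (trans (at t<k eq) (sym 1+j≡pv))) j<t) (ℕ.<-irrefl refl)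
    vi : vertex A i ≡ u
    vi = vertex-position A u
    vj : vertex A (suc j) ≡ v
    vj = trans (cong (vertex A) 1+j≡pv) (vertex-position A v)
    outerOnly : ∀ (E : _ → _ → _ → Set) → (∀ {c x y} → E c x y → E c y x) →
      (∀ {t} → t < k → E (colour A t) (power τ (not (sideOf t)) (vertex A t))
                                      (power τ (not (sideOf t)) (vertex A (suc t)))) →
      RainbowPath k E
    outerOnly E E-sym ok = reverseStretch i j j<k A ,
      reverseStretch-follows E E-sym A i≤j j<k τ
        (trans (cong τ vi) (trans τu (sym vj))) (trans (cong τ vj) (trans τv (sym vi)))
        (λ t≤k t≢i t≢1+j → τ-fix (λ eq → t≢i (at t≤k eq)) (λ eq → t≢1+j (trans (at t≤k eq) (sym 1+j≡pv))))
        outer inner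
      where
      outer : ∀ {t} → t < k → t < i ⊎ j < t → E (colour A t) (τ (vertex A t)) (τ (vertex A (suc t)))
      outer {t} t<k out with locate i j t | ok t<k
      ... | before _ | e = e
      ... | after _  | e = e
      outer {t} t<k (inj₁ t<i) | within i≤t _ | _ = contradiction i≤t (ℕ.<⇒≱ t<i)
      outer {t} t<k (inj₂ j<t) | within _ t≤j | _ = contradiction t≤j (ℕ.<⇒≱ j<t)
      inner : ∀ {t} → t < k → i ≤ t → t ≤ j → E (colour A t) (vertex A t) (vertex A (suc t))
      inner {t} t<k i≤t t≤j with locate i j t | ok t<k
      ... | within _ _ | e = e
      ... | before t<i | _ = contradiction i≤t (ℕ.<⇒≱ t<i)
      ... | after j<t  | _ = contradiction t≤j (ℕ.<⇒≱ j<t)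
    everywhere : ∀ {E : _ → _ → _ → Set} →
      RainbowPath k (λ c x y → E c (τ x) (τ y)) → RainbowPath k E
    everywhere (B , ok) = relabel τ τ ττ ττ B , ok
    toggle : ∀ (E : _ → _ → _ → Set) → (∀ {c x y} → E c x y → E c y x) → (f : Bool → Bool) →
      (∀ {t} → t < k → E (colour A t) (power τ (f (sideOf t)) (vertex A t))
                                      (power τ (f (sideOf t)) (vertex A (suc t)))) →
      RainbowPath k E
    toggle E E-sym f ok with f false in ff | f true in ft
    ... | false | false = A , λ {t} t<k → plain (f-const (sideOf t)) (ok t<k)
      where
      f-const : ∀ s → f s ≡ false
      f-const false = ff
      f-const true  = ft
      plain : ∀ {s c x y} → s ≡ false → E c (power τ s x) (power τ s y) → E c x y
      plain refl e = e
    ... | true | true = everywhere {E} (A , λ {t} t<k → plain (f-const (sideOf t)) (ok t<k))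
      where
      f-const : ∀ s → f s ≡ true
      f-const false = ff
      f-const true  = ft
      plain : ∀ {s c x y} → s ≡ true → E c (power τ s x) (power τ s y) → E c (τ x) (τ y)
      plain refl e = e
    ... | true | false = outerOnly E E-sym λ {t} t<k → plain (f-not (sideOf t)) (ok t<k)
      where
      f-not : ∀ s → f s ≡ not s
      f-not false = ff
      f-not true  = ft
      plain : ∀ {s s′ c x y} → s ≡ s′ → E c (power τ s x) (power τ s y) → E c (power τ s′ x) (power τ s′ y)
      plain refl e = e
    -- Exchanging inside only amounts to exchanging everywhere and once more outside, since `τ` is
    -- an involution.
    ... | false | true = everywhere {E} (outerOnly (λ c x y → E c (τ x) (τ y)) E-sym
            λ {t} t<k → plain (sideOf t) (f-id (sideOf t)) (ok t<k))
      where
      f-id : ∀ s → f s ≡ s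
      f-id false = ff
      f-id true  = ft
      plain : ∀ {c x y r} s → r ≡ s → E c (power τ r x) (power τ r y) →
        E c (τ (power τ (not s) x)) (τ (power τ (not s) y))
      plain {c} false refl e = subst₂ (E c) (sym (ττ _)) (sym (ττ _)) e
      plain true refl e = e

-- The notion is symmetric in `u` and `v`, so whichever comes first on the path starts the stretch.
-- This is why `Toggle` records the steps at `v` as well.
toggleAt : (A : Arrangement k V C) (τ : V → V) → (∀ v → τ (τ v) ≡ v) → ∀ {u v} → u ≢ v →
  τ u ≡ v → τ v ≡ u → (∀ {x} → x ≢ u → x ≢ v → τ x ≡ x) → Toggle A τ u v
toggleAt A τ ττ {u} {v} u≢v τu τv τ-fix with ℕ.<-cmp (position A u) (position A v)
... | tri< pu<pv _ _ = toggle-ordered A τ ττ τu τv τ-fix pu<pv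
... | tri≈ _ pu≡pv _ = contradiction
      (trans (sym (vertex-position A u)) (trans (cong (vertex A) pu≡pv) (vertex-position A v))) u≢v
... | tri> _ _ pv<pu = record
  { side   = side
  ; uTime  = vTime
  ; vTime  = uTime
  ; uTouch = vTouch
  ; vTouch = uTouch
  ; toggle = toggle
  }
  where open Toggle (toggle-ordered A τ ττ τv τu (λ x≢v x≢u → τ-fix x≢u x≢v) pv<pu)

-- Kelmans' operation on rainbow paths

transpose-matchˡ : (i j : Fin a) → transpose i j i ≡ j
transpose-matchˡ i j rewrite dec-true (i Fin.≟ i) refl = refl

transpose-matchʳ : (i j : Fin a) → transpose i j j ≡ i
transpose-matchʳ i j with j Fin.≟ i
... | yes j≡i = j≡i
... | no _ rewrite dec-true (j Fin.≟ j) refl = refl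

transpose-mismatch : (i j : Fin a) {x : Fin a} → x ≢ i → x ≢ j → transpose i j x ≡ x
transpose-mismatch i j {x} x≢i x≢j
  rewrite dec-false (x Fin.≟ i) x≢i | dec-false (x Fin.≟ j) x≢j = refl

transpose-involutive : (i j x : Fin a) → transpose i j (transpose i j x) ≡ x
transpose-involutive i j x with x Fin.≟ i
... | yes x≡i = trans (transpose-matchʳ i j) (sym x≡i)
... | no x≢i with x Fin.≟ j
...   | yes x≡j = trans (transpose-matchˡ i j) (sym x≡j)
...   | no x≢j = transpose-mismatch i j x≢i x≢j

-- A bipartite graph with parts Fin a (the rows) and Fin b (the columns).
Grid : ℕ → ℕ → Set
Grid a b = Fin a → Fin b → Bool

joins : Grid a b → Fin a ⊎ Fin b → Fin a ⊎ Fin b → Bool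
joins g (inj₁ x) (inj₂ y) = g x y
joins g (inj₂ y) (inj₁ x) = g x y
joins g (inj₁ _) (inj₁ _) = false
joins g (inj₂ _) (inj₂ _) = false

EdgeIn : (C → Grid a b) → C → Fin a ⊎ Fin b → Fin a ⊎ Fin b → Set
EdgeIn M c p q = T (joins (M c) p q)

joins-sym : (g : Grid a b) → ∀ p q → joins g p q ≡ joins g q p
joins-sym g (inj₁ _) (inj₁ _) = refl
joins-sym g (inj₁ _) (inj₂ _) = refl
joins-sym g (inj₂ _) (inj₁ _) = refl
joins-sym g (inj₂ _) (inj₂ _) = refl

EdgeIn-sym : {M : C → Grid a b} → ∀ {c p q} → EdgeIn M c p q → EdgeIn M c q p
EdgeIn-sym {M = M} {c} {p} {q} = subst T (joins-sym (M c) p q)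

-- The pair of a row and a column behind an edge, whichever way the path traverses it.
record Cell (p q : Fin a ⊎ Fin b) : Set where
  field
    row       : Fin a
    col       : Fin b
    row∈      : p ≡ inj₁ row ⊎ q ≡ inj₁ row
    joins-row : ∀ (g : Grid a b) (π : Fin a → Fin a) s →
      joins g (power (map₁ π) s p) (power (map₁ π) s q) ≡ g (power π s row) col

cell : {g : Grid a b} → ∀ p q → T (joins g p q) → Cell p q
cell (inj₁ x) (inj₂ y) _ = record
  { row = x ; col = y ; row∈ = inj₁ refl
  ; joins-row = λ { _ _ false → refl ; _ _ true → refl } }
cell (inj₂ y) (inj₁ x) _ = record
  { row = x ; col = y ; row∈ = inj₂ refl
  ; joins-row = λ { _ _ false → refl ; _ _ true → refl } }

-- Kelmans' operation: the neighbours of v that u lacks are moved to u.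
slide : (u v : Fin a) → Grid a b → Grid a b
slide u v g x y = if does (x Fin.≟ u) then g u y ∨ g v y
             else if does (x Fin.≟ v) then g u y ∧ g v y
             else g x y

slide-u : ∀ (u v : Fin a) (g : Grid a b) y → slide u v g u y ≡ g u y ∨ g v y
slide-u u v g y rewrite dec-true (u Fin.≟ u) refl = refl

slide-v : ∀ {u v : Fin a} → u ≢ v → (g : Grid a b) → ∀ y → slide u v g v y ≡ g u y ∧ g v y
slide-v {u = u} {v} u≢v g y
  rewrite dec-false (v Fin.≟ u) (u≢v ∘ sym) | dec-true (v Fin.≟ v) refl = refl

slide-other : ∀ {u v x : Fin a} → x ≢ u → x ≢ v → (g : Grid a b) → ∀ y → slide u v g x y ≡ g x y
slide-other {u = u} {v} {x} x≢u x≢v g y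
  rewrite dec-false (x Fin.≟ u) x≢u | dec-false (x Fin.≟ v) x≢v = refl

T-∨ : ∀ {x y} → T (x ∨ y) → T x ⊎ T y
T-∨ {true} _ = inj₁ _
T-∨ {false} t = inj₂ t

T-∧ : ∀ {x y} → T (x ∧ y) → T x × T y
T-∧ {true} {true} _ = _ , _

≡⇒T : ∀ {x} → x ≡ true → T x
≡⇒T refl = _

-- Only an edge at `u` constrains the choice of `s`. In row `v` the slide leaves a pair only if both
-- `u` and `v` had it, so either choice works; the other rows are untouched by slide and exchange
-- alike.
slide-restore : ∀ {u v : Fin a} → u ≢ v → (g : Grid a b) → ∀ {x y} s →
  (x ≡ u → s ≡ not (g u y)) → T (slide u v g x y) → T (g (power (transpose u v) s x) y)
slide-restore {u = u} {v} u≢v g {x} {y} s at-u t with x Fin.≟ u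
... | yes refl with at-u refl
...   | s≡ with g u y in eq
slide-restore {u = u} {v} u≢v g {x} {y} .false at-u t | yes refl | refl | true = ≡⇒T eq
slide-restore {u = u} {v} u≢v g {x} {y} .true at-u t | yes refl | refl | false
  rewrite transpose-matchˡ u v = t
slide-restore {u = u} {v} u≢v g {x} {y} s at-u t | no x≢u with x Fin.≟ v
... | no x≢v with s
...   | false = t
...   | true rewrite transpose-mismatch u v x≢u x≢v = t
slide-restore {u = u} {v} u≢v g {x} {y} s at-u t | no x≢u | yes refl with s
... | false = proj₂ (T-∧ {g u y} t)
... | true rewrite transpose-matchʳ u v = proj₁ (T-∧ {g u y} t)

module _ {C : Set} (A : Arrangement k (Fin a ⊎ Fin b) C)
  {u v : Fin a} (u≢v : u ≢ v) where

  rowToggle : Toggle A (map₁ (transpose u v)) (inj₁ u) (inj₁ v)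
  rowToggle = toggleAt A (map₁ (transpose u v))
    (λ { (inj₁ x) → cong inj₁ (transpose-involutive u v x) ; (inj₂ _) → refl })
    (λ { refl → u≢v refl })
    (cong inj₁ (transpose-matchˡ u v)) (cong inj₁ (transpose-matchʳ u v))
    (λ { {inj₁ x} ≢u ≢v → cong inj₁ (transpose-mismatch u v (≢u ∘ cong inj₁) (≢v ∘ cong inj₁))
       ; {inj₂ _} _ _ → refl })

  open Toggle rowToggle public

  -- A side exchanges `u` and `v` exactly when its edge at `u` is missing from the original graph of
  -- that colour. On a side without an edge at `u` the value is arbitrary, and any value will do.
  rule : (C → Grid a b) → Bool → Bool
  rule M s = not (joins (M (colour A (uTime s))) (vertex A (uTime s)) (vertex A (suc (uTime s))))

  rule-at-u : ∀ (M : C → Grid a b) {t} → t < k → (e : Cell (vertex A t) (vertex A (suc t))) →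
    Cell.row e ≡ u → rule M (side t) ≡ not (M (colour A t) u (Cell.col e))
  rule-at-u M {t} t<k e refl =
    subst (λ t′ → not (joins (M (colour A t′)) (vertex A t′) (vertex A (suc t′))) ≡ _)
      (uTouch t<k (Cell.row∈ e)) (cong not (Cell.joins-row e (M (colour A t)) id false))

  toggleCells : (M : C → Grid a b) (f : Bool → Bool) →
    (cells : ∀ {t} → t < k → Cell (vertex A t) (vertex A (suc t))) →
    (∀ {t} (t<k : t < k) → T (M (colour A t) (power (transpose u v) (f (side t)) (Cell.row (cells t<k)))
                                             (Cell.col (cells t<k)))) →
    RainbowPath k (EdgeIn M)
  toggleCells M f cells ok = toggle (EdgeIn M) (λ {c} {p} {q} → EdgeIn-sym {M = M} {c} {p} {q}) f λ {t} t<k →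
    subst T (sym (Cell.joins-row (cells t<k) (M (colour A t)) (transpose u v) (f (side t)))) (ok t<k)

slide-rainbow : ∀ {u v : Fin a} → u ≢ v → (M : C → Grid a b) →
  RainbowPath k (EdgeIn (λ c → slide u v (M c))) → RainbowPath k (EdgeIn M)
slide-rainbow {u = u} {v} u≢v M (A , ok) = toggleCells A u≢v M (rule A u≢v M) cells λ {t} t<k →
  slide-restore u≢v (M (colour A t)) (rule A u≢v M (side A u≢v t)) (rule-at-u A u≢v M t<k (cells t<k))
    (subst T (Cell.joins-row (cells t<k) (slide u v (M (colour A t))) id false) (ok t<k))
  where
  cells : ∀ {t} → t < _ → Cell (vertex A t) (vertex A (suc t))
  cells {t} t<k = cell (vertex A t) (vertex A (suc t)) (ok t<k)

IsStar : Grid a b → Fin a → Set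
IsStar g x = (∀ y → g x y ≡ false) × (∀ x′ y → x′ ≢ x → g x′ y ≡ true)

slide-star : ∀ {u v x : Fin a} {g : Grid a b} → u ≢ v → IsStar g u → x ≢ v → ∀ y →
  slide u v g x y ≡ true
slide-star {u = u} {v} {x} {g} u≢v (_ , g≢u) x≢v y with x Fin.≟ u
... | yes refl = trans (cong (g u y ∨_) (g≢u v y (u≢v ∘ sym))) (Bool.∨-zeroʳ (g u y))
... | no x≢u rewrite dec-false (x Fin.≟ v) x≢v = g≢u x y x≢u

full : Grid a b
full _ _ = true

recolourPath : {E : C → V → V → Set} (π : C → C) → (∀ c → π (π c) ≡ c) →
  RainbowPath k (λ c → E (π c)) → RainbowPath k E
recolourPath π ππ (A , ok) = recolour π ππ A , ok

-- Sliding would turn both colours p and q into the star at v.  Colour q may even be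
-- made complete instead: if the path uses q at v and this edge has to move to u,
-- which q misses, then exchanging colours p and q repairs the path.
exchange-rainbow : ∀ {u v : Fin a} → u ≢ v → (M : Fin l → Grid a b) → ∀ {p q} → p ≢ q →
  IsStar (M p) v → IsStar (M q) u →
  RainbowPath k (EdgeIn (λ c → if does (c Fin.≟ q) then full else slide u v (M c))) →
  RainbowPath k (EdgeIn M)
exchange-rainbow {k = k} {u = u} {v} u≢v M {p} {q} p≢q (pv , p≢v) (qu , q≢u) (A , ok) = main
  where
  M₀ : _ → Grid _ _
  M₀ c = if does (c Fin.≟ q) then full else slide u v (M c)
  cells : ∀ {t} → t < _ → Cell (vertex A t) (vertex A (suc t))
  cells {t} t<k = cell (vertex A t) (vertex A (suc t)) (ok t<k)
  module _ {t : ℕ} (t<k : t < k) where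
    x = Cell.row (cells t<k)
    y = Cell.col (cells t<k)
    c = colour A t
  ok₀ : ∀ {t} (t<k : t < _) → T (M₀ (c t<k) (x t<k) (y t<k))
  ok₀ t<k = subst T (Cell.joins-row (cells t<k) (M₀ (c t<k)) id false) (ok t<k)
  slid : ∀ {t} (t<k : t < _) → c t<k ≢ q → T (slide u v (M (c t<k)) (x t<k) (y t<k))
  slid t<k c≢q = subst (λ d → T ((if d then full else slide u v (M (c t<k))) (x t<k) (y t<k)))
    (dec-false (c t<k Fin.≟ q) c≢q) (ok₀ t<k)
  tq = step A q
  tq<k = step< A q
  at-tq : ∀ {t} → t < _ → colour A t ≡ q → t ≡ tq
  at-tq t<k refl = sym (step-colour A t<k)
  p-avoids-v : ∀ {t} (t<k : t < _) → c t<k ≡ p → x t<k ≢ v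
  p-avoids-v {t} t<k c≡p x≡v = subst T slide≡false (slid t<k (λ c≡q → p≢q (trans (sym c≡p) c≡q)))
    where
    slide≡false : slide u v (M (c t<k)) (x t<k) (y t<k) ≡ false
    slide≡false = begin
      slide u v (M (c t<k)) (x t<k) (y t<k)  ≡⟨ cong₂ (λ c x → slide u v (M c) x (y t<k)) c≡p x≡v ⟩
      slide u v (M p) v (y t<k)              ≡⟨ slide-v u≢v (M p) (y t<k) ⟩
      M p u (y t<k) ∧ M p v (y t<k)          ≡⟨ cong (M p u (y t<k) ∧_) (pv (y t<k)) ⟩
      M p u (y t<k) ∧ false                  ≡⟨ Bool.∧-zeroʳ _ ⟩
      false                                  ∎
      where open ≡-Reasoning

  -- The slide turns the star q at `u` into the star at `v`. An edge of colour q off row `v` is thus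
  -- present even without completing q, and the path follows the slid family.
  q-avoids-v : (∀ {t} (t<k : t < _) → c t<k ≡ q → x t<k ≢ v) → RainbowPath _ (EdgeIn M)
  q-avoids-v q-avoids = slide-rainbow u≢v M (A , λ {t} t<k →
    subst T (sym (Cell.joins-row (cells t<k) (slide u v (M (c t<k))) id false)) (valid t<k))
    where
    valid : ∀ {t} (t<k : t < _) → T (slide u v (M (c t<k)) (x t<k) (y t<k))
    valid {t} t<k = case c t<k Fin.≟ q of λ
      { (no c≢q)  → slid t<k c≢q
      ; (yes c≡q) → ≡⇒T (trans (cong (λ d → slide u v (M d) (x t<k) (y t<k)) c≡q)
                      (slide-star u≢v (qu , q≢u) (q-avoids t<k c≡q) (y t<k)))
      }

  module _ (q-at-v : ∀ {t} (t<k : t < _) → c t<k ≡ q → x t<k ≡ v) where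
    s = side A u≢v tq
    f = rule A u≢v M

    keep : f s ≡ false → RainbowPath _ (EdgeIn M)
    keep fs≡false = toggleCells A u≢v M f cells valid
      where
      valid : ∀ {t} (t<k : t < _) →
        T (M (c t<k) (power (transpose u v) (f (side A u≢v t)) (x t<k)) (y t<k))
      valid {t} t<k = case c t<k Fin.≟ q of λ
        { (no c≢q)  → slide-restore u≢v (M (c t<k)) (f (side A u≢v t))
                        (rule-at-u A u≢v M t<k (cells t<k)) (slid t<k c≢q)
        ; (yes c≡q) → ≡⇒T (begin
            M (c t<k) (power (transpose u v) (f (side A u≢v t)) (x t<k)) (y t<k)
              ≡⟨ cong₂ (λ d r → M d (power (transpose u v) r (x t<k)) (y t<k)) c≡q
                   (trans (cong (f ∘ side A u≢v) (at-tq t<k c≡q)) fs≡false) ⟩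
            M q (x t<k) (y t<k)
              ≡⟨ q≢u (x t<k) (y t<k) (λ x≡u → u≢v (trans (sym x≡u) (q-at-v t<k c≡q))) ⟩
            true ∎)
        }
        where open ≡-Reasoning

    exchange : f s ≡ true → RainbowPath _ (EdgeIn M)
    exchange fs≡true = recolourPath {E = EdgeIn M} (transpose p q) (transpose-involutive p q)
      (toggleCells A u≢v M′ f′ cells valid)
      where
      M′ : _ → Grid _ _
      M′ = M ∘ transpose p q
      f′ : Bool → Bool
      -- The side of the edge coloured q must exchange, to bring that edge to row `u`. This does no
      -- harm to an edge at `u` on the same side: with colour p it is recoloured q, which misses all
      -- of row `u`; with any other colour it is missing from its own graph, because the original
      -- rule was to exchange here.
      f′ s′ = if does (s′ Bool.≟ s) then true else rule A u≢v M′ s′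
      side-q : ∀ {t} (t<k : t < _) → c t<k ≡ q → f′ (side A u≢v t) ≡ true
      side-q t<k c≡q = trans (cong (f′ ∘ side A u≢v) (at-tq t<k c≡q))
        (cong (λ d → if d then true else rule A u≢v M′ s) (dec-true (s Bool.≟ s) refl))
      valid-q : ∀ {t} (t<k : t < _) → c t<k ≡ q →
        M′ (c t<k) (power (transpose u v) (f′ (side A u≢v t)) (x t<k)) (y t<k) ≡ true
      valid-q {t} t<k c≡q = begin
        M′ (c t<k) (power (transpose u v) (f′ (side A u≢v t)) (x t<k)) (y t<k)
          ≡⟨ cong₂ (λ d z → M d z (y t<k)) (trans (cong (transpose p q) c≡q) (transpose-matchʳ p q))
               (trans (cong₂ (power (transpose u v)) (side-q t<k c≡q) (q-at-v t<k c≡q))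
                 (transpose-matchʳ u v)) ⟩
        M p u (y t<k)
          ≡⟨ p≢v u (y t<k) u≢v ⟩
        true ∎
        where open ≡-Reasoning
      f′-at-u : ∀ {t} (t<k : t < _) → x t<k ≡ u →
        (side A u≢v t ≡ s → M (c t<k) u (y t<k) ≡ not (f s) → M′ (c t<k) u (y t<k) ≡ false) →
        f′ (side A u≢v t) ≡ not (M′ (c t<k) u (y t<k))
      f′-at-u {t} t<k x≡u same with side A u≢v t Bool.≟ s
      ... | no _ = rule-at-u A u≢v M′ t<k (cells t<k) x≡u
      ... | yes side≡s = cong not (sym (same side≡s (begin
        M (c t<k) u (y t<k)              ≡⟨ Bool.not-involutive _ ⟨
        not (not (M (c t<k) u (y t<k)))  ≡⟨ cong not (rule-at-u A u≢v M t<k (cells t<k) x≡u) ⟨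
        not (f (side A u≢v t))           ≡⟨ cong (not ∘ f) side≡s ⟩
        not (f s)                        ∎)))
        where open ≡-Reasoning
      valid : ∀ {t} (t<k : t < _) →
        T (M′ (c t<k) (power (transpose u v) (f′ (side A u≢v t)) (x t<k)) (y t<k))
      valid {t} t<k = case c t<k Fin.≟ q of λ
        { (yes c≡q) → ≡⇒T (valid-q t<k c≡q)
        ; (no c≢q)  → case c t<k Fin.≟ p of λ
          { (yes c≡p) →
              let p↦q : transpose p q (c t<k) ≡ q
                  p↦q = trans (cong (transpose p q) c≡p) (transpose-matchˡ p q)
              in slide-restore u≢v (M′ (c t<k)) (f′ (side A u≢v t))
                   (λ x≡u → f′-at-u t<k x≡u
                     (λ _ _ → trans (cong (λ d → M d u (y t<k)) p↦q) (qu (y t<k))))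
                   (≡⇒T (trans (cong (λ d → slide u v (M d) (x t<k) (y t<k)) p↦q)
                     (slide-star u≢v (qu , q≢u) (p-avoids-v t<k c≡p) (y t<k))))
          ; (no c≢p) →
              let fixed : transpose p q (c t<k) ≡ c t<k
                  fixed = transpose-mismatch p q c≢p c≢q
              in slide-restore u≢v (M′ (c t<k)) (f′ (side A u≢v t))
                   (λ x≡u → f′-at-u t<k x≡u
                     (λ _ eq → trans (cong (λ d → M d u (y t<k)) fixed) (trans eq (cong not fs≡true))))
                   (subst (λ d → T (slide u v (M d) (x t<k) (y t<k))) (sym fixed) (slid t<k c≢q))
          }
        }

  q-row : ∀ {t} (t<k : t < _) → c t<k ≡ q → x t<k ≡ x tq<k
  q-row t<k c≡q = relocate (at-tq t<k c≡q) t<k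
    where
    relocate : ∀ {t} → t ≡ tq → (t<k : t < _) → x t<k ≡ x tq<k
    relocate refl t<k = cong (λ lt → x lt) (ℕ.<-irrelevant t<k tq<k)

  main : RainbowPath _ (EdgeIn M)
  main with x tq<k Fin.≟ v
  ... | no xq≢v = q-avoids-v λ t<k c≡q x≡v → xq≢v (trans (sym (q-row t<k c≡q)) x≡v)
  ... | yes xq≡v with rule A u≢v M (side A u≢v tq) in fs
  ...   | true  = exchange (λ t<k c≡q → trans (q-row t<k c≡q) xq≡v) fs
  ...   | false = keep (λ t<k c≡q → trans (q-row t<k c≡q) xq≡v) fs

-- Compression

sum-mono-≤ : {f g : Fin a → ℕ} → (∀ i → f i ≤ g i) → ∑.sum f ≤ ∑.sum g
sum-mono-≤ {zero} f≤g = z≤n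
sum-mono-≤ {suc a} f≤g = ℕ.+-mono-≤ (f≤g zero) (sum-mono-≤ (f≤g ∘ suc))

sum-mono-< : {f g : Fin a → ℕ} → (∀ i → f i ≤ g i) → ∀ i → f i < g i → ∑.sum f < ∑.sum g
sum-mono-< f≤g zero f<g = ℕ.+-mono-<-≤ f<g (sum-mono-≤ (f≤g ∘ suc))
sum-mono-< f≤g (suc i) f<g = ℕ.+-mono-≤-< (f≤g zero) (sum-mono-< (f≤g ∘ suc) i f<g)

sum-differ₁ : (f g : Fin a → ℕ) (u : Fin a) → (∀ x → x ≢ u → f x ≡ g x) →
  ∑.sum f + g u ≡ ∑.sum g + f u
sum-differ₁ f g zero agree = begin
  f zero + ∑.sum (f ∘ suc) + g zero  ≡⟨ cong (λ s → f zero + s + g zero) (∑.sum-cong-≗ λ i → agree (suc i) λ ()) ⟩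
  f zero + ∑.sum (g ∘ suc) + g zero  ≡⟨ ℕ.+-comm _ (g zero) ⟩
  g zero + (f zero + ∑.sum (g ∘ suc))  ≡⟨ cong (g zero +_) (ℕ.+-comm (f zero) _) ⟩
  g zero + (∑.sum (g ∘ suc) + f zero)  ≡⟨ ℕ.+-assoc (g zero) _ _ ⟨
  g zero + ∑.sum (g ∘ suc) + f zero    ∎
  where open ≡-Reasoning
sum-differ₁ f g (suc u) agree = begin
  f zero + ∑.sum (f ∘ suc) + g (suc u)    ≡⟨ ℕ.+-assoc (f zero) _ _ ⟩
  f zero + (∑.sum (f ∘ suc) + g (suc u))  ≡⟨ cong₂ _+_ (agree zero λ ())
      (sum-differ₁ (f ∘ suc) (g ∘ suc) u (λ x x≢u → agree (suc x) (x≢u ∘ Fin.suc-injective))) ⟩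
  g zero + (∑.sum (g ∘ suc) + f (suc u))  ≡⟨ ℕ.+-assoc (g zero) _ _ ⟨
  g zero + ∑.sum (g ∘ suc) + f (suc u)    ∎
  where open ≡-Reasoning

-- Stated additively to avoid truncated subtraction. The function `h` changes `f` at `u` alone and
-- splits the step into two changes at one place.
sum-differ₂ : (f g : Fin a → ℕ) {u v : Fin a} → u ≢ v → (∀ x → x ≢ u → x ≢ v → f x ≡ g x) →
  ∑.sum f + (g u + g v) ≡ ∑.sum g + (f u + f v)
sum-differ₂ f g {u} {v} u≢v agree = begin
  ∑.sum f + (g u + g v)  ≡⟨ ℕ.+-assoc (∑.sum f) (g u) (g v) ⟨
  ∑.sum f + g u + g v    ≡⟨ cong (λ s → ∑.sum f + s + g v) h-u ⟨
  ∑.sum f + h u + g v    ≡⟨ cong (_+ g v) (sum-differ₁ f h u (λ x x≢u → sym (h-other x≢u))) ⟩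
  ∑.sum h + f u + g v    ≡⟨ ℕ.+-assoc (∑.sum h) (f u) (g v) ⟩
  ∑.sum h + (f u + g v)  ≡⟨ cong (∑.sum h +_) (ℕ.+-comm (f u) (g v)) ⟩
  ∑.sum h + (g v + f u)  ≡⟨ ℕ.+-assoc (∑.sum h) (g v) (f u) ⟨
  ∑.sum h + g v + f u    ≡⟨ cong (_+ f u) (sum-differ₁ h g v h-agree) ⟩
  ∑.sum g + h v + f u    ≡⟨ cong (λ s → ∑.sum g + s + f u) (h-other (u≢v ∘ sym)) ⟩
  ∑.sum g + f v + f u    ≡⟨ ℕ.+-assoc (∑.sum g) (f v) (f u) ⟩
  ∑.sum g + (f v + f u)  ≡⟨ cong (∑.sum g +_) (ℕ.+-comm (f v) (f u)) ⟩
  ∑.sum g + (f u + f v)  ∎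
  where
  open ≡-Reasoning
  h : Fin _ → ℕ
  h x = if does (x Fin.≟ u) then g u else f x
  h-u : h u ≡ g u
  h-u rewrite dec-true (u Fin.≟ u) refl = refl
  h-other : ∀ {x} → x ≢ u → h x ≡ f x
  h-other {x} x≢u rewrite dec-false (x Fin.≟ u) x≢u = refl
  h-agree : ∀ x → x ≢ v → h x ≡ g x
  h-agree x x≢v with x Fin.≟ u
  ... | yes refl = refl
  ... | no x≢u = agree x x≢u x≢v

sum-upset : (f : Fin a → ℕ) (x : Fin a) → (∀ x′ → x Fin.≤ x′ → 1 ≤ f x′) → a ∸ toℕ x ≤ ∑.sum f
sum-upset {suc a} f zero 1≤f = ℕ.+-mono-≤ (1≤f zero z≤n) (all (f ∘ suc) (λ x → 1≤f (suc x) z≤n))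
  where
  all : ∀ {a} (f : Fin a → ℕ) → (∀ x → 1 ≤ f x) → a ≤ ∑.sum f
  all {zero} f 1≤f = z≤n
  all {suc a} f 1≤f = ℕ.+-mono-≤ (1≤f zero) (all (f ∘ suc) (1≤f ∘ suc))
sum-upset {suc a} f (suc x) 1≤f =
  ℕ.≤-trans (sum-upset (f ∘ suc) x (λ x′ x≤x′ → 1≤f (suc x′) (s≤s x≤x′))) (ℕ.m≤n+m _ (f zero))

sum-downset : (f : Fin a → ℕ) (x : Fin a) (c : ℕ) → (∀ x′ → x′ Fin.≤ x → c ≤ f x′) →
  suc (toℕ x) * c ≤ ∑.sum f
sum-downset {suc a} f zero c c≤f = ℕ.+-mono-≤ (c≤f zero z≤n) z≤n
sum-downset {suc a} f (suc x) c c≤f =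
  ℕ.+-mono-≤ (c≤f zero z≤n) (sum-downset (f ∘ suc) x c (λ x′ x′≤x → c≤f (suc x′) (s≤s x′≤x)))

-- Columns form the outer sum because sliding rows acts on each column separately, at two entries.
total : (Fin a → Fin b → Bool → ℕ) → Grid a b → ℕ
total w g = ∑.sum λ y → ∑.sum λ x → w x y (g x y)

total-flip : (w : Fin a → Fin b → Bool → ℕ) (g : Grid a b) → total (flip w) (flip g) ≡ total w g
total-flip w g = ∑.∑-comm (λ x y → w x y (g x y))

module _ (w : Fin a → Fin b → Bool → ℕ) {u v : Fin a} (u≢v : u ≢ v) (g : Grid a b) where

  private
    column : Grid a b → Fin b → ℕ
    column h y = ∑.sum λ x → w x y (h x y)
    slideColumn : ∀ y → column (slide u v g) y + (w u y (g u y) + w v y (g v y)) ≡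
      column g y + (w u y (g u y ∨ g v y) + w v y (g u y ∧ g v y))
    slideColumn y = subst₂ (λ p q → column (slide u v g) y + _ ≡ column g y + (w u y p + w v y q))
      (slide-u u v g y) (slide-v u≢v g y)
      (sum-differ₂ _ _ u≢v (λ x x≢u x≢v → cong (w x y) (slide-other x≢u x≢v g y)))
    slideColumn-≤ : ∀ y → w u y (g u y ∨ g v y) + w v y (g u y ∧ g v y) ≤ w u y (g u y) + w v y (g v y) →
      column (slide u v g) y ≤ column g y
    slideColumn-≤ y le = ℕ.+-cancelʳ-≤ (w u y (g u y) + w v y (g v y)) (column (slide u v g) y) (column g y)
      (subst (_≤ column g y + (w u y (g u y) + w v y (g v y))) (sym (slideColumn y))
        (ℕ.+-monoʳ-≤ (column g y) le))

  total-slide-≤ : (∀ y → w u y (g u y ∨ g v y) + w v y (g u y ∧ g v y) ≤ w u y (g u y) + w v y (g v y)) →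
    total w (slide u v g) ≤ total w g
  total-slide-≤ le = sum-mono-≤ λ y → slideColumn-≤ y (le y)

  total-slide-< : (∀ y → w u y (g u y ∨ g v y) + w v y (g u y ∧ g v y) ≤ w u y (g u y) + w v y (g v y)) →
    ∀ y → w u y (g u y ∨ g v y) + w v y (g u y ∧ g v y) < w u y (g u y) + w v y (g v y) →
    total w (slide u v g) < total w g
  total-slide-< le y lt = sum-mono-< (λ y → slideColumn-≤ y (le y)) y
    (ℕ.+-cancelʳ-< (w u y (g u y) + w v y (g v y)) (column (slide u v g) y) (column g y)
      (subst (_< column g y + (w u y (g u y) + w v y (g v y))) (sym (slideColumn y))
        (ℕ.+-monoʳ-< (column g y) lt)))

absent : Bool → ℕ
absent true  = 0
absent false = 1

miss : Grid a b → ℕ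
miss = total (λ _ _ → absent)

miss-slide : ∀ {u v : Fin a} → u ≢ v → (g : Grid a b) → miss (slide u v g) ≤ miss g
miss-slide {u = u} {v} u≢v g = total-slide-≤ (λ _ _ → absent) u≢v g (λ y → le (g u y) (g v y))
  where
  le : ∀ p q → absent (p ∨ q) + absent (p ∧ q) ≤ absent p + absent q
  le true  true  = ℕ.≤-refl
  le true  false = ℕ.≤-refl
  le false true  = ℕ.≤-refl
  le false false = ℕ.≤-refl

charge : ℕ → Bool → ℕ
charge w true  = w
charge w false = 0

module _ (W : Fin a → Fin b → ℕ) {u v : Fin a} (u<v : ∀ y → W u y < W v y) (u≢v : u ≢ v)
  (g : Grid a b) where

  private
    le : ∀ {m n} p q → m ≤ n → charge m (p ∨ q) + charge n (p ∧ q) ≤ charge m p + charge n q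
    le true  true  m≤n = ℕ.≤-refl
    le true  false m≤n = ℕ.≤-refl
    le {m} false true m≤n = subst (_≤ _) (sym (ℕ.+-identityʳ m)) m≤n
    le false false m≤n = ℕ.≤-refl

  charge-slide-≤ : total (λ x y → charge (W x y)) (slide u v g) ≤ total (λ x y → charge (W x y)) g
  charge-slide-≤ = total-slide-≤ (λ x y → charge (W x y)) u≢v g (λ y → le (g u y) (g v y) (ℕ.<⇒≤ (u<v y)))

  charge-slide-< : ∀ y → g u y ≡ false → g v y ≡ true →
    total (λ x y → charge (W x y)) (slide u v g) < total (λ x y → charge (W x y)) g
  charge-slide-< y gu gv = total-slide-< (λ x y → charge (W x y)) u≢v g (λ y → le (g u y) (g v y) (ℕ.<⇒≤ (u<v y))) y lt
    where
    lt : charge (W u y) (g u y ∨ g v y) + charge (W v y) (g u y ∧ g v y) <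
         charge (W u y) (g u y) + charge (W v y) (g v y)
    lt rewrite gu | gv | ℕ.+-identityʳ (W u y) = u<v y

-- What the spectral hypothesis yields combinatorially. A star misses exactly `b` pairs and so needs
-- its own alternative.
Good : Grid a b → Set
Good {b = b} g = miss g < b ⊎ ∃[ x ] IsStar g x

-- The slide carries a star at `u` to `v` and fixes all other stars.
IsStar-slide : ∀ {u v x : Fin a} → u ≢ v → (g : Grid a b) → IsStar g x → ∃[ x′ ] IsStar (slide u v g) x′
IsStar-slide {u = u} {v} {x} u≢v g star@(gx , g≢x) with x Fin.≟ u
... | yes refl = v , (λ y → trans (slide-v u≢v g y) (cong (_∧ g v y) (gx y)))
                   , (λ x′ y x′≢v → slide-star u≢v star x′≢v y)
... | no x≢u with x Fin.≟ v
...   | yes refl = v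
        , (λ y → trans (slide-v u≢v g y) (trans (cong (g u y ∧_) (gx y)) (Bool.∧-zeroʳ (g u y))))
        , rest
  where
  rest : ∀ x′ y → x′ ≢ v → slide u v g x′ y ≡ true
  rest x′ y x′≢v with x′ Fin.≟ u
  ... | yes refl = cong (_∨ g v y) (g≢x u y u≢v)
  ... | no x′≢u rewrite dec-false (x′ Fin.≟ v) x′≢v = g≢x x′ y x′≢v
...   | no x≢v = x , (λ y → trans (slide-other x≢u x≢v g y) (gx y)) , rest
  where
  rest : ∀ x′ y → x′ ≢ x → slide u v g x′ y ≡ true
  rest x′ y x′≢x with x′ Fin.≟ u | x′ Fin.≟ v
  ... | yes refl | _ = cong (_∨ g v y) (g≢x u y x′≢x)
  ... | no _ | yes refl = cong₂ _∧_ (g≢x u y (x≢u ∘ sym)) (g≢x v y x′≢x)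
  ... | no _ | no _ = g≢x x′ y x′≢x

Good-slide : ∀ {u v : Fin a} → u ≢ v → (g : Grid a b) → Good g → Good (slide u v g)
Good-slide u≢v g (inj₁ miss<b) = inj₁ (ℕ.≤-<-trans (miss-slide u≢v g) miss<b)
Good-slide u≢v g (inj₂ (x , star)) = inj₂ (IsStar-slide u≢v g star)

slideColumns : (u v : Fin b) → Grid a b → Grid a b
slideColumns u v g = flip (slide u v (flip g))

miss-slideColumns : ∀ {u v : Fin b} → u ≢ v → (g : Grid a b) → miss (slideColumns u v g) ≤ miss g
miss-slideColumns {u = u} {v} u≢v g = subst₂ _≤_ (total-flip (λ _ _ → absent) (slideColumns u v g)) (total-flip (λ _ _ → absent) g)
  (miss-slide u≢v (flip g))

IsStar-constant : {g : Grid a b} {x : Fin a} → IsStar g x → ∀ x′ y y′ → g x′ y ≡ g x′ y′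
IsStar-constant {x = x} (gx , g≢x) x′ y y′ with x′ Fin.≟ x
... | yes refl = trans (gx y) (sym (gx y′))
... | no x′≢x = trans (g≢x x′ y x′≢x) (sym (g≢x x′ y′ x′≢x))

-- Each row of a star is constant, and `∨` and `∧` are idempotent.
slideColumns-star : ∀ {u v : Fin b} {x} → u ≢ v → (g : Grid a b) → IsStar g x → ∀ x′ y →
  slideColumns u v g x′ y ≡ g x′ y
slideColumns-star {u = u} {v} u≢v g star x′ y with y Fin.≟ u | y Fin.≟ v
... | yes refl | _ = trans (cong (g x′ u ∨_) (IsStar-constant {g = g} star x′ v u)) (Bool.∨-idem _)
... | no _ | yes refl = trans (cong (_∧ g x′ v) (IsStar-constant {g = g} star x′ u v)) (Bool.∧-idem _)
... | no _ | no _ = refl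

Good-slideColumns : ∀ {u v : Fin b} → u ≢ v → (g : Grid a b) → Good g → Good (slideColumns u v g)
Good-slideColumns u≢v g (inj₁ miss<b) = inj₁ (ℕ.≤-<-trans (miss-slideColumns u≢v g) miss<b)
Good-slideColumns u≢v g (inj₂ (x , gx , g≢x)) = inj₂ (x
  , (λ y → trans (slideColumns-star u≢v g (gx , g≢x) x y) (gx y))
  , (λ x′ y x′≢x → trans (slideColumns-star u≢v g (gx , g≢x) x′ y) (g≢x x′ y x′≢x)))

flip-rainbow : (M : C → Grid a b) → RainbowPath k (EdgeIn (flip ∘ M)) → RainbowPath k (EdgeIn M)
flip-rainbow M (A , ok) = relabel swap swap
    (λ { (inj₁ _) → refl ; (inj₂ _) → refl }) (λ { (inj₁ _) → refl ; (inj₂ _) → refl }) A ,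
  λ {t} t<k → subst T (joins-flip (M _) (vertex A t) (vertex A (suc t))) (ok t<k)
  where
  joins-flip : ∀ (g : Grid _ _) p q → joins (flip g) p q ≡ joins g (swap p) (swap q)
  joins-flip g (inj₁ _) (inj₁ _) = refl
  joins-flip g (inj₁ _) (inj₂ _) = refl
  joins-flip g (inj₂ _) (inj₁ _) = refl
  joins-flip g (inj₂ _) (inj₂ _) = refl

slideColumns-rainbow : ∀ {u v : Fin b} → u ≢ v → (M : C → Grid a b) →
  RainbowPath k (EdgeIn (λ c → slideColumns u v (M c))) → RainbowPath k (EdgeIn M)
slideColumns-rainbow {u = u} {v} u≢v M P = flip-rainbow M (slide-rainbow u≢v (flip ∘ M)
  (flip-rainbow (λ c → slide u v (flip (M c))) P))

-- Edges are pushed towards small rows and large columns, so that missing pairs gather at large rows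
-- and small columns, away from the diagonal along which the zigzag path runs.
Closed : Grid a b → Set
Closed g = ∀ {x x′ y y′} → x′ Fin.≤ x → y Fin.≤ y′ → g x y ≡ true → g x′ y′ ≡ true

-- A slide strictly lowers the potential unless the family is already closed.
module _ (weight : Fin a → Fin b → ℕ)
  (weight-row : ∀ {x x′} → x Fin.< x′ → ∀ y → weight x y < weight x′ y)
  (weight-col : ∀ {y y′} → y Fin.< y′ → ∀ x → weight x y′ < weight x y) where

  potential : (Fin l → Grid a b) → ℕ
  potential M = ∑.sum λ c → total (λ x y → charge (weight x y)) (M c)

  -- The colour `c₀` is tracked since slides never increase its number of missing pairs: it still
  -- misses fewer than `b` in the closed family, where stars at the last row may need its help.
  compress : (M : Fin l → Grid a b) (c₀ : Fin l) → (∀ c → Good (M c)) → miss (M c₀) < b →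
    (∀ (M : Fin l → Grid a b) → (∀ c → Good (M c)) → miss (M c₀) < b → (∀ c → Closed (M c)) →
      RainbowPath k (EdgeIn M)) →
    Acc _<_ (potential M) → RainbowPath k (EdgeIn M)
  compress {k = k} M c₀ good c₀-miss closedCase (acc rec)
    with Fin.any? (λ c → Fin.any? λ u → Fin.any? λ v → Fin.any? λ y →
           (u Fin.<? v) ×-dec (M c u y Bool.≟ false) ×-dec (M c v y Bool.≟ true))
  ... | yes (c , u , v , y , u<v , cu , cv) = slide-rainbow u≢v M
        (compress (λ c → slide u v (M c)) c₀ (λ c → Good-slide u≢v (M c) (good c))
          (ℕ.≤-<-trans (miss-slide u≢v (M c₀)) c₀-miss) closedCase
          (rec (sum-mono-< (λ c → charge-slide-≤ weight (weight-row u<v) u≢v (M c)) c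
            (charge-slide-< weight (weight-row u<v) u≢v (M c) y cu cv))))
    where
    u≢v : u ≢ v
    u≢v = Fin.<⇒≢ u<v
  ... | no rows
    with Fin.any? (λ c → Fin.any? λ u → Fin.any? λ v → Fin.any? λ x →
           (u Fin.<? v) ×-dec (M c x v Bool.≟ false) ×-dec (M c x u Bool.≟ true))
  ...   | yes (c , v , u , x , v<u , cu , cv) = slideColumns-rainbow u≢v M
        (compress (λ c → slideColumns u v (M c)) c₀ (λ c → Good-slideColumns u≢v (M c) (good c))
          (ℕ.≤-<-trans (miss-slideColumns u≢v (M c₀)) c₀-miss) closedCase
          (rec (sum-mono-< (λ c → subst₂ _≤_ (unflip (slideColumns u v (M c))) (unflip (M c))
                   (charge-slide-≤ (flip weight) (weight-col v<u) u≢v (flip (M c)))) c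
            (subst₂ _<_ (unflip (slideColumns u v (M c))) (unflip (M c))
              (charge-slide-< (flip weight) (weight-col v<u) u≢v (flip (M c)) x cu cv)))))
    where
    u≢v : u ≢ v
    u≢v = Fin.<⇒≢ v<u ∘ sym
    unflip : ∀ g → total (flip (λ x y → charge (weight x y))) (flip g) ≡ total (λ x y → charge (weight x y)) g
    unflip = total-flip (λ x y → charge (weight x y))
  ...   | no cols = closedCase M good c₀-miss λ c x′≤x y≤y′ gxy → col c y≤y′ (row c x′≤x gxy)
    where
    ≢false⇒≡true : ∀ {p} → p ≢ false → p ≡ true
    ≢false⇒≡true {true} _ = refl
    ≢false⇒≡true {false} p≢ = contradiction refl p≢
    row : ∀ c {x x′ y} → x′ Fin.≤ x → M c x y ≡ true → M c x′ y ≡ true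
    row c {x} {x′} {y} x′≤x gxy with x′ Fin.≟ x
    ... | yes refl = gxy
    ... | no x′≢x = ≢false⇒≡true λ gx′y → rows (c , x′ , x , y , Fin.≤∧≢⇒< x′≤x x′≢x , gx′y , gxy)
    col : ∀ c {x y y′} → y Fin.≤ y′ → M c x y ≡ true → M c x y′ ≡ true
    col c {x} {y} {y′} y≤y′ gxy with y Fin.≟ y′
    ... | yes refl = gxy
    ... | no y≢y′ = ≢false⇒≡true λ gxy′ → cols (c , y , y′ , x , Fin.≤∧≢⇒< y≤y′ y≢y′ , gxy′ , gxy)

-- All pairs in rows from x on and columns up to y are missing. As x ≤ y + 1, there are at least (y
-- + 1)(z + 1) of them with z = m - y - 1, and (y + 1)(z + 1) ≥ y + z + 1 = m.
closed-miss : ∀ {m} {g : Grid (suc m) m} → Closed g → ∀ {x y} → toℕ x ≤ suc (toℕ y) → g x y ≡ false →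
  m ≤ miss g
closed-miss {m} {g} closed {x} {y} x≤1+y gxy = begin
  m                                  ≡⟨ ℕ.m+[n∸m]≡n (Fin.toℕ<n y) ⟨
  suc (toℕ y) + z                    ≡⟨ ℕ.+-suc (toℕ y) z ⟨
  toℕ y + suc z                      ≤⟨ ℕ.+-monoˡ-≤ (suc z) (ℕ.m≤m*n (toℕ y) (suc z)) ⟩
  toℕ y * suc z + suc z              ≡⟨ ℕ.+-comm _ (suc z) ⟩
  suc (toℕ y) * suc z                ≡⟨ cong (suc (toℕ y) *_) (ℕ.+-∸-assoc 1 (Fin.toℕ<n y)) ⟨
  suc (toℕ y) * (m ∸ toℕ y)          ≤⟨ ℕ.*-monoʳ-≤ (suc (toℕ y)) (ℕ.∸-monoʳ-≤ (suc m) x≤1+y) ⟩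
  suc (toℕ y) * (suc m ∸ toℕ x)      ≤⟨ sum-downset _ y (suc m ∸ toℕ x) column ⟩
  miss g                             ∎
  where
  open ℕ.≤-Reasoning
  z = m ∸ suc (toℕ y)
  1≤absent : ∀ {p} → p ≢ true → 1 ≤ absent p
  1≤absent {true} p≢ = contradiction refl p≢
  1≤absent {false} _ = ℕ.≤-refl
  column : ∀ y′ → y′ Fin.≤ y → suc m ∸ toℕ x ≤ ∑.sum (λ x → absent (g x y′))
  column y′ y′≤y = sum-upset _ x λ x′ x≤x′ → 1≤absent λ gx′y′ →
    case trans (sym gxy) (closed x≤x′ y′≤y gx′y′) of λ ()

-- The zigzag path in a closed family

zigzag : ∀ m → ℕ → Fin (suc m) ⊎ Fin m
zigzag zero    _             = inj₁ zero
zigzag (suc m) zero          = inj₁ zero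
zigzag (suc m) (suc zero)    = inj₂ zero
zigzag (suc m) (suc (suc t)) = map suc suc (zigzag m t)

zigzag⁻¹ : ∀ m → Fin (suc m) ⊎ Fin m → ℕ
zigzag⁻¹ m       (inj₁ zero)    = 0
zigzag⁻¹ (suc m) (inj₁ (suc x)) = 2 + zigzag⁻¹ m (inj₁ x)
zigzag⁻¹ (suc m) (inj₂ zero)    = 1
zigzag⁻¹ (suc m) (inj₂ (suc y)) = 2 + zigzag⁻¹ m (inj₂ y)

m+1+m+1 : ∀ m → 2 + (m + m) ≡ suc m + suc m
m+1+m+1 m = cong suc (sym (ℕ.+-suc m m))

zigzag⁻¹-≤ : ∀ m v → zigzag⁻¹ m v ≤ m + m
zigzag⁻¹-≤ m       (inj₁ zero)    = z≤n
zigzag⁻¹-≤ (suc m) (inj₁ (suc x)) = subst (zigzag⁻¹ (suc m) (inj₁ (suc x)) ≤_) (m+1+m+1 m) (s≤s (s≤s (zigzag⁻¹-≤ m (inj₁ x))))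
zigzag⁻¹-≤ (suc m) (inj₂ zero)    = s≤s z≤n
zigzag⁻¹-≤ (suc m) (inj₂ (suc y)) = subst (zigzag⁻¹ (suc m) (inj₂ (suc y)) ≤_) (m+1+m+1 m) (s≤s (s≤s (zigzag⁻¹-≤ m (inj₂ y))))

zigzag-zigzag⁻¹ : ∀ m v → zigzag m (zigzag⁻¹ m v) ≡ v
zigzag-zigzag⁻¹ zero    (inj₁ zero)    = refl
zigzag-zigzag⁻¹ (suc m) (inj₁ zero)    = refl
zigzag-zigzag⁻¹ (suc m) (inj₁ (suc x)) = cong (map suc suc) (zigzag-zigzag⁻¹ m (inj₁ x))
zigzag-zigzag⁻¹ (suc m) (inj₂ zero)    = refl
zigzag-zigzag⁻¹ (suc m) (inj₂ (suc y)) = cong (map suc suc) (zigzag-zigzag⁻¹ m (inj₂ y))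

zigzag⁻¹-map : ∀ m v → zigzag⁻¹ (suc m) (map suc suc v) ≡ 2 + zigzag⁻¹ m v
zigzag⁻¹-map m (inj₁ _) = refl
zigzag⁻¹-map m (inj₂ _) = refl

zigzag⁻¹-zigzag : ∀ m {t} → t ≤ m + m → zigzag⁻¹ m (zigzag m t) ≡ t
zigzag⁻¹-zigzag zero    {zero}        _ = refl
zigzag⁻¹-zigzag (suc m) {zero}        _ = refl
zigzag⁻¹-zigzag (suc m) {suc zero}    _ = refl
zigzag⁻¹-zigzag (suc m) {suc (suc t)} t≤ = trans (zigzag⁻¹-map m (zigzag m t))
  (cong (2 +_) (zigzag⁻¹-zigzag m (ℕ.s≤s⁻¹ (ℕ.s≤s⁻¹ (subst (suc (suc t) ≤_) (sym (m+1+m+1 m)) t≤)))))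

-- Step 2i joins x_i to y_i, and step 2i + 1 joins y_i to x_{i+1}. So the row exceeds the column by
-- at most one, and row m occurs in the last step alone.
record ZigzagEdge (m t : ℕ) : Set where
  field
    row      : Fin (suc m)
    col      : Fin m
    row≤1+col : toℕ row ≤ suc (toℕ col)
    last     : toℕ row ≡ m → suc t ≡ m + m
    joins-zigzag : (g : Grid (suc m) m) → joins g (zigzag m t) (zigzag m (suc t)) ≡ g row col

zigzagEdge : ∀ m {t} → t < m + m → ZigzagEdge m t
zigzagEdge (suc m) {zero} _ = record
  { row = zero ; col = zero ; row≤1+col = z≤n ; last = λ () ; joins-zigzag = λ _ → refl }
zigzagEdge (suc zero) {suc zero} _ = record
  { row = suc zero ; col = zero ; row≤1+col = ℕ.≤-refl ; last = λ _ → refl ; joins-zigzag = λ _ → refl }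
zigzagEdge (suc (suc m)) {suc zero} _ = record
  { row = suc zero ; col = zero ; row≤1+col = ℕ.≤-refl ; last = λ () ; joins-zigzag = λ _ → refl }
zigzagEdge (suc m) {suc (suc t)} t< = record
  { row = suc row
  ; col = suc col
  ; row≤1+col = s≤s row≤1+col
  ; last = λ eq → trans (cong (2 +_) (last (ℕ.suc-injective eq))) (m+1+m+1 m)
  ; joins-zigzag = λ g → trans (joins-suc g (zigzag m t) (zigzag m (suc t)))
                           (joins-zigzag λ x y → g (suc x) (suc y))
  }
  where
  open ZigzagEdge (zigzagEdge m {t} (ℕ.s≤s⁻¹ (ℕ.s≤s⁻¹ (subst (suc (suc t) <_) (sym (m+1+m+1 m)) t<))))
  joins-suc : ∀ (g : Grid (suc (suc m)) (suc m)) p q →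
    joins g (map suc suc p) (map suc suc q) ≡ joins (λ x y → g (suc x) (suc y)) p q
  joins-suc g (inj₁ _) (inj₁ _) = refl
  joins-suc g (inj₁ _) (inj₂ _) = refl
  joins-suc g (inj₂ _) (inj₁ _) = refl
  joins-suc g (inj₂ _) (inj₂ _) = refl

-- The colour c₀ is put on the last step, which is the only one at the last row.
closed-rainbow : ∀ {m k} → k ≡ m + m → (M : Fin k → Grid (suc m) m) (c₀ : Fin k) → (∀ c → Good (M c)) →
  miss (M c₀) < m → (∀ c → Closed (M c)) → RainbowPath k (EdgeIn M)
closed-rainbow {m} {suc k} k≡m+m M c₀ good c₀-miss closed = A , ok
  where
  π : Fin (suc k) → Fin (suc k)
  π = transpose c₀ (Fin.fromℕ k)
  ππ : ∀ c → π (π c) ≡ c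
  ππ = transpose-involutive c₀ (Fin.fromℕ k)
  -- The decision is an argument so that it can be matched on; past the end `c₀` serves as a
  -- default.
  colourAt : ∀ t → Dec (t < suc k) → Fin (suc k)
  colourAt t (yes t<k) = π (Fin.fromℕ< t<k)
  colourAt t (no _)    = c₀
  colourAt-< : ∀ {t} (t<k : t < suc k) d → colourAt t d ≡ π (Fin.fromℕ< t<k)
  colourAt-< t<k (yes _) = refl
  colourAt-< t<k (no t≮k) = contradiction t<k t≮k
  A : Arrangement (suc k) (Fin (suc m) ⊎ Fin m) (Fin (suc k))
  A = record
    { vertex          = zigzag m
    ; position        = zigzag⁻¹ m
    ; position≤       = λ v → subst (zigzag⁻¹ m v ≤_) (sym k≡m+m) (zigzag⁻¹-≤ m v)
    ; vertex-position = zigzag-zigzag⁻¹ m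
    ; position-vertex = λ {t} t≤k → zigzag⁻¹-zigzag m (subst (t ≤_) k≡m+m t≤k)
    ; colour          = λ t → colourAt t (t ℕ.<? suc k)
    ; step            = λ c → toℕ (π c)
    ; step<           = λ c → Fin.toℕ<n (π c)
    ; colour-step     = λ c → trans (colourAt-< (Fin.toℕ<n (π c)) (toℕ (π c) ℕ.<? suc k))
                          (trans (cong π (Fin.fromℕ<-toℕ (π c) (Fin.toℕ<n (π c)))) (ππ c))
    ; step-colour     = λ {t} t<k → trans (cong (toℕ ∘ π) (colourAt-< t<k (t ℕ.<? suc k)))
                          (trans (cong toℕ (ππ (Fin.fromℕ< t<k))) (Fin.toℕ-fromℕ< t<k))
    }
  ok : Follows A (EdgeIn M)
  ok {t} t<k = ≡⇒T (trans (joins-zigzag (M c)) present)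
    where
    open ZigzagEdge (zigzagEdge m (subst (t <_) k≡m+m t<k))
    c = colour A t
    c≡c₀ : toℕ row ≡ m → c ≡ c₀
    c≡c₀ row≡m = begin
      colourAt t (t ℕ.<? suc k)  ≡⟨ colourAt-< t<k (t ℕ.<? suc k) ⟩
      π (Fin.fromℕ< t<k)         ≡⟨ cong π (Fin.toℕ-injective (trans (Fin.toℕ-fromℕ< t<k) (trans t≡k (sym (Fin.toℕ-fromℕ k))))) ⟩
      π (Fin.fromℕ k)            ≡⟨ transpose-matchʳ c₀ (Fin.fromℕ k) ⟩
      c₀                         ∎
      where
      open ≡-Reasoning
      t≡k : t ≡ k
      t≡k = ℕ.suc-injective (trans (last row≡m) (sym k≡m+m))
    few : miss (M c) < m → M c row col ≡ true
    few c-miss with M c row col in eq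
    ... | true = refl
    ... | false = contradiction (closed-miss (closed c) row≤1+col eq) (ℕ.<⇒≱ c-miss)
    present : M c row col ≡ true
    present with good c
    ... | inj₁ c-miss = few c-miss
    ... | inj₂ (x , empty , others) with row Fin.≟ x | toℕ row ℕ.≟ m
    ...   | no row≢x | _ = others row col row≢x
    ...   | yes refl | yes row≡m = few (subst (λ c → miss (M c) < m) (sym (c≡c₀ row≡m)) c₀-miss)
    -- In a star at another row the last row is full, and closedness passes its pairs on to every
    -- smaller row.
    ...   | yes refl | no row≢m = closed c (Fin.≤fromℕ row) ℕ.≤-refl (others (Fin.fromℕ m) col λ eq →
              row≢m (trans (cong toℕ (sym eq)) (Fin.toℕ-fromℕ m)))

rainbow-few-missing : ∀ {m k} → k ≡ m + m → (M : Fin k → Grid (suc m) m) (c₀ : Fin k) → (∀ c → Good (M c)) →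
  miss (M c₀) < m → RainbowPath k (EdgeIn M)
rainbow-few-missing {m} k≡m+m M c₀ good c₀-miss = compress (λ x y → toℕ x + (m ∸ toℕ y))
  (λ x<x′ y → ℕ.+-monoˡ-< (m ∸ toℕ y) x<x′)
  (λ {y} {y′} y<y′ x → ℕ.+-monoʳ-< (toℕ x) (ℕ.∸-monoʳ-< y<y′ (Fin.toℕ≤n y′)))
  M c₀ good c₀-miss (λ M → closed-rainbow k≡m+m M c₀) (<-wellFounded _)

-- If no graph misses fewer than m pairs, all are stars. Two stars at different rows allow an
-- exchange that makes one of them complete, which supplies the graph with few missing pairs.
rainbow-Good : ∀ {m k} → 0 < m → k ≡ m + m → (M : Fin k → Grid (suc m) m) → (∀ c → Good (M c)) →
  ¬ (∃[ x ] ∀ c → IsStar (M c) x) → RainbowPath k (EdgeIn M)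
rainbow-Good {m} {k} 0<m k≡m+m M good ¬common with Fin.any? (λ c → miss (M c) ℕ.<? m)
... | yes (c₀ , c₀-miss) = rainbow-few-missing k≡m+m M c₀ good c₀-miss
... | no none = main (subst Fin (sym k≡m+m) (Fin.fromℕ< (ℕ.≤-trans 0<m (ℕ.m≤m+n m m))))
  where
  star : ∀ c → ∃[ x ] IsStar (M c) x
  star c with good c
  ... | inj₁ c-miss = contradiction (c , c-miss) none
  ... | inj₂ s = s
  main : Fin k → RainbowPath k (EdgeIn M)
  main p with Fin.all? (λ c → proj₁ (star c) Fin.≟ proj₁ (star p))
  ... | yes same = contradiction (proj₁ (star p) , λ c → subst (IsStar (M c)) (same c) (proj₂ (star c))) ¬common
  ... | no ¬same with Fin.¬∀⟶∃¬ k _ (λ c → proj₁ (star c) Fin.≟ proj₁ (star p)) ¬same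
  ...   | q , u≢v = exchange-rainbow u≢v M p≢q (proj₂ (star p)) (proj₂ (star q))
            (rainbow-few-missing k≡m+m M₀ q good₀ q-miss)
    where
    u = proj₁ (star q)
    v = proj₁ (star p)
    p≢q : p ≢ q
    p≢q refl = u≢v refl
    M₀ : Fin k → Grid (suc m) m
    M₀ c = if does (c Fin.≟ q) then full else slide u v (M c)
    full-miss : miss (full {suc m} {m}) < m
    full-miss = subst (_< m) (sym (trans (∑.sum-cong-≗ {m} (λ _ → ∑.sum-replicate-zero (suc m)))
      (∑.sum-replicate-zero m))) 0<m
    q-miss : miss (M₀ q) < m
    q-miss rewrite dec-true (q Fin.≟ q) refl = full-miss
    good₀ : ∀ c → Good (M₀ c)
    good₀ c with c Fin.≟ q
    ... | yes _ = inj₁ full-miss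
    ... | no _ = Good-slide u≢v (M c) (good c)

-- Labelled graphs and grids

module _ {k} (𝒢 : Family k (suc k)) (A : Arrangement k (Fin (suc k)) (Fin k))
  (ok : Follows A (λ c u v → Adj (𝒢 c) u v)) where

  private
    pos vtx : Fin (suc k) → Fin (suc k)
    pos v = Fin.fromℕ< (s≤s (position≤ A v))
    vtx i = vertex A (toℕ i)

    toℕ-pos : ∀ v → toℕ (pos v) ≡ position A v
    toℕ-pos v = Fin.toℕ-fromℕ< (s≤s (position≤ A v))

    vtx-pos : ∀ v → vtx (pos v) ≡ v
    vtx-pos v = trans (cong (vertex A) (toℕ-pos v)) (vertex-position A v)

    pos-vtx : ∀ i → pos (vtx i) ≡ i
    pos-vtx i = Fin.toℕ-injective (trans (toℕ-pos (vtx i)) (position-vertex A (ℕ.s≤s⁻¹ (Fin.toℕ<n i))))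

    H : Graph (suc k)
    H = record
      { adj        = λ u v → adj (Path (suc k)) (pos u) (pos v)
      ; adj-sym    = λ u v → Graph.adj-sym (Path (suc k)) (pos u) (pos v)
      ; adj-irrefl = λ v → Graph.adj-irrefl (Path (suc k)) (pos v)
      }

    hamiltonPath : IsHamiltonPath H
    hamiltonPath = mk↔ₛ′ vtx pos vtx-pos pos-vtx ,
      λ i j → sym (cong₂ (adj (Path (suc k))) (pos-vtx i) (pos-vtx j))

    -- Edges list their smaller endpoint first whereas steps follow the path, so both orientations
    -- occur.
    AtStep : ℕ → Fin (suc k) → Fin (suc k) → Set
    AtStep t u v = (u ≡ vertex A t × v ≡ vertex A (suc t)) ⊎ (u ≡ vertex A (suc t) × v ≡ vertex A t)

    vertex-injective : ∀ {s t} → s ≤ k → t ≤ k → vertex A s ≡ vertex A t → s ≡ t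
    vertex-injective s≤k t≤k eq = trans (sym (position-vertex A s≤k)) (trans (cong (position A) eq) (position-vertex A t≤k))

    -- With opposite orientations, both s = t + 1 and t = s + 1 would hold.
    AtStep-unique : ∀ {s t u v} → s < k → t < k → AtStep s u v → AtStep t u v → s ≡ t
    AtStep-unique s<k t<k (inj₁ (us , _)) (inj₁ (ut , _)) =
      vertex-injective (ℕ.<⇒≤ s<k) (ℕ.<⇒≤ t<k) (trans (sym us) ut)
    AtStep-unique s<k t<k (inj₂ (_ , vs)) (inj₂ (_ , vt)) =
      vertex-injective (ℕ.<⇒≤ s<k) (ℕ.<⇒≤ t<k) (trans (sym vs) vt)
    AtStep-unique {s} {t} s<k t<k (inj₁ (us , vs)) (inj₂ (ut , vt)) = contradiction
      (cong suc (vertex-injective (ℕ.<⇒≤ s<k) t<k (trans (sym us) ut)))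
      (λ eq → ℕ.m≢1+n+m t {1} (trans (sym (vertex-injective s<k (ℕ.<⇒≤ t<k) (trans (sym vs) vt))) eq))
    AtStep-unique {s} {t} s<k t<k (inj₂ (us , vs)) (inj₁ (ut , vt)) = contradiction
      (cong suc (vertex-injective (ℕ.<⇒≤ s<k) t<k (trans (sym vs) vt)))
      (λ eq → ℕ.m≢1+n+m t {1} (trans (sym (vertex-injective s<k (ℕ.<⇒≤ t<k) (trans (sym us) ut))) eq))

    findStep : ∀ u v → T (adj H u v) → ∃[ t ] t < k × AtStep t u v
    findStep u v e with T-∨ {suc (toℕ (pos u)) ℕ.≡ᵇ toℕ (pos v)} e
    ... | inj₁ e₁ = position A u , next≤k , inj₁ (sym (vertex-position A u) , v≡)
      where
      next : suc (position A u) ≡ position A v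
      next = trans (cong suc (sym (toℕ-pos u))) (trans (ℕ.≡ᵇ⇒≡ _ _ e₁) (toℕ-pos v))
      next≤k : position A u < k
      next≤k = subst (_≤ k) (sym next) (position≤ A v)
      v≡ : v ≡ vertex A (suc (position A u))
      v≡ = trans (sym (vertex-position A v)) (cong (vertex A) (sym next))
    ... | inj₂ e₂ = position A v , next≤k , inj₂ (u≡ , sym (vertex-position A v))
      where
      next : suc (position A v) ≡ position A u
      next = trans (cong suc (sym (toℕ-pos v))) (trans (ℕ.≡ᵇ⇒≡ _ _ e₂) (toℕ-pos u))
      next≤k : position A v < k
      next≤k = subst (_≤ k) (sym next) (position≤ A u)
      u≡ : u ≡ vertex A (suc (position A v))
      u≡ = trans (sym (vertex-position A u)) (cong (vertex A) (sym next))

    T-∨ˡ : ∀ {p q} → T p → T (p ∨ q)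
    T-∨ˡ {true} _ = _
    T-∨ʳ : ∀ {p q} → T q → T (p ∨ q)
    T-∨ʳ {true} _ = _
    T-∨ʳ {false} t = t

    step-adjacent : ∀ {t u v} → t < k → AtStep t u v → T (adj H u v)
    step-adjacent {t} t<k (inj₁ (refl , refl)) = T-∨ˡ (ℕ.≡⇒≡ᵇ _ _ (trans
      (cong suc (trans (toℕ-pos _) (position-vertex A (ℕ.<⇒≤ t<k))))
      (sym (trans (toℕ-pos _) (position-vertex A t<k)))))
    step-adjacent {t} t<k (inj₂ (refl , refl)) =
      T-∨ʳ {suc (toℕ (pos (vertex A (suc t)))) ℕ.≡ᵇ toℕ (pos (vertex A t))} (ℕ.≡⇒≡ᵇ _ _ (trans
      (cong suc (trans (toℕ-pos _) (position-vertex A (ℕ.<⇒≤ t<k))))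
      (sym (trans (toℕ-pos _) (position-vertex A t<k)))))

    edgeAtStep : ∀ t → t < k → Σ[ e ∈ Edge H ] AtStep t (proj₁ e) (proj₁ (proj₂ e))
    edgeAtStep t t<k with Fin.<-cmp (vertex A t) (vertex A (suc t))
    ... | tri< lt _ _ = (vertex A t , vertex A (suc t) , lt , step-adjacent t<k (inj₁ (refl , refl)))
                      , inj₁ (refl , refl)
    ... | tri> _ _ gt = (vertex A (suc t) , vertex A t , gt , step-adjacent t<k (inj₂ (refl , refl)))
                      , inj₂ (refl , refl)
    ... | tri≈ _ eq _ = contradiction (vertex-injective (ℕ.<⇒≤ t<k) t<k eq) (ℕ.m≢1+n+m t {0})

    edge-≡ : ∀ {u v} {p q : u Fin.< v × Adj H u v} → _≡_ {A = Edge H} (u , v , p) (u , v , q)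
    edge-≡ {u} {v} {p , p′} {q , q′} =
      cong₂ (λ r s → u , v , r , s) (Fin.<-irrelevant p q) (Bool.T-irrelevant p′ q′)

    AtStep-edge : ∀ {t} (e e′ : Edge H) → AtStep t (proj₁ e) (proj₁ (proj₂ e)) →
      AtStep t (proj₁ e′) (proj₁ (proj₂ e′)) → e ≡ e′
    AtStep-edge (_ , _ , p) (_ , _ , q) (inj₁ (refl , refl)) (inj₁ (refl , refl)) = edge-≡ {p = p} {q}
    AtStep-edge (_ , _ , p) (_ , _ , q) (inj₂ (refl , refl)) (inj₂ (refl , refl)) = edge-≡ {p = p} {q}
    AtStep-edge (_ , _ , p , _) (_ , _ , q , _) (inj₁ (refl , refl)) (inj₂ (refl , refl)) =
      contradiction q (Fin.<-asym p)
    AtStep-edge (_ , _ , p , _) (_ , _ , q , _) (inj₂ (refl , refl)) (inj₁ (refl , refl)) =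
      contradiction q (Fin.<-asym p)

    find : (e : Edge H) → ∃[ t ] t < k × AtStep t (proj₁ e) (proj₁ (proj₂ e))
    find (u , v , _ , e) = findStep u v e

    colouring : Edge H ↔ Fin k
    colouring = mk↔ₛ′ to from to-from from-to
      where
      to : Edge H → Fin k
      to e = colour A (proj₁ (find e))
      from : Fin k → Edge H
      from c = proj₁ (edgeAtStep (step A c) (step< A c))
      to-from : ∀ c → to (from c) ≡ c
      to-from c = trans (cong (colour A) (AtStep-unique (proj₁ (proj₂ (find (from c)))) (step< A c)
        (proj₂ (proj₂ (find (from c)))) (proj₂ (edgeAtStep (step A c) (step< A c))))) (colour-step A c)
      from-to : ∀ e → from (to e) ≡ e
      from-to e = AtStep-edge (from (to e)) e (proj₂ (edgeAtStep (step A (to e)) (step< A (to e))))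
        (subst (λ t → AtStep t (proj₁ e) (proj₁ (proj₂ e)))
          (sym (step-colour A (proj₁ (proj₂ (find e))))) (proj₂ (proj₂ (find e))))

  hasRainbowHamiltonPath : HasRainbowHamiltonPath 𝒢
  hasRainbowHamiltonPath = H , hamiltonPath , colouring , λ e → coloured (find e)
    where
    coloured : ∀ {u v} (s : ∃[ t ] t < k × AtStep t u v) → Adj (𝒢 (colour A (proj₁ s))) u v
    coloured (t , t<k , inj₁ (refl , refl)) = ok t<k
    coloured (t , t<k , inj₂ (refl , refl)) = subst T (Graph.adj-sym (𝒢 (colour A t)) _ _) (ok t<k)

-- Numbering the two parts of a bipartition

index : ∀ {N} (X : Subset N) → Fin N → Fin ∣ X ∣ ⊎ Fin ∣ ∁ X ∣
index (inside  ∷ X) zero    = inj₁ zero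
index (outside ∷ X) zero    = inj₂ zero
index (inside  ∷ X) (suc v) = map suc id (index X v)
index (outside ∷ X) (suc v) = map id suc (index X v)

index⁻¹ : ∀ {N} (X : Subset N) → Fin ∣ X ∣ ⊎ Fin ∣ ∁ X ∣ → Fin N
index⁻¹ (inside  ∷ X) (inj₁ zero)    = zero
index⁻¹ (inside  ∷ X) (inj₁ (suc x)) = suc (index⁻¹ X (inj₁ x))
index⁻¹ (inside  ∷ X) (inj₂ y)       = suc (index⁻¹ X (inj₂ y))
index⁻¹ (outside ∷ X) (inj₁ x)       = suc (index⁻¹ X (inj₁ x))
index⁻¹ (outside ∷ X) (inj₂ zero)    = zero
index⁻¹ (outside ∷ X) (inj₂ (suc y)) = suc (index⁻¹ X (inj₂ y))

index-index⁻¹ : ∀ {N} (X : Subset N) p → index X (index⁻¹ X p) ≡ p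
index-index⁻¹ (inside  ∷ X) (inj₁ zero)    = refl
index-index⁻¹ (inside  ∷ X) (inj₁ (suc x)) = cong (map suc id) (index-index⁻¹ X (inj₁ x))
index-index⁻¹ (inside  ∷ X) (inj₂ y)       = cong (map suc id) (index-index⁻¹ X (inj₂ y))
index-index⁻¹ (outside ∷ X) (inj₁ x)       = cong (map id suc) (index-index⁻¹ X (inj₁ x))
index-index⁻¹ (outside ∷ X) (inj₂ zero)    = refl
index-index⁻¹ (outside ∷ X) (inj₂ (suc y)) = cong (map id suc) (index-index⁻¹ X (inj₂ y))

index⁻¹-index : ∀ {N} (X : Subset N) v → index⁻¹ X (index X v) ≡ v
index⁻¹-index (inside  ∷ X) zero    = refl
index⁻¹-index (outside ∷ X) zero    = refl
index⁻¹-index (inside  ∷ X) (suc v) with index X v | index⁻¹-index X v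
... | inj₁ _ | eq = cong suc eq
... | inj₂ _ | eq = cong suc eq
index⁻¹-index (outside ∷ X) (suc v) with index X v | index⁻¹-index X v
... | inj₁ _ | eq = cong suc eq
... | inj₂ _ | eq = cong suc eq

index⁻¹-inside : ∀ {N} (X : Subset N) x → index⁻¹ X (inj₁ x) ∈ X
index⁻¹-inside (inside  ∷ X) zero    = here
index⁻¹-inside (inside  ∷ X) (suc x) = there (index⁻¹-inside X x)
index⁻¹-inside (outside ∷ X) x       = there (index⁻¹-inside X x)

index⁻¹-outside : ∀ {N} (X : Subset N) y → index⁻¹ X (inj₂ y) ∉ X
index⁻¹-outside (inside  ∷ X) y       (there y∈X) = index⁻¹-outside X y y∈X
index⁻¹-outside (outside ∷ X) (suc y) (there y∈X) = index⁻¹-outside X y y∈X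

record Coordinates {N} (m : ℕ) (X Y : Subset N) : Set where
  field
    to      : Fin N → Fin (suc m) ⊎ Fin m
    from    : Fin (suc m) ⊎ Fin m → Fin N
    to-from : ∀ p → to (from p) ≡ p
    from-to : ∀ v → from (to v) ≡ v
    row∈X   : ∀ x → from (inj₁ x) ∈ X
    col∈Y   : ∀ y → from (inj₂ y) ∈ Y

m+m-injective : ∀ {m n} → m + m ≡ n + n → m ≡ n
m+m-injective {m} {n} eq with ℕ.<-cmp m n
... | tri< m<n _ _ = contradiction eq (ℕ.<⇒≢ (ℕ.+-mono-< m<n m<n))
... | tri≈ _ m≡n _ = m≡n
... | tri> _ _ n<m = contradiction (sym eq) (ℕ.<⇒≢ (ℕ.+-mono-< n<m n<m))

coordinates : ∀ {N m} {X Y : Subset N} → IsBipartition X Y → N ≡ suc (m + m) → ∣ X ∣ ≡ suc ∣ Y ∣ →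
  Coordinates m X Y
coordinates {N} {m} {X} {Y} bip N≡ X≡1+Y = build ∣X∣≡1+m ∣∁X∣≡m
  where
  open IsBipartition bip
  Y≡∁X : Y ≡ ∁ X
  Y≡∁X = Subset.⊆-antisym
    (λ v∈Y → Subset.x∉p⇒x∈∁p (λ v∈X → disjoint _ (v∈X , v∈Y)))
    (λ v∈∁X → case cover _ of λ { (inj₁ v∈X) → contradiction v∈X (Subset.x∈∁p⇒x∉p v∈∁X) ; (inj₂ v∈Y) → v∈Y })
  ∣X∣+∣Y∣ : ∣ X ∣ + ∣ Y ∣ ≡ N
  ∣X∣+∣Y∣ = trans (cong (λ Z → ∣ X ∣ + ∣ Z ∣) Y≡∁X) (trans (cong (∣ X ∣ +_) (Subset.∣∁p∣≡n∸∣p∣ X))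
    (ℕ.m+[n∸m]≡n (Subset.∣p∣≤n X)))
  ∣Y∣≡m : ∣ Y ∣ ≡ m
  ∣Y∣≡m = m+m-injective (ℕ.suc-injective (trans (cong (_+ ∣ Y ∣) (sym X≡1+Y)) (trans ∣X∣+∣Y∣ N≡)))
  ∣X∣≡1+m : ∣ X ∣ ≡ suc m
  ∣X∣≡1+m = trans X≡1+Y (cong suc ∣Y∣≡m)
  ∣∁X∣≡m : ∣ ∁ X ∣ ≡ m
  ∣∁X∣≡m = trans (cong ∣_∣ (sym Y≡∁X)) ∣Y∣≡m
  -- The cardinalities are generalised to variables, so that the equations can be matched with
  -- `refl`.
  to′ : ∀ {a b} → ∣ X ∣ ≡ a → ∣ ∁ X ∣ ≡ b → Fin N → Fin a ⊎ Fin b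
  to′ refl refl = index X
  from′ : ∀ {a b} → ∣ X ∣ ≡ a → ∣ ∁ X ∣ ≡ b → Fin a ⊎ Fin b → Fin N
  from′ refl refl = index⁻¹ X
  to-from′ : ∀ {a b} (p : ∣ X ∣ ≡ a) (q : ∣ ∁ X ∣ ≡ b) w → to′ p q (from′ p q w) ≡ w
  to-from′ refl refl = index-index⁻¹ X
  from-to′ : ∀ {a b} (p : ∣ X ∣ ≡ a) (q : ∣ ∁ X ∣ ≡ b) v → from′ p q (to′ p q v) ≡ v
  from-to′ refl refl = index⁻¹-index X
  row′ : ∀ {a b} (p : ∣ X ∣ ≡ a) (q : ∣ ∁ X ∣ ≡ b) x → from′ p q (inj₁ x) ∈ X
  row′ refl refl = index⁻¹-inside X
  col′ : ∀ {a b} (p : ∣ X ∣ ≡ a) (q : ∣ ∁ X ∣ ≡ b) y → from′ p q (inj₂ y) ∈ Y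
  col′ refl refl y = case cover (index⁻¹ X (inj₂ y)) of λ
    { (inj₁ y∈X) → contradiction y∈X (index⁻¹-outside X y) ; (inj₂ y∈Y) → y∈Y }
  build : ∣ X ∣ ≡ suc m → ∣ ∁ X ∣ ≡ m → Coordinates m X Y
  build p q = record
    { to = to′ p q ; from = from′ p q ; to-from = to-from′ p q ; from-to = from-to′ p q
    ; row∈X = row′ p q ; col∈Y = col′ p q }

-- Bipartite graphs as grids, and the exceptional graph

module _ {N m} {X Y : Subset N} (bip : IsBipartition X Y) (coords : Coordinates m X Y) where
  open Coordinates coords

  biadjacency : Graph N → Grid (suc m) m
  biadjacency G x y = adj G (from (inj₁ x)) (from (inj₂ y))

  module _ (G : Graph N) (G-bip : IsBipartite G X Y) where

    private
      ¬T⇒≡ : ∀ {p} → ¬ T p → p ≡ false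
      ¬T⇒≡ {true} ¬p = contradiction _ ¬p
      ¬T⇒≡ {false} _ = refl

    adj-from : ∀ p q → adj G (from p) (from q) ≡ joins (biadjacency G) p q
    adj-from (inj₁ x) (inj₂ y) = refl
    adj-from (inj₂ y) (inj₁ x) = Graph.adj-sym G _ _
    adj-from (inj₁ x) (inj₁ x′) = ¬T⇒≡ λ e → case G-bip _ _ e of λ
      { (inj₁ (_ , v∈Y)) → IsBipartition.disjoint bip _ (row∈X x′ , v∈Y)
      ; (inj₂ (u∈Y , _)) → IsBipartition.disjoint bip _ (row∈X x , u∈Y) }
    adj-from (inj₂ y) (inj₂ y′) = ¬T⇒≡ λ e → case G-bip _ _ e of λ
      { (inj₁ (u∈X , _)) → IsBipartition.disjoint bip _ (u∈X , col∈Y y)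
      ; (inj₂ (_ , v∈X)) → IsBipartition.disjoint bip _ (v∈X , col∈Y y′) }

    adj-to : ∀ u v → adj G u v ≡ joins (biadjacency G) (to u) (to v)
    adj-to u v = trans (sym (cong₂ (adj G) (from-to u) (from-to v))) (adj-from (to u) (to v))

  star-≐ : ∀ G G′ {x} → IsBipartite G X Y → IsBipartite G′ X Y →
    IsStar (biadjacency G) x → IsStar (biadjacency G′) x → G ≐ G′
  star-≐ G G′ {x} G-bip G′-bip (gx , g≢x) (g′x , g′≢x) u v =
    trans (adj-to G G-bip u v) (trans (joins-≡ (to u) (to v)) (sym (adj-to G′ G′-bip u v)))
    where
    same : ∀ x′ y → biadjacency G x′ y ≡ biadjacency G′ x′ y
    same x′ y with x′ Fin.≟ x
    ... | yes refl = trans (gx y) (sym (g′x y))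
    ... | no x′≢x = trans (g≢x x′ y x′≢x) (sym (g′≢x x′ y x′≢x))
    joins-≡ : ∀ p q → joins (biadjacency G) p q ≡ joins (biadjacency G′) p q
    joins-≡ (inj₁ _) (inj₁ _) = refl
    joins-≡ (inj₁ x) (inj₂ y) = same x y
    joins-≡ (inj₂ y) (inj₁ x) = same x y
    joins-≡ (inj₂ _) (inj₂ _) = refl

  -- The rows other than `x` become the first m vertices, the columns the next m, and the isolated
  -- row `x` the last vertex.
  star-≅ : ∀ G {x} → IsBipartite G X Y → IsStar (biadjacency G) x → G ≅ (K[ m , m ] ⊍ K 1)
  star-≅ G {x} G-bip (gx , g≢x) = mk↔ₛ′ (ψ ∘ to) (from ∘ ψ⁻¹)
      (λ i → trans (cong ψ (to-from (ψ⁻¹ i))) (ψ-ψ⁻¹ i)) (λ v → trans (cong from (ψ⁻¹-ψ (to v))) (from-to v)) ,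
    λ u v → trans (adj-to G G-bip u v) (sym (adj-ψ (to u) (to v)))
    where
    place : ∀ x′ → Dec (x ≡ x′) → Fin (m + m + 1)
    place x′ (yes _) = (m + m) Fin.↑ʳ zero
    place x′ (no x≢x′) = (Fin.punchOut x≢x′ Fin.↑ˡ m) Fin.↑ˡ 1
    ψ : Fin (suc m) ⊎ Fin m → Fin (m + m + 1)
    ψ (inj₁ x′) = place x′ (x Fin.≟ x′)
    ψ (inj₂ y) = (m Fin.↑ʳ y) Fin.↑ˡ 1
    unplace : (Fin m ⊎ Fin m) → Fin (suc m) ⊎ Fin m
    unplace (inj₁ x′) = inj₁ (Fin.punchIn x x′)
    unplace (inj₂ y) = inj₂ y
    ψ⁻¹ : Fin (m + m + 1) → Fin (suc m) ⊎ Fin m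
    ψ⁻¹ i with Fin.splitAt (m + m) i
    ... | inj₁ j = unplace (Fin.splitAt m j)
    ... | inj₂ _ = inj₁ x
    place-no : ∀ {x′} (x≢x′ : x ≢ x′) d → place x′ d ≡ (Fin.punchOut x≢x′ Fin.↑ˡ m) Fin.↑ˡ 1
    place-no x≢x′ (yes x≡x′) = contradiction x≡x′ x≢x′
    place-no x≢x′ (no x≢x″) = cong (λ j → (j Fin.↑ˡ m) Fin.↑ˡ 1) (Fin.punchOut-cong x refl)
    place-yes : ∀ d → place x d ≡ (m + m) Fin.↑ʳ zero
    place-yes (yes _) = refl
    place-yes (no x≢x) = contradiction refl x≢x
    ψ-ψ⁻¹ : ∀ i → ψ (ψ⁻¹ i) ≡ i
    ψ-ψ⁻¹ i with Fin.splitAt (m + m) i in eq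
    ... | inj₂ zero = trans (place-yes (x Fin.≟ x)) (Fin.splitAt⁻¹-↑ʳ eq)
    ... | inj₁ j with Fin.splitAt m j in eq′
    ...   | inj₁ x′ = trans (place-no (Fin.punchInᵢ≢i x x′ ∘ sym) (x Fin.≟ Fin.punchIn x x′))
              (trans (cong (λ j → (j Fin.↑ˡ m) Fin.↑ˡ 1) (Fin.punchOut-punchIn x))
                (trans (cong (Fin._↑ˡ 1) (Fin.splitAt⁻¹-↑ˡ eq′)) (Fin.splitAt⁻¹-↑ˡ eq)))
    ...   | inj₂ y = trans (cong (Fin._↑ˡ 1) (Fin.splitAt⁻¹-↑ʳ eq′)) (Fin.splitAt⁻¹-↑ˡ eq)
    ψ⁻¹-ψ : ∀ p → ψ⁻¹ (ψ p) ≡ p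
    ψ⁻¹-ψ (inj₂ y) rewrite Fin.splitAt-↑ˡ (m + m) (m Fin.↑ʳ y) 1 | Fin.splitAt-↑ʳ m m y = refl
    ψ⁻¹-ψ (inj₁ x′) with x Fin.≟ x′
    ... | yes refl rewrite Fin.splitAt-↑ʳ (m + m) 1 zero = refl
    ... | no x≢x′ rewrite Fin.splitAt-↑ˡ (m + m) (Fin.punchOut x≢x′ Fin.↑ˡ m) 1
                        | Fin.splitAt-↑ˡ m (Fin.punchOut x≢x′) m = cong inj₁ (Fin.punchIn-punchOut x≢x′)
    adj-ψ : ∀ p q → adj (K[ m , m ] ⊍ K 1) (ψ p) (ψ q) ≡ joins (biadjacency G) p q
    adj-ψ (inj₂ y) (inj₂ y′)
      rewrite Fin.splitAt-↑ˡ (m + m) (m Fin.↑ʳ y) 1 | Fin.splitAt-↑ˡ (m + m) (m Fin.↑ʳ y′) 1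
            | Fin.splitAt-↑ʳ m m y | Fin.splitAt-↑ʳ m m y′ = refl
    adj-ψ (inj₁ x₁) (inj₂ y) with x Fin.≟ x₁
    ... | yes refl rewrite Fin.splitAt-↑ʳ (m + m) 1 zero | Fin.splitAt-↑ˡ (m + m) (m Fin.↑ʳ y) 1 = sym (gx y)
    ... | no x≢x₁ rewrite Fin.splitAt-↑ˡ (m + m) (Fin.punchOut x≢x₁ Fin.↑ˡ m) 1
                        | Fin.splitAt-↑ˡ (m + m) (m Fin.↑ʳ y) 1
                        | Fin.splitAt-↑ˡ m (Fin.punchOut x≢x₁) m | Fin.splitAt-↑ʳ m m y = sym (g≢x x₁ y (x≢x₁ ∘ sym))
    adj-ψ (inj₂ y) (inj₁ x₁) = trans (Graph.adj-sym (K[ m , m ] ⊍ K 1) (ψ (inj₂ y)) (ψ (inj₁ x₁)))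
      (adj-ψ (inj₁ x₁) (inj₂ y))
    adj-ψ (inj₁ x₁) (inj₁ x₂) with x Fin.≟ x₁ | x Fin.≟ x₂
    ... | yes refl | yes refl rewrite Fin.splitAt-↑ʳ (m + m) 1 zero = refl
    ... | yes refl | no x≢x₂ rewrite Fin.splitAt-↑ʳ (m + m) 1 zero
                        | Fin.splitAt-↑ˡ (m + m) (Fin.punchOut x≢x₂ Fin.↑ˡ m) 1 = refl
    ... | no x≢x₁ | yes refl rewrite Fin.splitAt-↑ʳ (m + m) 1 zero
                        | Fin.splitAt-↑ˡ (m + m) (Fin.punchOut x≢x₁ Fin.↑ˡ m) 1 = refl
    ... | no x≢x₁ | no x≢x₂ rewrite Fin.splitAt-↑ˡ (m + m) (Fin.punchOut x≢x₁ Fin.↑ˡ m) 1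
                        | Fin.splitAt-↑ˡ (m + m) (Fin.punchOut x≢x₂ Fin.↑ˡ m) 1
                        | Fin.splitAt-↑ˡ m (Fin.punchOut x≢x₁) m
                        | Fin.splitAt-↑ˡ m (Fin.punchOut x≢x₂) m = refl

rainbow-from-Good : ∀ {m k} {X Y : Subset (suc k)} → 0 < m → k ≡ m + m → (bip : IsBipartition X Y) →
  (coords : Coordinates m X Y) (𝒢 : Family k (suc k)) → (∀ i → IsBipartite (𝒢 i) X Y) →
  (∀ i → Good (biadjacency bip coords (𝒢 i))) →
  ¬ ((∀ i j → 𝒢 i ≐ 𝒢 j) × (∀ i → 𝒢 i ≅ (K[ m , m ] ⊍ K 1))) → HasRainbowHamiltonPath 𝒢
rainbow-from-Good 0<m k≡m+m bip coords 𝒢 𝒢-bip good ¬exceptional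
  with rainbow-Good 0<m k≡m+m (λ i → biadjacency bip coords (𝒢 i)) good
         (λ { (x , star) → ¬exceptional
           ( (λ i j → star-≐ bip coords (𝒢 i) (𝒢 j) (𝒢-bip i) (𝒢-bip j) (star i) (star j))
           , (λ i → star-≅ bip coords (𝒢 i) (𝒢-bip i) (star i))) })
... | A , ok = hasRainbowHamiltonPath 𝒢 (relabel from to to-from from-to A)
      λ {t} t<k → subst T (sym (adj-from bip coords (𝒢 _) (𝒢-bip _) (vertex A t) (vertex A (suc t)))) (ok t<k)
  where open Coordinates coords

-- Real numbers

private variable
  x y x′ y′ z : ℝ
  p q r s δ ε : ℚ

0≤* : 0ℚ ℚ.≤ p → 0ℚ ℚ.≤ q → 0ℚ ℚ.≤ p ℚ.* q
0≤* {p} {q} 0≤p 0≤q = ℚ.nonNegative⁻¹ (p ℚ.* q)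
  {{ℚ.nonNeg*nonNeg⇒nonNeg p {{ℚ.nonNegative 0≤p}} q {{ℚ.nonNegative 0≤q}}}}

0≤+ : 0ℚ ℚ.≤ p → 0ℚ ℚ.≤ q → 0ℚ ℚ.≤ p ℚ.+ q
0≤+ = ℚ.+-mono-≤

0≤1 : 0ℚ ℚ.≤ 1ℚ
0≤1 = ℚ.nonNegative⁻¹ 1ℚ

0≤square : ∀ p → 0ℚ ℚ.≤ p ℚ.* p
0≤square p with ℚ.≤-total 0ℚ p
... | inj₁ 0≤p = 0≤* 0≤p 0≤p
... | inj₂ p≤0 = subst (0ℚ ℚ.≤_) (solve 1 (λ p → (:- p) :* (:- p) := p :* p) refl p)
                   (0≤* (ℚ.neg-antimono-≤ p≤0) (ℚ.neg-antimono-≤ p≤0))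

≤-by-difference : ∀ d → 0ℚ ℚ.≤ d → q ≡ p ℚ.+ d → p ℚ.≤ q
≤-by-difference {q} {p} d 0≤d q≡p+d = subst₂ ℚ._≤_ (ℚ.+-identityʳ p) (sym q≡p+d) (ℚ.+-monoʳ-≤ p 0≤d)

0≤difference : p ℚ.≤ q → 0ℚ ℚ.≤ q ℚ.- p
0≤difference {p} {q} p≤q = subst (ℚ._≤ q ℚ.- p) (ℚ.+-inverseʳ p) (ℚ.+-monoˡ-≤ (ℚ.- p) p≤q)

∣-∣≤⇒≤ : ℚ.∣ p ∣ ℚ.≤ q → p ℚ.≤ q
∣-∣≤⇒≤ {p} ∣p∣≤q with ℚ.∣p∣≡p∨∣p∣≡-p p
... | inj₁ ∣p∣≡p = subst (ℚ._≤ _) ∣p∣≡p ∣p∣≤q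
... | inj₂ ∣p∣≡-p = ℚ.≤-trans p≤0 (ℚ.≤-trans (ℚ.0≤∣p∣ p) ∣p∣≤q)
  where
  p≤0 : p ℚ.≤ 0ℚ
  p≤0 = subst (ℚ._≤ 0ℚ) (solve 1 (λ p → :- (:- p) := p) refl p)
    (ℚ.neg-antimono-≤ (subst (0ℚ ℚ.≤_) ∣p∣≡-p (ℚ.0≤∣p∣ p)))

½ε+½ε : ∀ ε → ½ ℚ.* ε ℚ.+ ½ ℚ.* ε ≡ ε
½ε+½ε ε = trans (sym (ℚ.*-distribʳ-+ ε ½ ½)) (ℚ.*-identityˡ ε)

0<½ε : 0ℚ ℚ.< ε → 0ℚ ℚ.< ½ ℚ.* ε
0<½ε {ε} 0<ε = subst (ℚ._< ½ ℚ.* ε) (ℚ.*-zeroʳ ½) (ℚ.*-monoʳ-<-pos ½ 0<ε)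

fraction : ∀ B .{{_ : ℚ.Positive B}} → 0ℚ ℚ.< ε → ∃[ δ ] 0ℚ ℚ.< δ × B ℚ.* δ ≡ ε
fraction {ε} B 0<ε = B⁻¹ ℚ.* ε
    , subst (ℚ._< B⁻¹ ℚ.* ε) (ℚ.*-zeroʳ B⁻¹) (ℚ.*-monoʳ-<-pos B⁻¹ {{ℚ.1/pos⇒pos B}} 0<ε)
    , trans (sym (ℚ.*-assoc B B⁻¹ ε))
            (trans (cong (ℚ._* ε) (ℚ.*-inverseʳ B {{ℚ.pos⇒nonZero B}})) (ℚ.*-identityˡ ε))
  where
  B⁻¹ : ℚ
  B⁻¹ = (ℚ.1/ B) {{ℚ.pos⇒nonZero B}}

eventually₂ : {P Q R : ℕ → Set} → Eventually P → Eventually Q → (∀ n → P n → Q n → R n) → Eventually R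
eventually₂ (M , p) (N , q) f = M ℕ.⊔ N , λ n M⊔N≤n →
  f n (p n (ℕ.m⊔n≤o⇒m≤o M N M⊔N≤n)) (q n (ℕ.m⊔n≤o⇒n≤o M N M⊔N≤n))

eventually₁ : {P Q : ℕ → Set} → Eventually P → (∀ n → P n → Q n) → Eventually Q
eventually₁ (M , p) f = M , λ n M≤n → f n (p n M≤n)

always : {P : ℕ → Set} → (∀ n → P n) → Eventually P
always p = 0 , λ n _ → p n

bounded : ∀ x → ∃[ B ] 0ℚ ℚ.< B × Eventually λ n → ℚ.∣ seq x n ∣ ℚ.≤ B
bounded x with cauchy x 1ℚ (ℚ.positive⁻¹ 1ℚ)
... | N , close-to = 1ℚ ℚ.+ ℚ.∣ seq x N ∣ , ℚ.+-mono-<-≤ (ℚ.positive⁻¹ 1ℚ) (ℚ.0≤∣p∣ (seq x N)) ,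
      N , λ n N≤n → begin
  ℚ.∣ seq x n ∣
    ≡⟨ cong ℚ.∣_∣ (solve 2 (λ a b → a := (a :- b) :+ b) refl (seq x n) (seq x N)) ⟩
  ℚ.∣ (seq x n ℚ.- seq x N) ℚ.+ seq x N ∣
    ≤⟨ ℚ.∣p+q∣≤∣p∣+∣q∣ (seq x n ℚ.- seq x N) (seq x N) ⟩
  ℚ.∣ seq x n ℚ.- seq x N ∣ ℚ.+ ℚ.∣ seq x N ∣
    ≤⟨ ℚ.+-monoˡ-≤ ℚ.∣ seq x N ∣ (close-to n N N≤n ℕ.≤-refl) ⟩
  1ℚ ℚ.+ ℚ.∣ seq x N ∣ ∎
  where open ℚ.≤-Reasoning

≗⇒≈ : (∀ n → seq x n ≡ seq y n) → x ≈ℝ y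
≗⇒≈ {x} {y} x≗y = mk≈ λ ε 0<ε → always λ n → subst (ℚ._≤ ε)
  (sym (cong ℚ.∣_∣ (trans (cong (ℚ._- seq y n) (x≗y n)) (ℚ.+-inverseʳ (seq y n))))) (ℚ.<⇒≤ 0<ε)

≈-sym : x ≈ℝ y → y ≈ℝ x
≈-sym {x} {y} x≈y = mk≈ λ ε 0<ε → eventually₁ (close x≈y ε 0<ε) λ n → subst (ℚ._≤ ε)
  (trans (sym (ℚ.∣-p∣≡∣p∣ (seq x n ℚ.- seq y n)))
    (cong ℚ.∣_∣ (solve 2 (λ a b → :- (a :- b) := b :- a) refl (seq x n) (seq y n))))

≈-trans : x ≈ℝ y → y ≈ℝ z → x ≈ℝ z
≈-trans {x} {y} {z} x≈y y≈z = mk≈ λ ε 0<ε →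
  eventually₂ (close x≈y (½ ℚ.* ε) (0<½ε 0<ε)) (close y≈z (½ ℚ.* ε) (0<½ε 0<ε)) λ n p q → begin
    ℚ.∣ seq x n ℚ.- seq z n ∣
      ≡⟨ cong ℚ.∣_∣ (solve 3 (λ a b c → a :- c := (a :- b) :+ (b :- c)) refl (seq x n) (seq y n) (seq z n)) ⟩
    ℚ.∣ (seq x n ℚ.- seq y n) ℚ.+ (seq y n ℚ.- seq z n) ∣
      ≤⟨ ℚ.∣p+q∣≤∣p∣+∣q∣ (seq x n ℚ.- seq y n) (seq y n ℚ.- seq z n) ⟩
    ℚ.∣ seq x n ℚ.- seq y n ∣ ℚ.+ ℚ.∣ seq y n ℚ.- seq z n ∣
      ≤⟨ ℚ.+-mono-≤ p q ⟩
    ½ ℚ.* ε ℚ.+ ½ ℚ.* ε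
      ≡⟨ ½ε+½ε ε ⟩
    ε ∎
  where open ℚ.≤-Reasoning

+ℝ-cong : x ≈ℝ x′ → y ≈ℝ y′ → x +ℝ y ≈ℝ x′ +ℝ y′
+ℝ-cong {x} {x′} {y} {y′} x≈x′ y≈y′ = mk≈ λ ε 0<ε →
  eventually₂ (close x≈x′ (½ ℚ.* ε) (0<½ε 0<ε)) (close y≈y′ (½ ℚ.* ε) (0<½ε 0<ε)) λ n p q → begin
    ℚ.∣ (seq x n ℚ.+ seq y n) ℚ.- (seq x′ n ℚ.+ seq y′ n) ∣
      ≡⟨ cong ℚ.∣_∣ (solve 4 (λ a b c d → (a :+ b) :- (c :+ d) := (a :- c) :+ (b :- d)) refl
           (seq x n) (seq y n) (seq x′ n) (seq y′ n)) ⟩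
    ℚ.∣ (seq x n ℚ.- seq x′ n) ℚ.+ (seq y n ℚ.- seq y′ n) ∣
      ≤⟨ ℚ.∣p+q∣≤∣p∣+∣q∣ (seq x n ℚ.- seq x′ n) (seq y n ℚ.- seq y′ n) ⟩
    ℚ.∣ seq x n ℚ.- seq x′ n ∣ ℚ.+ ℚ.∣ seq y n ℚ.- seq y′ n ∣
      ≤⟨ ℚ.+-mono-≤ p q ⟩
    ½ ℚ.* ε ℚ.+ ½ ℚ.* ε
      ≡⟨ ½ε+½ε ε ⟩
    ε ∎
  where open ℚ.≤-Reasoning

∣*∣-mono : ∀ {a b B δ} → ℚ.∣ a ∣ ℚ.≤ B → ℚ.∣ b ∣ ℚ.≤ δ → ℚ.∣ a ℚ.* b ∣ ℚ.≤ B ℚ.* δ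
∣*∣-mono {a} {b} {B} {δ} a≤B b≤δ = begin
  ℚ.∣ a ℚ.* b ∣        ≡⟨ ℚ.∣p*q∣≡∣p∣*∣q∣ a b ⟩
  ℚ.∣ a ∣ ℚ.* ℚ.∣ b ∣  ≤⟨ ℚ.*-monoʳ-≤-nonNeg ℚ.∣ b ∣ {{ℚ.∣-∣-nonNeg b}} a≤B ⟩
  B ℚ.* ℚ.∣ b ∣        ≤⟨ ℚ.*-monoˡ-≤-nonNeg B {{ℚ.nonNegative (ℚ.≤-trans (ℚ.0≤∣p∣ a) a≤B)}} b≤δ ⟩
  B ℚ.* δ              ∎
  where open ℚ.≤-Reasoning

*ℝ-cong : x ≈ℝ x′ → y ≈ℝ y′ → x *ℝ y ≈ℝ x′ *ℝ y′
*ℝ-cong {x} {x′} {y} {y′} x≈x′ y≈y′ = mk≈ λ ε 0<ε →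
  let B , 0<B , ∣x∣≤B = bounded x
      C , 0<C , ∣y′∣≤C = bounded y′
      δ , 0<δ , Bδ≡½ε = fraction B {{ℚ.positive 0<B}} (0<½ε 0<ε)
      η , 0<η , Cη≡½ε = fraction C {{ℚ.positive 0<C}} (0<½ε 0<ε)
  in eventually₂
       (eventually₂ ∣x∣≤B (close y≈y′ δ 0<δ) λ n → ∣*∣-mono {seq x n} {seq y n ℚ.- seq y′ n})
       (eventually₂ ∣y′∣≤C (close x≈x′ η 0<η) λ n → ∣*∣-mono {seq y′ n} {seq x n ℚ.- seq x′ n})
       λ n p q → begin
         ℚ.∣ seq x n ℚ.* seq y n ℚ.- seq x′ n ℚ.* seq y′ n ∣
           ≡⟨ cong ℚ.∣_∣ (solve 4 (λ a b c d → a :* b :- c :* d := a :* (b :- d) :+ d :* (a :- c)) refl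
                (seq x n) (seq y n) (seq x′ n) (seq y′ n)) ⟩
         ℚ.∣ seq x n ℚ.* (seq y n ℚ.- seq y′ n) ℚ.+ seq y′ n ℚ.* (seq x n ℚ.- seq x′ n) ∣
           ≤⟨ ℚ.∣p+q∣≤∣p∣+∣q∣ (seq x n ℚ.* (seq y n ℚ.- seq y′ n)) (seq y′ n ℚ.* (seq x n ℚ.- seq x′ n)) ⟩
         _ ≤⟨ ℚ.+-mono-≤ p q ⟩
         _ ≡⟨ cong₂ ℚ._+_ Bδ≡½ε Cη≡½ε ⟩
         ½ ℚ.* ε ℚ.+ ½ ℚ.* ε
           ≡⟨ ½ε+½ε ε ⟩
         ε ∎
  where open ℚ.≤-Reasoning

≤ℝ-pointwise : (∀ n → seq x n ℚ.≤ seq y n) → x ≤ℝ y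
≤ℝ-pointwise {x} {y} x≤y = mk≤ λ ε 0<ε → always λ n → ℚ.≤-trans (x≤y n)
  (≤-by-difference ε (ℚ.<⇒≤ 0<ε) refl)

≈⇒≤ : x ≈ℝ y → x ≤ℝ y
≈⇒≤ {x} {y} x≈y = mk≤ λ ε 0<ε → eventually₁ (close x≈y ε 0<ε) λ n p →
  ≤-by-difference (ε ℚ.- (seq x n ℚ.- seq y n)) (0≤difference (∣-∣≤⇒≤ p))
    (solve 3 (λ a b e → b :+ e := a :+ (e :- (a :- b))) refl (seq x n) (seq y n) ε)

≤ℝ-trans : x ≤ℝ y → y ≤ℝ z → x ≤ℝ z
≤ℝ-trans {x} {y} {z} x≤y y≤z = mk≤ λ ε 0<ε →
  eventually₂ (below x≤y (½ ℚ.* ε) (0<½ε 0<ε)) (below y≤z (½ ℚ.* ε) (0<½ε 0<ε)) λ n p q → begin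
    seq x n                                    ≤⟨ p ⟩
    seq y n ℚ.+ ½ ℚ.* ε                        ≤⟨ ℚ.+-monoˡ-≤ (½ ℚ.* ε) q ⟩
    seq z n ℚ.+ ½ ℚ.* ε ℚ.+ ½ ℚ.* ε            ≡⟨ ℚ.+-assoc (seq z n) _ _ ⟩
    seq z n ℚ.+ (½ ℚ.* ε ℚ.+ ½ ℚ.* ε)          ≡⟨ cong (seq z n ℚ.+_) (½ε+½ε ε) ⟩
    seq z n ℚ.+ ε                              ∎
  where open ℚ.≤-Reasoning

+ℝ-mono-≤ : x ≤ℝ x′ → y ≤ℝ y′ → x +ℝ y ≤ℝ x′ +ℝ y′
+ℝ-mono-≤ {x} {x′} {y} {y′} x≤x′ y≤y′ = mk≤ λ ε 0<ε →
  eventually₂ (below x≤x′ (½ ℚ.* ε) (0<½ε 0<ε)) (below y≤y′ (½ ℚ.* ε) (0<½ε 0<ε)) λ n p q → begin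
    seq x n ℚ.+ seq y n
      ≤⟨ ℚ.+-mono-≤ p q ⟩
    (seq x′ n ℚ.+ ½ ℚ.* ε) ℚ.+ (seq y′ n ℚ.+ ½ ℚ.* ε)
      ≡⟨ solve 4 (λ a b e f → (a :+ e) :+ (b :+ f) := (a :+ b) :+ (e :+ f)) refl (seq x′ n) (seq y′ n) _ _ ⟩
    (seq x′ n ℚ.+ seq y′ n) ℚ.+ (½ ℚ.* ε ℚ.+ ½ ℚ.* ε)
      ≡⟨ cong (seq x′ n ℚ.+ seq y′ n ℚ.+_) (½ε+½ε ε) ⟩
    (seq x′ n ℚ.+ seq y′ n) ℚ.+ ε ∎
  where open ℚ.≤-Reasoning

-- From x ≥ -δ and y ≥ -η one has (x + δ)(y + η) ≥ 0. With x ≤ B and y ≤ C this gives xy + (B + δ)η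
-- + Cδ ≥ 0. The choice of η depends on δ, so δ comes first.
0≤*ℝ : 0ℝ ≤ℝ x → 0ℝ ≤ℝ y → 0ℝ ≤ℝ x *ℝ y
0≤*ℝ {x} {y} 0≤x 0≤y = mk≤ λ ε 0<ε →
  let C , 0<C , ∣y∣≤C = bounded y
      δ , 0<δ , Cδ≡½ε = fraction C {{ℚ.positive 0<C}} (0<½ε 0<ε)
      B , 0<B , ∣x∣≤B = bounded x
      0<B+δ = ℚ.+-mono-<-≤ 0<B (ℚ.<⇒≤ 0<δ)
      η , 0<η , B+δη≡½ε = fraction (B ℚ.+ δ) {{ℚ.positive 0<B+δ}} (0<½ε 0<ε)
  in eventually₂ (eventually₂ (below 0≤x δ 0<δ) (below 0≤y η 0<η) λ _ → _,_)
                 (eventually₂ ∣x∣≤B ∣y∣≤C λ _ → _,_)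
     λ { n (p , q) (p′ , q′) → subst (λ e → 0ℚ ℚ.≤ seq x n ℚ.* seq y n ℚ.+ e)
           (trans (cong₂ ℚ._+_ B+δη≡½ε Cδ≡½ε) (½ε+½ε ε))
           (subst (0ℚ ℚ.≤_)
             (solve 6 (λ x y δ η B C →
               (x :+ δ) :* (y :+ η) :+ ((B :- x) :* η :+ (C :- y) :* δ) :=
               x :* y :+ ((B :+ δ) :* η :+ C :* δ)) refl (seq x n) (seq y n) δ η B C)
             (0≤+ (0≤* p q) (0≤+ (0≤* (0≤difference (∣-∣≤⇒≤ p′)) (ℚ.<⇒≤ 0<η))
                                 (0≤* (0≤difference (∣-∣≤⇒≤ q′)) (ℚ.<⇒≤ 0<δ))))) }

-- Eigenvectors and the Cauchy–Schwarz inequality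

constℝ : ℚ → ℝ
constℝ q = mkℝ (λ _ → q) λ ε 0<ε → 0 , λ _ _ _ _ →
  subst (ℚ._≤ ε) (sym (cong ℚ.∣_∣ (ℚ.+-inverseʳ q))) (ℚ.<⇒≤ 0<ε)

sumℝ : (Fin a → ℝ) → ℝ
sumℝ {zero}  f = 0ℝ
sumℝ {suc a} f = f zero +ℝ sumℝ (f ∘ suc)

seq-sumℝ : (f : Fin a → ℝ) → ∀ n → seq (sumℝ f) n ≡ ∑ℚ.sum λ i → seq (f i) n
seq-sumℝ {zero}  f n = refl
seq-sumℝ {suc a} f n = cong (seq (f zero) n ℚ.+_) (seq-sumℝ (f ∘ suc) n)

re-sumℂ : (f : Fin a → ℂ) → ∀ n → seq (re (sumℂ f)) n ≡ ∑ℚ.sum λ i → seq (re (f i)) n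
re-sumℂ {zero}  f n = refl
re-sumℂ {suc a} f n = cong (seq (re (f zero)) n ℚ.+_) (re-sumℂ (f ∘ suc) n)

im-sumℂ : (f : Fin a → ℂ) → ∀ n → seq (im (sumℂ f)) n ≡ ∑ℚ.sum λ i → seq (im (f i)) n
im-sumℂ {zero}  f n = refl
im-sumℂ {suc a} f n = cong (seq (im (f zero)) n ℚ.+_) (im-sumℂ (f ∘ suc) n)

sumℝ-cong : {f g : Fin a → ℝ} → (∀ i → f i ≈ℝ g i) → sumℝ f ≈ℝ sumℝ g
sumℝ-cong {zero}  f≈g = ≗⇒≈ λ _ → refl
sumℝ-cong {suc a} f≈g = +ℝ-cong (f≈g zero) (sumℝ-cong (f≈g ∘ suc))

χ : Bool → ℚ
χ b = if b then 1ℚ else 0ℚ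

normℚ : (Fin b → ℚ) → ℚ
normℚ q = ∑ℚ.sum λ j → q j ℚ.* q j

rowℚ : Grid a b → (Fin b → ℚ) → Fin a → ℚ
rowℚ g q i = ∑ℚ.sum λ j → χ (g i j) ℚ.* q j

normℝ : (Fin b → ℝ) → ℝ
normℝ w = sumℝ λ j → w j *ℝ w j

rowℝ : Grid a b → (Fin b → ℝ) → Fin a → ℝ
rowℝ g w i = sumℝ λ j → constℝ (χ (g i j)) *ℝ w j

seq-normℝ : (w : Fin b → ℝ) → ∀ n → seq (normℝ w) n ≡ normℚ (λ j → seq (w j) n)
seq-normℝ w = seq-sumℝ λ j → w j *ℝ w j

seq-norm-rowℝ : (g : Grid a b) (w : Fin b → ℝ) → ∀ n →
  seq (normℝ (rowℝ g w)) n ≡ normℚ (rowℚ g λ j → seq (w j) n)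
seq-norm-rowℝ g w n = trans (seq-normℝ (rowℝ g w) n)
  (∑ℚ.sum-cong-≗ λ i → cong₂ ℚ._*_ (seq-sumℝ (λ j → constℝ (χ (g i j)) *ℝ w j) n)
                                   (seq-sumℝ (λ j → constℝ (χ (g i j)) *ℝ w j) n))

sumℚ-nonNeg : {f : Fin a → ℚ} → (∀ i → 0ℚ ℚ.≤ f i) → 0ℚ ℚ.≤ ∑ℚ.sum f
sumℚ-nonNeg {zero}  0≤f = ℚ.≤-refl
sumℚ-nonNeg {suc a} 0≤f = 0≤+ (0≤f zero) (sumℚ-nonNeg (0≤f ∘ suc))

term≤sumℚ : {f : Fin a → ℚ} → (∀ i → 0ℚ ℚ.≤ f i) → ∀ i → f i ℚ.≤ ∑ℚ.sum f
term≤sumℚ {f = f} 0≤f zero = ≤-by-difference _ (sumℚ-nonNeg (0≤f ∘ suc)) refl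
term≤sumℚ {f = f} 0≤f (suc i) = ℚ.≤-trans (term≤sumℚ (0≤f ∘ suc) i)
  (≤-by-difference (f zero) (0≤f zero) (ℚ.+-comm (f zero) _))

norm-nonNeg : (q : Fin b → ℚ) → 0ℚ ℚ.≤ normℚ q
norm-nonNeg q = sumℚ-nonNeg λ j → 0≤square (q j)

-- An eigenvector for an eigenvalue of modulus at least c is stretched by at least c.
eigen-growth : (g : Grid a b) (R I : Fin a → ℝ) (R′ I′ : Fin b → ℝ) {α β r : ℝ} {c : ℚ} →
  (∀ i → rowℝ g R′ i ≈ℝ α *ℝ R i -ℝ β *ℝ I i) → (∀ i → rowℝ g I′ i ≈ℝ α *ℝ I i +ℝ β *ℝ R i) →
  r *ℝ r ≈ℝ α *ℝ α +ℝ β *ℝ β → 0ℝ ≤ℝ r → 0ℚ ℚ.≤ c → constℝ c ≤ℝ r →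
  constℝ (c ℚ.* c) *ℝ (normℝ R +ℝ normℝ I) ≤ℝ normℝ (rowℝ g R′) +ℝ normℝ (rowℝ g I′)
eigen-growth g R I R′ I′ {α} {β} {r} {c} eqR eqI r²≈ 0≤r 0≤c c≤r =
  ≤ℝ-trans {y = (r *ℝ r) *ℝ Q} (≤ℝ-trans {y = cQ +ℝ D} cQ≤cQ+D (≈⇒≤ (≗⇒≈ cQ+D≡r²Q))) (≈⇒≤ (≈-sym P≈r²Q))
  where
  Q cQ D : ℝ
  Q = normℝ R +ℝ normℝ I
  cQ = constℝ (c ℚ.* c) *ℝ Q
  -- The surplus (r² - c²)Q, factored so that each factor is nonnegative by hypothesis.
  D = ((r -ℝ constℝ c) *ℝ (r +ℝ constℝ c)) *ℝ Q
  0≤r-c : 0ℝ ≤ℝ r -ℝ constℝ c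
  0≤r-c = mk≤ λ ε 0<ε → eventually₁ (below c≤r ε 0<ε) λ n p → subst (0ℚ ℚ.≤_)
    (solve 3 (λ r c e → (r :+ e) :- c := (r :- c) :+ e) refl (seq r n) c ε) (0≤difference p)
  0≤r+c : 0ℝ ≤ℝ r +ℝ constℝ c
  0≤r+c = mk≤ λ ε 0<ε → eventually₁ (below 0≤r ε 0<ε) λ n p → subst (0ℚ ℚ.≤_)
    (solve 3 (λ r c e → (r :+ e) :+ c := (r :+ c) :+ e) refl (seq r n) c ε) (0≤+ p 0≤c)
  0≤Q : 0ℝ ≤ℝ Q
  0≤Q = ≤ℝ-pointwise λ n → subst (0ℚ ℚ.≤_) (sym (cong₂ ℚ._+_ (seq-normℝ R n) (seq-normℝ I n)))
    (0≤+ (norm-nonNeg λ j → seq (R j) n) (norm-nonNeg λ j → seq (I j) n))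
  cQ≤cQ+D : cQ ≤ℝ cQ +ℝ D
  cQ≤cQ+D = ≤ℝ-trans {y = cQ +ℝ 0ℝ} (≤ℝ-pointwise λ n → ℚ.≤-reflexive (sym (ℚ.+-identityʳ (seq cQ n))))
    (+ℝ-mono-≤ (≤ℝ-pointwise {cQ} {cQ} λ _ → ℚ.≤-refl) (0≤*ℝ (0≤*ℝ 0≤r-c 0≤r+c) 0≤Q))
  cQ+D≡r²Q : ∀ n → seq (cQ +ℝ D) n ≡ seq ((r *ℝ r) *ℝ Q) n
  cQ+D≡r²Q n = solve 3 (λ r c Q → (c :* c) :* Q :+ ((r :- c) :* (r :+ c)) :* Q := (r :* r) :* Q) refl
    (seq r n) c (seq Q n)
  R₁ I₁ : Fin _ → ℝ
  R₁ i = α *ℝ R i -ℝ β *ℝ I i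
  I₁ i = α *ℝ I i +ℝ β *ℝ R i
  pointwise : ∀ n → seq (normℝ R₁ +ℝ normℝ I₁) n ≡ seq ((α *ℝ α +ℝ β *ℝ β) *ℝ Q) n
  pointwise n = begin
    seq (normℝ R₁) n ℚ.+ seq (normℝ I₁) n
      ≡⟨ cong₂ ℚ._+_ (seq-normℝ R₁ n) (seq-normℝ I₁ n) ⟩
    normℚ (λ i → seq (R₁ i) n) ℚ.+ normℚ (λ i → seq (I₁ i) n)
      ≡⟨ ∑ℚ.∑-distrib-+ (λ i → seq (R₁ i) n ℚ.* seq (R₁ i) n) (λ i → seq (I₁ i) n ℚ.* seq (I₁ i) n) ⟨
    ∑ℚ.sum (λ i → seq (R₁ i) n ℚ.* seq (R₁ i) n ℚ.+ seq (I₁ i) n ℚ.* seq (I₁ i) n)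
      -- The identity |zw|² = |z|²|w|² for each entry w of the eigenvector.
      ≡⟨ ∑ℚ.sum-cong-≗ (λ i → solve 4 (λ α β x y →
           (α :* x :+ (:- (β :* y))) :* (α :* x :+ (:- (β :* y))) :+ (α :* y :+ β :* x) :* (α :* y :+ β :* x)
           := (α :* α :+ β :* β) :* (x :* x :+ y :* y)) refl (seq α n) (seq β n) (seq (R i) n) (seq (I i) n)) ⟩
    ∑ℚ.sum (λ i → A ℚ.* (seq (R i) n ℚ.* seq (R i) n ℚ.+ seq (I i) n ℚ.* seq (I i) n))
      ≡⟨ ∑ℚ.*-distribˡ-sum A (λ i → seq (R i) n ℚ.* seq (R i) n ℚ.+ seq (I i) n ℚ.* seq (I i) n) ⟨
    A ℚ.* ∑ℚ.sum (λ i → seq (R i) n ℚ.* seq (R i) n ℚ.+ seq (I i) n ℚ.* seq (I i) n)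
      ≡⟨ cong (A ℚ.*_) (∑ℚ.∑-distrib-+ (λ i → seq (R i) n ℚ.* seq (R i) n) (λ i → seq (I i) n ℚ.* seq (I i) n)) ⟩
    A ℚ.* (normℚ (λ i → seq (R i) n) ℚ.+ normℚ (λ i → seq (I i) n))
      ≡⟨ cong (A ℚ.*_) (cong₂ ℚ._+_ (seq-normℝ R n) (seq-normℝ I n)) ⟨
    A ℚ.* seq Q n ∎
    where
    open ≡-Reasoning
    A = seq α n ℚ.* seq α n ℚ.+ seq β n ℚ.* seq β n
  P≈r²Q : normℝ (rowℝ g R′) +ℝ normℝ (rowℝ g I′) ≈ℝ (r *ℝ r) *ℝ Q
  P≈r²Q = ≈-trans {y = normℝ R₁ +ℝ normℝ I₁}
    (+ℝ-cong (sumℝ-cong λ i → *ℝ-cong (eqR i) (eqR i)) (sumℝ-cong λ i → *ℝ-cong (eqI i) (eqI i)))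
    (≈-trans {y = (α *ℝ α +ℝ β *ℝ β) *ℝ Q} (≗⇒≈ pointwise)
      (*ℝ-cong (≈-sym r²≈) (≗⇒≈ {Q} {Q} λ _ → refl)))

-- The Cauchy-Schwarz inequality with an explicit deficit

ι : ℕ → ℚ
ι n = n Mult.× 1ℚ

ι-nonNeg : ∀ n → 0ℚ ℚ.≤ ι n
ι-nonNeg zero    = ℚ.≤-refl
ι-nonNeg (suc n) = 0≤+ 0≤1 (ι-nonNeg n)

ι-mono : ∀ {m n} → m ≤ n → ι m ℚ.≤ ι n
ι-mono {m} {n} m≤n = ≤-by-difference (ι (n ∸ m)) (ι-nonNeg (n ∸ m))
  (trans (cong ι (sym (ℕ.m+[n∸m]≡n m≤n))) (Mult.×-homo-+ 1ℚ m (n ∸ m)))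

ι-sum : (f : Fin a → ℕ) → ι (∑.sum f) ≡ ∑ℚ.sum (ι ∘ f)
ι-sum {zero}  f = refl
ι-sum {suc a} f = trans (Mult.×-homo-+ 1ℚ (f zero) (∑.sum (f ∘ suc))) (cong (ι (f zero) ℚ.+_) (ι-sum (f ∘ suc)))

present : Bool → ℕ
present true  = 1
present false = 0

ones : Grid a b → ℕ
ones g = ∑.sum λ i → ∑.sum λ j → present (g i j)

degree : (Fin b → Bool) → ℚ
degree β = ∑ℚ.sum λ j → χ (β j)

sum-degree : (g : Grid a b) → (∑ℚ.sum λ i → degree (g i)) ≡ ι (ones g)
sum-degree g = sym (trans (ι-sum λ i → ∑.sum λ j → present (g i j))
  (∑ℚ.sum-cong-≗ λ i → trans (ι-sum λ j → present (g i j)) (∑ℚ.sum-cong-≗ λ j → ι-present (g i j))))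
  where
  ι-present : ∀ b → ι (present b) ≡ χ b
  ι-present true  = refl
  ι-present false = refl

twice : ℚ → ℚ
twice p = p ℚ.+ p

-- The summands of twice the deficit in the Cauchy–Schwarz inequality
-- (∑_{j ∈ β} q j)² ≤ ∣ β ∣ ∑_j (q j)².
deficit : Bool → Bool → ℚ → ℚ → ℚ
deficit true  true  x y = (x ℚ.- y) ℚ.* (x ℚ.- y)
deficit false true  x y = x ℚ.* x
deficit true  false x y = y ℚ.* y
deficit false false x y = 0ℚ

deficit-nonNeg : ∀ s t x y → 0ℚ ℚ.≤ deficit s t x y
deficit-nonNeg true  true  x y = 0≤square (x ℚ.- y)
deficit-nonNeg false true  x y = 0≤square x
deficit-nonNeg true  false x y = 0≤square y
deficit-nonNeg false false x y = ℚ.≤-refl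

module _ (β : Fin b → Bool) (q : Fin b → ℚ) where

  private
    S = ∑ℚ.sum λ j → χ (β j) ℚ.* q j
    d cross : Fin b → Fin b → ℚ
    d j l = deficit (β j) (β l) (q j) (q l)
    cross j l = (χ (β j) ℚ.* q j) ℚ.* (χ (β l) ℚ.* q l)

  deficits : ℚ
  deficits = ∑ℚ.sum λ j → ∑ℚ.sum λ l → d j l

  deficits-nonNeg : 0ℚ ℚ.≤ deficits
  deficits-nonNeg = sumℚ-nonNeg λ j → sumℚ-nonNeg λ l → deficit-nonNeg (β j) (β l) (q j) (q l)

  deficit≤deficits : ∀ j l → deficit (β j) (β l) (q j) (q l) ℚ.≤ deficits
  deficit≤deficits j l = ℚ.≤-trans
    (term≤sumℚ (λ l → deficit-nonNeg (β j) (β l) (q j) (q l)) l)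
    (term≤sumℚ (λ j → sumℚ-nonNeg λ l → deficit-nonNeg (β j) (β l) (q j) (q l)) j)

  private
    ∑∑-distrib-+ : (f g : Fin b → Fin b → ℚ) →
      (∑ℚ.sum λ j → ∑ℚ.sum λ l → f j l ℚ.+ g j l) ≡
      (∑ℚ.sum λ j → ∑ℚ.sum (f j)) ℚ.+ (∑ℚ.sum λ j → ∑ℚ.sum (g j))
    ∑∑-distrib-+ f g = trans (∑ℚ.sum-cong-≗ λ j → ∑ℚ.∑-distrib-+ (f j) (g j))
      (∑ℚ.∑-distrib-+ (λ j → ∑ℚ.sum (f j)) (λ j → ∑ℚ.sum (g j)))
    ∑∑-product : (f g : Fin b → ℚ) →
      (∑ℚ.sum λ j → ∑ℚ.sum λ l → f j ℚ.* g l) ≡ ∑ℚ.sum f ℚ.* ∑ℚ.sum g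
    ∑∑-product f g = trans (∑ℚ.sum-cong-≗ λ j → sym (∑ℚ.*-distribˡ-sum (f j) g))
      (sym (∑ℚ.*-distribʳ-sum (∑ℚ.sum g) f))
    expand : ∀ s t x y → deficit s t x y ℚ.+ ((χ s ℚ.* x) ℚ.* (χ t ℚ.* y) ℚ.+ (χ s ℚ.* x) ℚ.* (χ t ℚ.* y)) ≡
      χ s ℚ.* (y ℚ.* y) ℚ.+ (x ℚ.* x) ℚ.* χ t
    expand true true = solve 2 (λ x y →
      (x :- y) :* (x :- y) :+ ((con 1ℚ :* x) :* (con 1ℚ :* y) :+ (con 1ℚ :* x) :* (con 1ℚ :* y)) :=
      con 1ℚ :* (y :* y) :+ (x :* x) :* con 1ℚ) refl
    expand false true = solve 2 (λ x y →
      x :* x :+ ((con 0ℚ :* x) :* (con 1ℚ :* y) :+ (con 0ℚ :* x) :* (con 1ℚ :* y)) :=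
      con 0ℚ :* (y :* y) :+ (x :* x) :* con 1ℚ) refl
    expand true false = solve 2 (λ x y →
      y :* y :+ ((con 1ℚ :* x) :* (con 0ℚ :* y) :+ (con 1ℚ :* x) :* (con 0ℚ :* y)) :=
      con 1ℚ :* (y :* y) :+ (x :* x) :* con 0ℚ) refl
    expand false false = solve 2 (λ x y →
      con 0ℚ :+ ((con 0ℚ :* x) :* (con 0ℚ :* y) :+ (con 0ℚ :* x) :* (con 0ℚ :* y)) :=
      con 0ℚ :* (y :* y) :+ (x :* x) :* con 0ℚ) refl

  -- A variant of Lagrange's identity, summed over ordered pairs (j, l), hence the factor two: each
  -- deficit plus twice the product of the two terms of `S` is χ_j q_l² + χ_l q_j².
  cauchySchwarz : deficits ℚ.+ twice (S ℚ.* S) ≡ twice (degree β ℚ.* normℚ q)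
  cauchySchwarz = begin
    deficits ℚ.+ (S ℚ.* S ℚ.+ S ℚ.* S)
      ≡⟨ cong (λ z → deficits ℚ.+ (z ℚ.+ z)) (∑∑-product (λ j → χ (β j) ℚ.* q j) (λ j → χ (β j) ℚ.* q j)) ⟨
    deficits ℚ.+ ((∑ℚ.sum λ j → ∑ℚ.sum (cross j)) ℚ.+ (∑ℚ.sum λ j → ∑ℚ.sum (cross j)))
      ≡⟨ cong (deficits ℚ.+_) (∑∑-distrib-+ cross cross) ⟨
    deficits ℚ.+ (∑ℚ.sum λ j → ∑ℚ.sum λ l → cross j l ℚ.+ cross j l)
      ≡⟨ ∑∑-distrib-+ d (λ j l → cross j l ℚ.+ cross j l) ⟨
    (∑ℚ.sum λ j → ∑ℚ.sum λ l → d j l ℚ.+ (cross j l ℚ.+ cross j l))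
      ≡⟨ ∑ℚ.sum-cong-≗ (λ j → ∑ℚ.sum-cong-≗ λ l → expand (β j) (β l) (q j) (q l)) ⟩
    (∑ℚ.sum λ j → ∑ℚ.sum λ l → χ (β j) ℚ.* (q l ℚ.* q l) ℚ.+ (q j ℚ.* q j) ℚ.* χ (β l))
      ≡⟨ ∑∑-distrib-+ (λ j l → χ (β j) ℚ.* (q l ℚ.* q l)) (λ j l → (q j ℚ.* q j) ℚ.* χ (β l)) ⟩
    _ ≡⟨ cong₂ ℚ._+_ (∑∑-product (χ ∘ β) (λ l → q l ℚ.* q l)) (∑∑-product (λ j → q j ℚ.* q j) (χ ∘ β)) ⟩
    degree β ℚ.* normℚ q ℚ.+ normℚ q ℚ.* degree β
      ≡⟨ cong (degree β ℚ.* normℚ q ℚ.+_) (ℚ.*-comm (normℚ q) (degree β)) ⟩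
    twice (degree β ℚ.* normℚ q) ∎
    where open ≡-Reasoning

module _ (g : Grid a b) (q : Fin b → ℚ) where

  private
    sum-twice : (f : Fin a → ℚ) → (∑ℚ.sum λ i → twice (f i)) ≡ twice (∑ℚ.sum f)
    sum-twice f = ∑ℚ.∑-distrib-+ f f

  -- Summed over the rows, the degrees add up to the number of edges, whence ‖gq‖² ≤ e‖q‖² with e
  -- edges.
  sum-cauchySchwarz : (∑ℚ.sum λ i → deficits (g i) q) ℚ.+ twice (normℚ (rowℚ g q)) ≡
    twice (ι (ones g) ℚ.* normℚ q)
  sum-cauchySchwarz = begin
    (∑ℚ.sum λ i → deficits (g i) q) ℚ.+ twice (normℚ (rowℚ g q))
      ≡⟨ cong ((∑ℚ.sum λ i → deficits (g i) q) ℚ.+_) (sum-twice λ i → rowℚ g q i ℚ.* rowℚ g q i) ⟨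
    (∑ℚ.sum λ i → deficits (g i) q) ℚ.+ (∑ℚ.sum λ i → twice (rowℚ g q i ℚ.* rowℚ g q i))
      ≡⟨ ∑ℚ.∑-distrib-+ (λ i → deficits (g i) q) (λ i → twice (rowℚ g q i ℚ.* rowℚ g q i)) ⟨
    (∑ℚ.sum λ i → deficits (g i) q ℚ.+ twice (rowℚ g q i ℚ.* rowℚ g q i))
      ≡⟨ ∑ℚ.sum-cong-≗ (λ i → cauchySchwarz (g i) q) ⟩
    (∑ℚ.sum λ i → twice (degree (g i) ℚ.* normℚ q))
      ≡⟨ sum-twice (λ i → degree (g i) ℚ.* normℚ q) ⟩
    twice (∑ℚ.sum λ i → degree (g i) ℚ.* normℚ q)
      ≡⟨ cong twice (∑ℚ.*-distribʳ-sum (normℚ q) (λ i → degree (g i))) ⟨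
    twice ((∑ℚ.sum λ i → degree (g i)) ℚ.* normℚ q)
      ≡⟨ cong (λ e → twice (e ℚ.* normℚ q)) (sum-degree g) ⟩
    twice (ι (ones g) ℚ.* normℚ q) ∎
    where open ≡-Reasoning

  twice-mono : p ℚ.≤ r → twice p ℚ.≤ twice r
  twice-mono p≤r = ℚ.+-mono-≤ p≤r p≤r

  stretch-bound : ∀ {K} → ones g ≤ K → ∀ {t} → t ℚ.≤ (∑ℚ.sum λ i → deficits (g i) q) →
    t ℚ.+ twice (normℚ (rowℚ g q)) ℚ.≤ twice (ι K ℚ.* normℚ q)
  stretch-bound {K} ones≤K {t} t≤ = begin
    t ℚ.+ twice (normℚ (rowℚ g q))   ≤⟨ ℚ.+-monoˡ-≤ (twice (normℚ (rowℚ g q))) t≤ ⟩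
    _                                ≡⟨ sum-cauchySchwarz ⟩
    twice (ι (ones g) ℚ.* normℚ q)   ≤⟨ twice-mono (ℚ.*-monoʳ-≤-nonNeg (normℚ q)
                                          {{ℚ.nonNegative (norm-nonNeg q)}} (ι-mono ones≤K)) ⟩
    twice (ι K ℚ.* normℚ q)          ∎
    where open ℚ.≤-Reasoning

  deficits-sum-nonNeg : 0ℚ ℚ.≤ (∑ℚ.sum λ i → deficits (g i) q)
  deficits-sum-nonNeg = sumℚ-nonNeg λ i → deficits-nonNeg (g i) q

  stretch-bound-deficit : ∀ {K} → ones g ≤ K → ∀ i j l →
    deficit (g i j) (g i l) (q j) (q l) ℚ.+ twice (normℚ (rowℚ g q)) ℚ.≤ twice (ι K ℚ.* normℚ q)
  stretch-bound-deficit ones≤K i j l = stretch-bound ones≤K (ℚ.≤-trans (deficit≤deficits (g i) q j l)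
    (term≤sumℚ (λ i → deficits-nonNeg (g i) q) i))

  -- One edge to spare leaves a slack of 2‖q‖², which exceeds the square of any entry.
  stretch-bound-strict : ∀ {K} → ones g < K → ∀ j →
    q j ℚ.* q j ℚ.+ twice (normℚ (rowℚ g q)) ℚ.≤ twice (ι K ℚ.* normℚ q)
  stretch-bound-strict {K} ones<K j = begin
    q j ℚ.* q j ℚ.+ twice (normℚ (rowℚ g q))
      ≤⟨ ℚ.+-mono-≤ (ℚ.≤-trans (term≤sumℚ (λ j → 0≤square (q j)) j)
           (≤-by-difference (normℚ q) (norm-nonNeg q) refl))
           (ℚ.≤-trans (ℚ.≤-reflexive (sym (ℚ.+-identityˡ _))) (stretch-bound ℕ.≤-refl deficits-sum-nonNeg)) ⟩
    twice (normℚ q) ℚ.+ twice (ι (ones g) ℚ.* normℚ q)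
      ≡⟨ solve 2 (λ e N → (N :+ N) :+ (e :* N :+ e :* N) := (con 1ℚ :+ e) :* N :+ (con 1ℚ :+ e) :* N) refl
           (ι (ones g)) (normℚ q) ⟩
    twice (ι (suc (ones g)) ℚ.* normℚ q)
      ≤⟨ twice-mono (ℚ.*-monoʳ-≤-nonNeg (normℚ q) {{ℚ.nonNegative (norm-nonNeg q)}} (ι-mono ones<K)) ⟩
    twice (ι K ℚ.* normℚ q) ∎
    where open ℚ.≤-Reasoning

-- Eigenvectors in the equality case

module _ (K : ℕ) where

  -- R, I and R′, I′ are the real and imaginary parts of an eigenvector on rows and on columns.
  record Growth (g : Grid a b) (R I : Fin a → ℝ) (R′ I′ : Fin b → ℝ) : Set where
    field
      rows : constℝ (ι K) *ℝ (normℝ R +ℝ normℝ I) ≤ℝ normℝ (rowℝ g R′) +ℝ normℝ (rowℝ g I′)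
      cols : constℝ (ι K) *ℝ (normℝ R′ +ℝ normℝ I′) ≤ℝ normℝ (rowℝ (flip g) R) +ℝ normℝ (rowℝ (flip g) I)

  Growth-flip : ∀ {g : Grid a b} {R I R′ I′} → Growth g R I R′ I′ → Growth (flip g) R′ I′ R I
  Growth-flip G = record { rows = Growth.cols G ; cols = Growth.rows G }

  -- Together with `Growth-flip`, this carries every conclusion about `R′` over to `I′`, `R` and
  -- `I`.
  Growth-conj : ∀ {g : Grid a b} {R I R′ I′} → Growth g R I R′ I′ → Growth g I R I′ R′
  Growth-conj {g = g} {R} {I} {R′} {I′} G = record
    { rows = conj (normℝ R) (normℝ I) (normℝ (rowℝ g R′)) (normℝ (rowℝ g I′)) (Growth.rows G)
    ; cols = conj (normℝ R′) (normℝ I′) (normℝ (rowℝ (flip g) R)) (normℝ (rowℝ (flip g) I)) (Growth.cols G) }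
    where
    conj : ∀ x y z w → constℝ (ι K) *ℝ (x +ℝ y) ≤ℝ z +ℝ w → constℝ (ι K) *ℝ (y +ℝ x) ≤ℝ w +ℝ z
    conj x y z w le = mk≤ λ ε 0<ε → eventually₁ (below le ε 0<ε) λ n → subst₂ ℚ._≤_
      (cong (ι K ℚ.*_) (ℚ.+-comm (seq x n) (seq y n))) (cong (ℚ._+ ε) (ℚ.+-comm (seq z n) (seq w n)))

ones-flip : (g : Grid a b) → ones (flip g) ≡ ones g
ones-flip g = ∑.∑-comm λ j i → present (g i j)

-- For an eigenvector with rows w and columns w′ one has, up to δ, K‖w‖² ≤ ‖gw′‖² ≤ K‖w′‖² ≤ ‖gᵗw‖²
-- ≤ K‖w‖². The cycle closes, so no step has room for more than the two errors together. The p are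
-- the squared norms of the images of `R′`, `I′`, `R`, `I`; the k are K times the squared norms of
-- these vectors. The slack t sits in a doubled inequality, hence 4δ.
squeeze : ∀ δ t p₁ p₂ p₃ p₄ k₁ k₂ k₃ k₄ → t ℚ.+ twice p₁ ℚ.≤ twice k₁ → twice p₂ ℚ.≤ twice k₂ →
  twice p₃ ℚ.≤ twice k₃ → twice p₄ ℚ.≤ twice k₄ →
  k₃ ℚ.+ k₄ ℚ.≤ p₁ ℚ.+ p₂ ℚ.+ δ → k₁ ℚ.+ k₂ ℚ.≤ p₃ ℚ.+ p₄ ℚ.+ δ → t ℚ.≤ twice (twice δ)
squeeze δ t p₁ p₂ p₃ p₄ k₁ k₂ k₃ k₄ le₁ le₂ le₃ le₄ le₅ le₆ =
  ≤-by-difference _ (0≤+ (0≤+ (0≤difference le₁) (0≤difference le₂))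
    (0≤+ (0≤+ (0≤difference le₃) (0≤difference le₄))
         (0≤+ (0≤difference (ℚ.+-mono-≤ le₅ le₅)) (0≤difference (ℚ.+-mono-≤ le₆ le₆)))))
    (solve 10 (λ t p₁ p₂ p₃ p₄ k₁ k₂ k₃ k₄ δ →
      (δ :+ δ) :+ (δ :+ δ) := t :+ (((k₁ :+ k₁ :- (t :+ (p₁ :+ p₁))) :+ (k₂ :+ k₂ :- (p₂ :+ p₂))) :+
        (((k₃ :+ k₃ :- (p₃ :+ p₃)) :+ (k₄ :+ k₄ :- (p₄ :+ p₄))) :+
         (((p₁ :+ p₂ :+ δ) :+ (p₁ :+ p₂ :+ δ) :- ((k₃ :+ k₄) :+ (k₃ :+ k₄))) :+
          ((p₃ :+ p₄ :+ δ) :+ (p₃ :+ p₄ :+ δ) :- ((k₁ :+ k₂) :+ (k₁ :+ k₂)))))))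
      refl t p₁ p₂ p₃ p₄ k₁ k₂ k₃ k₄ δ)

∣-∣≤-from-square : 0ℚ ℚ.< ε → p ℚ.* p ℚ.≤ ε ℚ.* ε → ℚ.∣ p ∣ ℚ.≤ ε
∣-∣≤-from-square {ε} {p} 0<ε p²≤ε² with ℚ.∣ p ∣ ℚ.≤? ε
... | yes ∣p∣≤ε = ∣p∣≤ε
... | no ∣p∣≰ε = contradiction (ℚ.≤-<-trans p²≤ε² (begin-strict
  ε ℚ.* ε              <⟨ ℚ.*-monoʳ-<-pos ε {{ℚ.positive 0<ε}} ε<∣p∣ ⟩
  ε ℚ.* ℚ.∣ p ∣        ≤⟨ ℚ.*-monoʳ-≤-nonNeg ℚ.∣ p ∣ {{ℚ.∣-∣-nonNeg p}} (ℚ.<⇒≤ ε<∣p∣) ⟩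
  ℚ.∣ p ∣ ℚ.* ℚ.∣ p ∣  ≡⟨ ℚ.∣p*q∣≡∣p∣*∣q∣ p p ⟨
  ℚ.∣ p ℚ.* p ∣        ≡⟨ ℚ.0≤p⇒∣p∣≡p (0≤square p) ⟩
  p ℚ.* p              ∎)) (ℚ.<-irrefl refl)
  where
  open ℚ.≤-Reasoning
  ε<∣p∣ = ℚ.≰⇒> ∣p∣≰ε

module _ {K} {g : Grid a b} {R I R′ I′} (G : Growth K g R I R′ I′) (ones≤K : ones g ≤ K) where

  private
    at : ℕ → Fin b → ℚ
    at n j = seq (R′ j) n

    bound : ∀ {a b} (h : Grid a b) (q : Fin b → ℚ) → ones h ≤ K →
      twice (normℚ (rowℚ h q)) ℚ.≤ twice (ι K ℚ.* normℚ q)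
    bound h q ones≤K = ℚ.≤-trans (ℚ.≤-reflexive (sym (ℚ.+-identityˡ (twice (normℚ (rowℚ h q))))))
      (stretch-bound h q ones≤K (deficits-sum-nonNeg h q))

    unfold : ∀ {a b c} (h : Grid a b) (S T : Fin c → ℝ) (S′ T′ : Fin b → ℝ) n {δ} →
      seq (constℝ (ι K) *ℝ (normℝ S +ℝ normℝ T)) n ℚ.≤ seq (normℝ (rowℝ h S′) +ℝ normℝ (rowℝ h T′)) n ℚ.+ δ →
      ι K ℚ.* normℚ (λ j → seq (S j) n) ℚ.+ ι K ℚ.* normℚ (λ j → seq (T j) n) ℚ.≤
      normℚ (rowℚ h λ j → seq (S′ j) n) ℚ.+ normℚ (rowℚ h λ j → seq (T′ j) n) ℚ.+ δ
    unfold h S T S′ T′ n {δ} = subst₂ ℚ._≤_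
      (trans (cong (ι K ℚ.*_) (cong₂ ℚ._+_ (seq-normℝ S n) (seq-normℝ T n)))
        (ℚ.*-distribˡ-+ (ι K) (normℚ λ j → seq (S j) n) (normℚ λ j → seq (T j) n)))
      (cong (ℚ._+ δ) (cong₂ ℚ._+_ (seq-norm-rowℝ h S′ n) (seq-norm-rowℝ h T′ n)))

    vanish : (t : ℕ → ℚ) →
      (∀ n → t n ℚ.+ twice (normℚ (rowℚ g (at n))) ℚ.≤ twice (ι K ℚ.* normℚ (at n))) →
      ∀ ε → 0ℚ ℚ.< ε → Eventually λ n → t n ℚ.≤ ε
    vanish t t≤ ε 0<ε = eventually₂ (below (Growth.rows G) η 0<η) (below (Growth.cols G) η 0<η) λ n p q →
      subst (t n ℚ.≤_) (trans (cong twice (½ε+½ε (½ ℚ.* ε))) (½ε+½ε ε))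
        (squeeze η (t n) (normℚ (rowℚ g (at n))) (normℚ (rowℚ g λ j → seq (I′ j) n))
          (normℚ (rowℚ (flip g) λ i → seq (R i) n)) (normℚ (rowℚ (flip g) λ i → seq (I i) n))
          (ι K ℚ.* normℚ (at n)) (ι K ℚ.* normℚ λ j → seq (I′ j) n)
          (ι K ℚ.* normℚ λ i → seq (R i) n) (ι K ℚ.* normℚ λ i → seq (I i) n)
          (t≤ n) (bound g (λ j → seq (I′ j) n) ones≤K)
          (bound (flip g) (λ i → seq (R i) n) ones-flip≤K) (bound (flip g) (λ i → seq (I i) n) ones-flip≤K)
          (unfold g R I R′ I′ n p) (unfold (flip g) R′ I′ R I n q))
      where
      -- A quarter of ε, against the factor four in `squeeze`.
      η = ½ ℚ.* (½ ℚ.* ε)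
      0<η : 0ℚ ℚ.< η
      0<η = 0<½ε (0<½ε 0<ε)
      ones-flip≤K : ones (flip g) ≤ K
      ones-flip≤K = subst (_≤ K) (sym (ones-flip g)) ones≤K

    ≈-from-squares : ∀ x y → (∀ n → (seq x n ℚ.- seq y n) ℚ.* (seq x n ℚ.- seq y n) ℚ.+
      twice (normℚ (rowℚ g (at n))) ℚ.≤ twice (ι K ℚ.* normℚ (at n))) → x ≈ℝ y
    ≈-from-squares x y le = mk≈ λ ε 0<ε →
      eventually₁ (vanish (λ n → (seq x n ℚ.- seq y n) ℚ.* (seq x n ℚ.- seq y n)) le (ε ℚ.* ε)
        (subst (ℚ._< ε ℚ.* ε) (ℚ.*-zeroʳ ε) (ℚ.*-monoʳ-<-pos ε {{ℚ.positive 0<ε}} 0<ε)))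
      λ n → ∣-∣≤-from-square 0<ε

    minus0 : ∀ x → (x ℚ.- 0ℚ) ℚ.* (x ℚ.- 0ℚ) ≡ x ℚ.* x
    minus0 x = cong (λ y → y ℚ.* y) (ℚ.+-identityʳ x)

  -- The deficit at two columns joined to one row is the square of the difference of their entries,
  -- and it tends to 0.
  column-equal : ∀ {i j l} → g i j ≡ true → g i l ≡ true → R′ j ≈ℝ R′ l
  column-equal {i} {j} {l} gij gil = ≈-from-squares (R′ j) (R′ l) λ n → subst
    (λ d → d ℚ.+ twice (normℚ (rowℚ g (at n))) ℚ.≤ twice (ι K ℚ.* normℚ (at n)))
    (cong₂ (λ s t → deficit s t (at n j) (at n l)) gij gil) (stretch-bound-deficit g (at n) ones≤K i j l)

  -- If the row is joined to just one of the two columns, the deficit is the square of the entry at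
  -- the other.
  column-zero : ∀ {i j l} → g i j ≡ false → g i l ≡ true → R′ j ≈ℝ 0ℝ
  column-zero {i} {j} {l} gij gil = ≈-from-squares (R′ j) 0ℝ λ n → subst
    (λ d → d ℚ.+ twice (normℚ (rowℚ g (at n))) ℚ.≤ twice (ι K ℚ.* normℚ (at n)))
    (trans (cong₂ (λ s t → deficit s t (at n j) (at n l)) gij gil) (sym (minus0 (at n j))))
    (stretch-bound-deficit g (at n) ones≤K i j l)

  column-strict : ones g < K → ∀ j → R′ j ≈ℝ 0ℝ
  column-strict ones<K j = ≈-from-squares (R′ j) 0ℝ λ n → subst
    (λ d → d ℚ.+ twice (normℚ (rowℚ g (at n))) ℚ.≤ twice (ι K ℚ.* normℚ (at n)))
    (sym (minus0 (at n j))) (stretch-bound-strict g (at n) ones<K j)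

  -- Row `i′` forces the entry at `j` to vanish. Row `i`, which contains `j`, then makes the columns
  -- it contains equal to that entry and the others zero.
  columns-vanish : ∀ {i i′ j l} → g i j ≡ true → g i′ j ≡ false → g i′ l ≡ true → ∀ j₀ → R′ j₀ ≈ℝ 0ℝ
  columns-vanish {i} gij gi′j gi′l j₀ with g i j₀ in gij₀
  ... | true  = ≈-trans (column-equal gij₀ gij) (column-zero gi′j gi′l)
  ... | false = column-zero gij₀ gij

  -- Dually, column `j` makes the entry at `i′` vanish and column `l`, which contains `i′`, spreads
  -- this to all rows. The last two hypotheses come from the transposed grid.
  rows-vanish : ∀ {i i′ j l} → g i j ≡ true → g i′ j ≡ false → g i′ l ≡ true →
    (∀ {j i i′} → g i j ≡ true → g i′ j ≡ true → R i ≈ℝ R i′) →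
    (∀ {j i i′} → g i j ≡ false → g i′ j ≡ true → R i ≈ℝ 0ℝ) → ∀ i₀ → R i₀ ≈ℝ 0ℝ
  rows-vanish {l = l} gij gi′j gi′l row-equal row-zero i₀ with g i₀ l in gi₀l
  ... | true  = ≈-trans (row-equal gi₀l gi′l) (row-zero gi′j gij)
  ... | false = row-zero gi₀l gi′l

-- Counting edges: few missing pairs or a star

sum-const : ∀ a c → ∑.sum {a} (λ _ → c) ≡ a * c
sum-const zero    c = refl
sum-const (suc a) c = cong (c +_) (sum-const a c)

term≤sum : (f : Fin a → ℕ) (i : Fin a) → f i ≤ ∑.sum f
term≤sum f zero    = ℕ.m≤m+n (f zero) _
term≤sum f (suc i) = ℕ.≤-trans (term≤sum (f ∘ suc) i) (ℕ.m≤n+m _ (f zero))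

ones+miss : (g : Grid a b) → ones g + miss g ≡ b * a
ones+miss {a} {b} g = begin
  ones g + miss g
    ≡⟨ cong (_+ miss g) (∑.∑-comm λ i j → present (g i j)) ⟩
  (∑.sum λ j → ∑.sum λ i → present (g i j)) + miss g
    ≡⟨ ∑.∑-distrib-+ (λ j → ∑.sum λ i → present (g i j)) (λ j → ∑.sum λ i → absent (g i j)) ⟨
  (∑.sum λ j → (∑.sum λ i → present (g i j)) + (∑.sum λ i → absent (g i j)))
    ≡⟨ ∑.sum-cong-≗ (λ j → trans (sym (∑.∑-distrib-+ (λ i → present (g i j)) (λ i → absent (g i j))))
         (trans (∑.sum-cong-≗ λ i → present+absent (g i j)) (trans (sum-const a 1) (ℕ.*-identityʳ a)))) ⟩
  ∑.sum {b} (λ _ → a)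
    ≡⟨ sum-const b a ⟩
  b * a ∎
  where
  open ≡-Reasoning
  present+absent : ∀ s → present s + absent s ≡ 1
  present+absent true  = refl
  present+absent false = refl

module _ {m} (0<m : 0 < m) (g : Grid (suc m) m) where

  -- The empty row already accounts for one missing pair in each of the m columns, which leaves none
  -- for the other rows.
  emptyRow-star : miss g ≡ m → ∀ {x} → (∀ y → g x y ≡ false) → IsStar g x
  emptyRow-star miss≡m {x} empty = empty , others
    where
    column : Fin m → ℕ
    column y = ∑.sum λ x → absent (g x y)
    1≤column : ∀ y → 1 ≤ column y
    1≤column y = subst (λ s → absent s ≤ column y) (empty y) (term≤sum (λ x → absent (g x y)) x)
    others : ∀ x′ y → x′ ≢ x → g x′ y ≡ true
    others x′ y x′≢x with g x′ y in gx′y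
    ... | true = refl
    ... | false = contradiction miss≡m (ℕ.>⇒≢ (subst (_< miss g) (trans (sum-const m 1) (ℕ.*-identityʳ m))
                    (sum-mono-< 1≤column y 1<column)))
      where
      f : Fin (suc m) → ℕ
      f x = absent (g x y)
      x≢x′ : x ≢ x′
      x≢x′ = x′≢x ∘ sym
      1<column : 1 < column y
      1<column = begin
        1 + 1                               ≡⟨ cong₂ (λ s t → absent s + absent t) (empty y) gx′y ⟨
        f x + f x′                          ≡⟨ cong (λ z → f x + f z) (Fin.punchIn-punchOut x≢x′) ⟨
        f x + removeAt f x (Fin.punchOut x≢x′)  ≤⟨ ℕ.+-monoʳ-≤ (f x) (term≤sum (removeAt f x) (Fin.punchOut x≢x′)) ⟩
        f x + ∑.sum (removeAt f x)          ≡⟨ ∑.sum-remove f ⟨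
        column y                            ∎
        where open ℕ.≤-Reasoning

  -- When all rows are equal, one missing pair costs a whole column of m + 1 pairs, so the number
  -- missing is 0 or exceeds m.
  equalRows-absurd : miss g ≡ m → (∀ {x x′ y} → g x y ≡ true → g x′ y ≡ false → ⊥) → ⊥
  equalRows-absurd miss≡m equal with Fin.any? (λ y → g zero y Bool.≟ false)
  ... | yes (y , g0y) = ℕ.1+n≰n (subst (suc m ≤_) miss≡m (ℕ.≤-trans
        (sum-upset (λ x → absent (g x y)) zero λ x _ → 1≤absent x) (term≤sum (λ y → ∑.sum λ x → absent (g x y)) y)))
    where
    1≤absent : ∀ x → 1 ≤ absent (g x y)
    1≤absent x with g x y in gxy
    ... | true  = contradiction g0y (equal gxy)
    ... | false = ℕ.≤-refl
  ... | no none = ℕ.<⇒≢ 0<m (trans (sym miss≡0) miss≡m)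
    where
    absent≡0 : ∀ x y → absent (g x y) ≡ 0
    absent≡0 x y with g zero y in g0y | g x y in gxy
    ... | _     | true  = refl
    ... | true  | false = ⊥-elim (equal g0y gxy)
    ... | false | false = contradiction (y , g0y) none
    miss≡0 : miss g ≡ 0
    miss≡0 = trans (∑.sum-cong-≗ λ y → trans (∑.sum-cong-≗ λ x → absent≡0 x y) (∑.sum-replicate-zero (suc m)))
      (∑.sum-replicate-zero m)

  -- Of m² + m pairs, missing at least m leaves at most m² edges. Fewer than m² would annihilate the
  -- eigenvector. With exactly m², two distinct nonempty rows would do the same, so some row is
  -- empty or all rows are equal.
  Growth-Good : ∀ {R I R′ I′} → Growth (m * m) g R I R′ I′ →
    ¬ (((∀ i → R i ≈ℝ 0ℝ) × (∀ i → I i ≈ℝ 0ℝ)) × (∀ j → R′ j ≈ℝ 0ℝ) × (∀ j → I′ j ≈ℝ 0ℝ)) → Good g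
  Growth-Good {R} {I} {R′} {I′} G nonzero with miss g ℕ.<? m
  ... | yes miss<m = inj₁ miss<m
  ... | no miss≮m = inj₂ star
    where
    m≤miss : m ≤ miss g
    m≤miss = ℕ.≮⇒≥ miss≮m
    total≡ : ones g + miss g ≡ m * m + m
    total≡ = trans (ones+miss g) (trans (ℕ.*-suc m m) (ℕ.+-comm m (m * m)))
    ones≤ : ones g ≤ m * m
    ones≤ = ℕ.+-cancelʳ-≤ m (ones g) (m * m) (subst (ones g + m ≤_) total≡ (ℕ.+-monoʳ-≤ (ones g) m≤miss))
    ones-flip≤ : ones (flip g) ≤ m * m
    ones-flip≤ = subst (_≤ m * m) (sym (ones-flip g)) ones≤
    Gᶜ = Growth-conj (m * m) G
    Gᵗ = Growth-flip (m * m) G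
    Gᵗᶜ = Growth-conj (m * m) Gᵗ
    ones≮ : ¬ (ones g < m * m)
    ones≮ ones< = nonzero
      ( (column-strict Gᵗ ones-flip≤ ones-flip< , column-strict Gᵗᶜ ones-flip≤ ones-flip<)
      , column-strict G ones≤ ones< , column-strict Gᶜ ones≤ ones<)
      where
      ones-flip< : ones (flip g) < m * m
      ones-flip< = subst (_< m * m) (sym (ones-flip g)) ones<
    miss≡m : miss g ≡ m
    miss≡m = ℕ.+-cancelˡ-≡ (m * m) (miss g) m
      (subst (λ e → e + miss g ≡ m * m + m) (ℕ.≤-antisym ones≤ (ℕ.≮⇒≥ ones≮)) total≡)
    star : ∃[ x ] IsStar g x
    star with Fin.any? (λ x → Fin.all? λ y → g x y Bool.≟ false)
    ... | yes (x , empty) = x , emptyRow-star miss≡m empty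
    ... | no none = ⊥-elim (equalRows-absurd miss≡m equal)
      where
      nonempty : ∀ x → ∃[ y ] g x y ≡ true
      nonempty x with Fin.any? (λ y → g x y Bool.≟ true)
      ... | yes found = found
      ... | no ¬found = contradiction (x , λ y → Bool.¬-not λ gxy → ¬found (y , gxy)) none
      equal : ∀ {x x′ y} → g x y ≡ true → g x′ y ≡ false → ⊥
      equal {x} {x′} gxy gx′y = let l , gx′l = nonempty x′ in nonzero
        ( ( rows-vanish G ones≤ gxy gx′y gx′l (column-equal Gᵗ ones-flip≤) (column-zero Gᵗ ones-flip≤)
          , rows-vanish Gᶜ ones≤ gxy gx′y gx′l (column-equal Gᵗᶜ ones-flip≤) (column-zero Gᵗᶜ ones-flip≤))
        , columns-vanish G ones≤ gxy gx′y gx′l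
        , columns-vanish Gᶜ ones≤ gxy gx′y gx′l)

-- The eigenvalue m of K_{m,m} ∪ K_1

sum-splitAt : ∀ a {b} (F : Fin (a + b) → ℚ) →
  ∑ℚ.sum F ≡ (∑ℚ.sum λ i → F (i Fin.↑ˡ b)) ℚ.+ (∑ℚ.sum λ j → F (a Fin.↑ʳ j))
sum-splitAt zero    F = sym (ℚ.+-identityˡ (∑ℚ.sum F))
sum-splitAt (suc a) F = trans (cong (F zero ℚ.+_) (sum-splitAt a (F ∘ suc))) (sym (ℚ.+-assoc (F zero) _ _))

0or1 : Bool → ℂ
0or1 b = if b then 1ℂ else 0ℂ

re-0or1 : ∀ b w n → seq (re (0or1 b *ℂ w)) n ≡ χ b ℚ.* seq (re w) n
re-0or1 true w n = solve 2 (λ x y → con 1ℚ :* x :+ (:- (con 0ℚ :* y)) := con 1ℚ :* x) refl (seq (re w) n) (seq (im w) n)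
re-0or1 false w n = solve 2 (λ x y → con 0ℚ :* x :+ (:- (con 0ℚ :* y)) := con 0ℚ :* x) refl (seq (re w) n) (seq (im w) n)

im-0or1 : ∀ b w n → seq (im (0or1 b *ℂ w)) n ≡ χ b ℚ.* seq (im w) n
im-0or1 true w n = solve 2 (λ x y → con 1ℚ :* y :+ con 0ℚ :* x := con 1ℚ :* y) refl (seq (re w) n) (seq (im w) n)
im-0or1 false w n = solve 2 (λ x y → con 0ℚ :* y :+ con 0ℚ :* x := con 0ℚ :* y) refl (seq (re w) n) (seq (im w) n)

module _ (m : ℕ) (0<m : 0 < m) where

  private
    H = K[ m , m ] ⊍ K 1
    Part = (Fin m ⊎ Fin m) ⊎ Fin 1
    part : Fin (m + m + 1) → Part
    part i = map₁ (Fin.splitAt m) (Fin.splitAt (m + m) i)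
    joined : Part → Part → Bool
    joined (inj₁ (inj₁ _)) (inj₁ (inj₂ _)) = true
    joined (inj₁ (inj₂ _)) (inj₁ (inj₁ _)) = true
    joined _ _ = false
    support : Part → Bool
    support (inj₁ _) = true
    support (inj₂ _) = false
    v : Fin (m + m + 1) → ℂ
    v i = 0or1 (support (part i))
    adj-joined : ∀ i j → adj H i j ≡ joined (part i) (part j)
    adj-joined i j with Fin.splitAt (m + m) i | Fin.splitAt (m + m) j
    ... | inj₂ _ | inj₁ _ = refl
    ... | inj₂ zero | inj₂ zero = refl
    ... | inj₁ i′ | inj₂ _ with Fin.splitAt m i′
    ...   | inj₁ _ = refl
    ...   | inj₂ _ = refl
    adj-joined i j | inj₁ i′ | inj₁ j′ with Fin.splitAt m i′ | Fin.splitAt m j′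
    ... | inj₁ _ | inj₁ _ = refl
    ... | inj₁ _ | inj₂ _ = refl
    ... | inj₂ _ | inj₁ _ = refl
    ... | inj₂ _ | inj₂ _ = refl
    sum-part : (F : Part → ℚ) → (∑ℚ.sum λ j → F (part j)) ≡
      (∑ℚ.sum λ x → F (inj₁ (inj₁ x))) ℚ.+ (∑ℚ.sum λ y → F (inj₁ (inj₂ y))) ℚ.+ (∑ℚ.sum λ z → F (inj₂ z))
    sum-part F = trans (sum-splitAt (m + m) (F ∘ part)) (cong₂ ℚ._+_
      (trans (sum-splitAt m (λ i → F (part (i Fin.↑ˡ 1)))) (cong₂ ℚ._+_
        (∑ℚ.sum-cong-≗ λ x → cong F (trans (cong (map₁ (Fin.splitAt m)) (Fin.splitAt-↑ˡ (m + m) (x Fin.↑ˡ m) 1))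
          (cong inj₁ (Fin.splitAt-↑ˡ m x m))))
        (∑ℚ.sum-cong-≗ λ y → cong F (trans (cong (map₁ (Fin.splitAt m)) (Fin.splitAt-↑ˡ (m + m) (m Fin.↑ʳ y) 1))
          (cong inj₁ (Fin.splitAt-↑ʳ m m y))))))
      (∑ℚ.sum-cong-≗ λ z → cong (F ∘ map₁ (Fin.splitAt m)) (Fin.splitAt-↑ʳ (m + m) 1 z)))
    sum-1 : ∑ℚ.sum {m} (λ _ → 1ℚ) ≡ ι m
    sum-1 = ∑ℚ.sum-replicate m
    sum-0 : ∑ℚ.sum {m} (λ _ → 0ℚ) ≡ 0ℚ
    sum-0 = ∑ℚ.sum-replicate-zero m
    row-sum : ∀ p → (∑ℚ.sum λ j → χ (joined p (part j)) ℚ.* χ (support (part j))) ≡ ι m ℚ.* χ (support p)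
    row-sum p@(inj₁ (inj₁ _)) = trans (sum-part λ q → χ (joined p q) ℚ.* χ (support q))
      (trans (cong₂ (λ s t → s ℚ.+ t ℚ.+ 0ℚ) sum-0 sum-1)
        (solve 1 (λ i → con 0ℚ :+ i :+ con 0ℚ := i :* con 1ℚ) refl (ι m)))
    row-sum p@(inj₁ (inj₂ _)) = trans (sum-part λ q → χ (joined p q) ℚ.* χ (support q))
      (trans (cong₂ (λ s t → s ℚ.+ t ℚ.+ 0ℚ) sum-1 sum-0)
        (solve 1 (λ i → i :+ con 0ℚ :+ con 0ℚ := i :* con 1ℚ) refl (ι m)))
    row-sum p@(inj₂ _) = trans (sum-part λ q → χ (joined p q) ℚ.* χ (support q))
      (trans (cong₂ (λ s t → s ℚ.+ t ℚ.+ 0ℚ) sum-0 sum-0) (sym (ℚ.*-zeroʳ (ι m))))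
    re-v : ∀ b n → seq (re (0or1 b)) n ≡ χ b
    re-v true  n = refl
    re-v false n = refl
    im-v : ∀ b n → seq (im (0or1 b)) n ≡ 0ℚ
    im-v true  n = refl
    im-v false n = refl
    re-eq : ∀ i n → seq (re (sumℂ λ j → adjacencyMatrix H i j *ℂ v j)) n ≡
      seq (re ((constℝ (ι m) +i 0ℝ) *ℂ v i)) n
    re-eq i n = begin
      seq (re (sumℂ λ j → adjacencyMatrix H i j *ℂ v j)) n
        ≡⟨ re-sumℂ (λ j → adjacencyMatrix H i j *ℂ v j) n ⟩
      (∑ℚ.sum λ j → seq (re (0or1 (adj H i j) *ℂ v j)) n)
        ≡⟨ ∑ℚ.sum-cong-≗ (λ j → trans (re-0or1 (adj H i j) (v j) n)
             (cong₂ ℚ._*_ (cong χ (adj-joined i j)) (re-v (support (part j)) n))) ⟩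
      (∑ℚ.sum λ j → χ (joined (part i) (part j)) ℚ.* χ (support (part j)))
        ≡⟨ row-sum (part i) ⟩
      ι m ℚ.* χ (support (part i))
        ≡⟨ solve 2 (λ i s → i :* s := i :* s :+ (:- (con 0ℚ :* con 0ℚ))) refl (ι m) (χ (support (part i))) ⟩
      ι m ℚ.* χ (support (part i)) ℚ.- 0ℚ ℚ.* 0ℚ
        ≡⟨ cong₂ (λ s t → ι m ℚ.* s ℚ.- 0ℚ ℚ.* t) (re-v (support (part i)) n) (im-v (support (part i)) n) ⟨
      seq (re ((constℝ (ι m) +i 0ℝ) *ℂ v i)) n ∎
      where open ≡-Reasoning
    im-eq : ∀ i n → seq (im (sumℂ λ j → adjacencyMatrix H i j *ℂ v j)) n ≡
      seq (im ((constℝ (ι m) +i 0ℝ) *ℂ v i)) n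
    im-eq i n = begin
      seq (im (sumℂ λ j → adjacencyMatrix H i j *ℂ v j)) n
        ≡⟨ im-sumℂ (λ j → adjacencyMatrix H i j *ℂ v j) n ⟩
      (∑ℚ.sum λ j → seq (im (0or1 (adj H i j) *ℂ v j)) n)
        ≡⟨ ∑ℚ.sum-cong-≗ (λ j → trans (im-0or1 (adj H i j) (v j) n)
             (trans (cong (χ (adj H i j) ℚ.*_) (im-v (support (part j)) n)) (ℚ.*-zeroʳ (χ (adj H i j))))) ⟩
      ∑ℚ.sum {m + m + 1} (λ _ → 0ℚ)
        ≡⟨ ∑ℚ.sum-replicate-zero (m + m + 1) ⟩
      0ℚ
        ≡⟨ solve 2 (λ i s → con 0ℚ := i :* con 0ℚ :+ con 0ℚ :* s) refl (ι m) (seq (re (v i)) n) ⟩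
      ι m ℚ.* 0ℚ ℚ.+ 0ℚ ℚ.* seq (re (v i)) n
        ≡⟨ cong (λ t → ι m ℚ.* t ℚ.+ 0ℚ ℚ.* seq (re (v i)) n) (im-v (support (part i)) n) ⟨
      seq (im ((constℝ (ι m) +i 0ℝ) *ℂ v i)) n ∎
      where open ≡-Reasoning
    v≉0 : ¬ (∀ i → v i ≈ℂ 0ℂ)
    v≉0 v≈0 = contradiction (close 1≈0 ½ (ℚ.positive⁻¹ ½)) λ { (N , ≤½) → 1≰½ (≤½ N ℕ.≤-refl) }
      where
      i₀ : Fin (m + m + 1)
      i₀ = (Fin.fromℕ< 0<m Fin.↑ˡ m) Fin.↑ˡ 1
      1≈0 : 1ℝ ≈ℝ 0ℝ
      1≈0 = subst (λ p → re (0or1 (support p)) ≈ℝ 0ℝ)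
        (cong (map₁ (Fin.splitAt m)) (Fin.splitAt-↑ˡ (m + m) (Fin.fromℕ< 0<m Fin.↑ˡ m) 1))
        (re-≈ (v≈0 i₀))
      1≰½ : ¬ (1ℚ ℚ.≤ ½)
      1≰½ 1≤½ = ℚ.<-irrefl refl (ℚ.<-≤-trans (ℚ.*<* (ℤ.+<+ (s≤s (s≤s z≤n)))) 1≤½)

  -- The indicator `v` of the 2m non-isolated vertices is an eigenvector for m, because each of them
  -- has m neighbours.
  K∪K₁-spectralRadius : ∀ {s} → IsSpectralRadius H s → constℝ (ι m) ≤ℝ s
  K∪K₁-spectralRadius ρ = MaxModulusOfEigenvalues.maximal ρ (constℝ (ι m) +i 0ℝ) (constℝ (ι m))
    (v , v≉0 , λ i → mk≈ℂ (≗⇒≈ (re-eq i)) (≗⇒≈ (im-eq i)))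
    (≤ℝ-pointwise (λ _ → ι-nonNeg m) , ≗⇒≈ λ _ → sym (ℚ.+-identityʳ (ι m ℚ.* ι m)))

-- From the spectral hypothesis to grids

module _ {N m} {X Y : Subset N} (0<m : 0 < m) (bip : IsBipartition X Y) (coords : Coordinates m X Y)
  (G : Graph N) (G-bip : IsBipartite G X Y) where

  open Coordinates coords

  private
    g = biadjacency bip coords G

    sum-coordinates : (F : Fin N → ℚ) →
      ∑ℚ.sum F ≡ (∑ℚ.sum λ x → F (from (inj₁ x))) ℚ.+ (∑ℚ.sum λ y → F (from (inj₂ y)))
    sum-coordinates F = trans (∑ℚ.sum-permute F π) (trans (sum-splitAt (suc m) (λ i → F (from (Fin.splitAt (suc m) i))))
      (cong₂ ℚ._+_ (∑ℚ.sum-cong-≗ λ x → cong (F ∘ from) (Fin.splitAt-↑ˡ (suc m) x m))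
                   (∑ℚ.sum-cong-≗ λ y → cong (F ∘ from) (Fin.splitAt-↑ʳ (suc m) m y))))
      where
      π : Perm.Permutation (suc m + m) N
      π = Perm.permutation (from ∘ Fin.splitAt (suc m)) (Fin.join (suc m) m ∘ to)
        (λ v → trans (cong from (Fin.splitAt-join (suc m) m (to v))) (from-to v))
        (λ i → trans (cong (Fin.join (suc m) m) (to-from (Fin.splitAt (suc m) i))) (Fin.join-splitAt (suc m) m i))

    adj-row : ∀ (w : Fin N → ℚ) x → (∑ℚ.sum λ j → χ (adj G (from (inj₁ x)) j) ℚ.* w j) ≡
      rowℚ g (λ y → w (from (inj₂ y))) x
    adj-row w x = trans (sum-coordinates λ j → χ (adj G (from (inj₁ x)) j) ℚ.* w j)
      (trans (cong (ℚ._+ rowℚ g (λ y → w (from (inj₂ y))) x)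
        (trans (∑ℚ.sum-cong-≗ λ x′ → trans (cong (λ b → χ b ℚ.* w (from (inj₁ x′)))
            (adj-from bip coords G G-bip (inj₁ x) (inj₁ x′))) (ℚ.*-zeroˡ (w (from (inj₁ x′)))))
          (∑ℚ.sum-replicate-zero (suc m))))
        (ℚ.+-identityˡ (rowℚ g (λ y → w (from (inj₂ y))) x)))

    adj-col : ∀ (w : Fin N → ℚ) y → (∑ℚ.sum λ j → χ (adj G (from (inj₂ y)) j) ℚ.* w j) ≡
      rowℚ (flip g) (λ x → w (from (inj₁ x))) y
    adj-col w y = trans (sum-coordinates λ j → χ (adj G (from (inj₂ y)) j) ℚ.* w j)
      (trans (cong₂ ℚ._+_
        (∑ℚ.sum-cong-≗ λ x → cong (λ b → χ b ℚ.* w (from (inj₁ x))) (adj-from bip coords G G-bip (inj₂ y) (inj₁ x)))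
        (trans (∑ℚ.sum-cong-≗ λ y′ → trans (cong (λ b → χ b ℚ.* w (from (inj₂ y′)))
            (adj-from bip coords G G-bip (inj₂ y) (inj₂ y′))) (ℚ.*-zeroˡ (w (from (inj₂ y′)))))
          (∑ℚ.sum-replicate-zero m)))
        (ℚ.+-identityʳ (rowℚ (flip g) (λ x → w (from (inj₁ x))) y)))

  -- An eigenvalue attaining the spectral radius has modulus at least m. Bipartiteness splits its
  -- eigenvector equation into one for rows and one for columns, and both stretch by m² in squared
  -- norm.
  ρ≥ρ-Good : G ρ≥ρ (K[ m , m ] ⊍ K 1) → Good g
  ρ≥ρ-Good (r , s , ρG , ρH , s≤r) = fromEigenvector (MaxModulusOfEigenvalues.attained ρG)
    where
    fromEigenvector : ∃[ z ] IsEigenvalue (adjacencyMatrix G) z × IsModulus z r → Good g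
    fromEigenvector (z , (v , v≉0 , eigen) , 0≤r , r²≈) = Growth-Good 0<m g growth nonzero
      where
      R I : Fin (suc m) → ℝ
      R x = re (v (from (inj₁ x)))
      I x = im (v (from (inj₁ x)))
      R′ I′ : Fin m → ℝ
      R′ y = re (v (from (inj₂ y)))
      I′ y = im (v (from (inj₂ y)))
      re-matrix : ∀ i n → seq (re (sumℂ λ j → adjacencyMatrix G i j *ℂ v j)) n ≡
        ∑ℚ.sum λ j → χ (adj G i j) ℚ.* seq (re (v j)) n
      re-matrix i n = trans (re-sumℂ (λ j → adjacencyMatrix G i j *ℂ v j) n)
        (∑ℚ.sum-cong-≗ λ j → re-0or1 (adj G i j) (v j) n)
      im-matrix : ∀ i n → seq (im (sumℂ λ j → adjacencyMatrix G i j *ℂ v j)) n ≡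
        ∑ℚ.sum λ j → χ (adj G i j) ℚ.* seq (im (v j)) n
      im-matrix i n = trans (im-sumℂ (λ j → adjacencyMatrix G i j *ℂ v j) n)
        (∑ℚ.sum-cong-≗ λ j → im-0or1 (adj G i j) (v j) n)
      row : ∀ {a b} (h : Grid a b) (w : Fin b → ℝ) i {x y : ℝ} → x ≈ℝ y →
        (∀ n → seq x n ≡ rowℚ h (λ j → seq (w j) n) i) → rowℝ h w i ≈ℝ y
      row h w i {x} x≈y x≗ = ≈-trans {y = x} (≗⇒≈ λ n →
        trans (seq-sumℝ (λ j → constℝ (χ (h i j)) *ℝ w j) n) (sym (x≗ n))) x≈y
      c≤r : constℝ (ι m) ≤ℝ r
      c≤r = ≤ℝ-trans (K∪K₁-spectralRadius m 0<m ρH) s≤r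
      m²≡ : ι m ℚ.* ι m ≡ ι (m * m)
      m²≡ = sym (Mult.×1-homo-* m m)
      growth : Growth (m * m) g R I R′ I′
      growth = record
        { rows = subst (λ c → constℝ c *ℝ (normℝ R +ℝ normℝ I) ≤ℝ normℝ (rowℝ g R′) +ℝ normℝ (rowℝ g I′)) m²≡
            (eigen-growth g R I R′ I′ {re z} {im z} {r}
              (λ x → row g R′ x (re-≈ (eigen (from (inj₁ x)))) λ n →
                trans (re-matrix (from (inj₁ x)) n) (adj-row (λ j → seq (re (v j)) n) x))
              (λ x → row g I′ x (im-≈ (eigen (from (inj₁ x)))) λ n →
                trans (im-matrix (from (inj₁ x)) n) (adj-row (λ j → seq (im (v j)) n) x))
              r²≈ 0≤r (ι-nonNeg m) c≤r)
        ; cols = subst (λ c → constℝ c *ℝ (normℝ R′ +ℝ normℝ I′) ≤ℝ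
                              normℝ (rowℝ (flip g) R) +ℝ normℝ (rowℝ (flip g) I)) m²≡
            (eigen-growth (flip g) R′ I′ R I {re z} {im z} {r}
              (λ y → row (flip g) R y (re-≈ (eigen (from (inj₂ y)))) λ n →
                trans (re-matrix (from (inj₂ y)) n) (adj-col (λ j → seq (re (v j)) n) y))
              (λ y → row (flip g) I y (im-≈ (eigen (from (inj₂ y)))) λ n →
                trans (im-matrix (from (inj₂ y)) n) (adj-col (λ j → seq (im (v j)) n) y))
              r²≈ 0≤r (ι-nonNeg m) c≤r)
        }
      nonzero : ¬ (((∀ i → R i ≈ℝ 0ℝ) × (∀ i → I i ≈ℝ 0ℝ)) × (∀ j → R′ j ≈ℝ 0ℝ) × (∀ j → I′ j ≈ℝ 0ℝ))
      nonzero ((R≈0 , I≈0) , R′≈0 , I′≈0) = v≉0 λ i → subst (λ i → v i ≈ℂ 0ℂ) (from-to i) (zeroAt (to i))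
        where
        zeroAt : ∀ p → v (from p) ≈ℂ 0ℂ
        zeroAt (inj₁ x) = mk≈ℂ (R≈0 x) (I≈0 x)
        zeroAt (inj₂ y) = mk≈ℂ (R′≈0 y) (I′≈0 y)

-- The number of vertices is a variable `N` because `2 * n ∸ 1` does not reduce to the successor of
-- `2 * n ∸ 2`; matching on the equation identifies the two.
larger-first : ∀ {m k N} {X Y : Subset N} → 0 < m → k ≡ m + m → N ≡ suc k →
  IsBipartition X Y → ∣ X ∣ ≡ suc ∣ Y ∣ → (𝒢 : Family k N) → (∀ i → IsBipartite (𝒢 i) X Y) →
  (∀ i → 𝒢 i ρ≥ρ (K[ m , m ] ⊍ K 1)) →
  ¬ ((∀ i j → 𝒢 i ≐ 𝒢 j) × (∀ i → 𝒢 i ≅ (K[ m , m ] ⊍ K 1))) → HasRainbowHamiltonPath 𝒢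
larger-first {m} 0<m k≡m+m refl bip X≡1+Y 𝒢 𝒢-bip spectral =
  rainbow-from-Good 0<m k≡m+m bip coords 𝒢 𝒢-bip λ i → ρ≥ρ-Good 0<m bip coords (𝒢 i) (𝒢-bip i) (spectral i)
  where
  coords : Coordinates m _ _
  coords = coordinates bip (cong suc k≡m+m) X≡1+Y

theorem1p4 : ∀ (n : ℕ) → 2 ≤ n →
    ∀ (X Y : Subset (2 * n ∸ 1)) → IsBipartition X Y → NearlyBalanced X Y →
    ∀ (𝒢 : Family (2 * n ∸ 2) (2 * n ∸ 1)) →
    (∀ i → IsBipartite (𝒢 i) X Y) →
    (∀ i → 𝒢 i ρ≥ρ (K[ n ∸ 1 , n ∸ 1 ] ⊍ K 1)) →
    ¬ ((∀ i j → 𝒢 i ≐ 𝒢 j) × (∀ i → 𝒢 i ≅ (K[ n ∸ 1 , n ∸ 1 ] ⊍ K 1))) →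
    HasRainbowHamiltonPath 𝒢
theorem1p4 (suc m) (s≤s 0<m) X Y bip balanced 𝒢 𝒢-bip = case balanced of λ
  { (inj₁ X≡1+Y) → larger-first 0<m k≡ N≡ bip X≡1+Y 𝒢 𝒢-bip
  ; (inj₂ Y≡1+X) → larger-first 0<m k≡ N≡
      (record { cover = λ v → swap (IsBipartition.cover bip v)
              ; disjoint = λ { v (v∈Y , v∈X) → IsBipartition.disjoint bip v (v∈X , v∈Y) } })
      Y≡1+X 𝒢 (λ i u v e → swap (𝒢-bip i u v e))
  }
  where
  m+1+m : m + suc (m + 0) ≡ suc (m + m)
  m+1+m = trans (ℕ.+-suc m (m + 0)) (cong (λ l → suc (m + l)) (ℕ.+-identityʳ m))
  k≡ : m + suc (m + 0) ∸ 1 ≡ m + m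
  k≡ = cong (_∸ 1) m+1+m
  N≡ : m + suc (m + 0) ≡ suc (m + suc (m + 0) ∸ 1)
  N≡ = trans m+1+m (cong suc (sym k≡))
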